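{- Let $p$ be a prime and $A\subset\mathbb{F}_p$. Suppose that $|A||A-A||A^2-A^2|\le p^2$ and $|A-A|=|A|^{1+\epsilon}$ with $0<\epsilon<1/54$. Then $$|A^2-A^2|\gtrsim |A|^{1+\frac{9-27\epsilon}{17}}.$$
   Context: For sets $X,Y\subset\mathbb{F}_p$, $X-Y:=\{x-y:x\in X,y\in Y\}$, and $A^2:=\{a^2:a\in A\}$, so $A^2-A^2=\{a^2-b^2:a,b\in A\}$. Notation: $X\gtrsim Y$ means that for every $\epsilon'>0$ there is a constant $C_{\epsilon'}$ (independent of $p$) with $Y\le C_{\epsilon'}p^{\epsilon'}X$. -}

module Defs where

open import Data.Nat using (ℕ; _+_; _*_; _∸_; NonZero)
open import Data.Nat.DivMod using (_mod_)
open import Data.Fin using (Fin; toℕ; _≟_)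
open import Data.Fin.Properties using (any?)
open import Data.Fin.Subset using (Subset; _∈_)
open import Data.Fin.Subset.Properties using (_∈?_)
open import Data.Vec using (tabulate)
open import Data.Product using (_×_)
open import Relation.Nullary using (does)
open import Relation.Nullary.Decidable using (_×-dec_)
open import Relation.Binary.PropositionalEquality using (_≡_)

-- The field F_p is modelled by Fin p (residues 0..p-1), with arithmetic mod p.

subF : (p : ℕ) .{{_ : NonZero p}} → Fin p → Fin p → Fin p
subF p x y = (toℕ x + (p ∸ toℕ y)) mod p

sqF : (p : ℕ) .{{_ : NonZero p}} → Fin p → Fin p
sqF p x = (toℕ x * toℕ x) mod p

diffSet : (p : ℕ) .{{_ : NonZero p}} → Subset p → Subset p → Subset p
diffSet p X Y = tabulate λ z →
  does (any? λ x → any? λ y → (x ∈? X) ×-dec ((y ∈? Y) ×-dec (subF p x y ≟ z)))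

sqSet : (p : ℕ) .{{_ : NonZero p}} → Subset p → Subset p
sqSet p A = tabulate λ z → does (any? λ a → (a ∈? A) ×-dec (sqF p a ≟ z))

{-# OPTIONS --safe #-}
module Submission where

-- Write D = |A - A|, S = |A² - A²| and K = D / |A|, and let X ⊆ A minimise |X - A| / |X|. Any b ∈ A is u + c
-- with c ∈ X, u ∈ A - X, so a coincidence b² - y = b′² - y′ lifts to |X|² coincidences of a bilinear form.
-- Fibring these over the slopes u - lc, for a dilate l to be chosen, Cauchy–Schwarz bounds them by a diagonal
-- term of size |X + lX| and by the number of solutions of δ(2t + κ) = y - y′, where the pairs with difference δ
-- and lδ are the scarcer, the larger X + lX is. If y runs through squares, that number is bounded in terms of
-- coincidences b² - w = b′² - w′ with w in a dilate of a sum set of X and lX, to which the same argument applies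
-- with a second dilate. By Petridis's inequality |X + lX| grows by a factor of at most K along l = 0, -1, -2, …,
-- a walk through the whole field, so it attains every size up to min(|X|², p) up to the factor K. With the two
-- sizes chosen well this gives |A|³² ≪ D²⁷ S³. The powers of K are lost many times, but D⁵⁴ < |A|⁵⁵ keeps the
-- result strong enough: it yields |A|⁵³ ≪ S¹⁷ D²⁷.

-- Where the two sizes and the exponents come from: put K = 1, so that D and |X| equal a = |A|, and
-- drop constants. Let f₁, f₂ be the sizes of X + lX for the two dilates, Q the number of solutions
-- of b² - y² = b′² - y′² in A, and N the largest number of solutions of δ(2t + κ) = y² - y′² for
-- one pair. The first fibration gives Q ≪ a f₁ + a² N / f₁. The trivial N ≤ a² would yield at best
-- Q ≪ a^(5/2), hence S ≫ a^(3/2) from a⁴ ≤ SQ, short of the exponent 26/17; this is why N needs a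
-- dilate of its own. That one gives N ≪ f₂ + a² f₁ / f₂, and Q ≪ a f₁ + a² f₂ / f₁ + a⁴ / f₂ is
-- balanced at f₁ = a^(4/3), f₂ = a^(5/3), so S ≫ a^(5/3). With K restored this is S³ ≫ a⁵ / K²⁷,
-- and the claim is S¹⁷ ≫ a²⁶ / K²⁷. Raised to the powers 17 and 3 they differ by a⁷ against K³⁷⁸ =
-- (K⁵⁴)⁷, so K⁵⁴ < a is exactly what the surplus can pay for. In the code, bounds by powers of K
-- are cleared of denominators into products of powers of a and D.

module Counting where

  open import Data.Nat hiding (_≟_)
  open import Data.Nat.Properties hiding (_≟_)
  open import Data.Nat.Solver using (module +-*-Solver)
  open import Data.List.Base using (List; []; _∷_; _++_; length; map; filter; deduplicate; cartesianProduct)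
  open import Data.List.Properties using (length-++; length-map)
  open import Data.List.Membership.Propositional using (_∈_; _∉_)
  open import Data.List.Membership.Propositional.Properties
  import Data.List.Membership.DecPropositional as DecMembership
  open import Data.List.Relation.Unary.Any using (here; there)
  open import Data.List.Relation.Unary.All as All using ([]; _∷_)
  open import Data.List.Relation.Unary.AllPairs using ([]; _∷_)
  open import Data.List.Relation.Unary.Unique.Propositional using (Unique)
  import Data.List.Relation.Unary.Unique.Propositional.Properties as Unique
  open import Data.List.Relation.Unary.Unique.DecPropositional.Properties using (deduplicate-!)
  open import Data.List.Relation.Binary.Subset.Propositional using (_⊆_)
  open import Data.Product using (∃; _×_; _,_; proj₁; proj₂)
  open import Data.Sum using (_⊎_; inj₁; inj₂)
  open import Data.Empty using (⊥-elim)
  open import Function using (_∘_)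
  open import Level using (0ℓ)
  open import Relation.Nullary using (yes; no)
  open import Relation.Nullary.Decidable using (¬?)
  open import Relation.Unary using (Pred; Decidable)
  open import Relation.Binary.Definitions using (DecidableEquality)
  open import Relation.Binary.PropositionalEquality hiding (J)

  private variable
    I J B : Set

  -- Counting by injections, by fibres and by Cauchy-Schwarz.

  length-cartesianProduct : (xs : List I) (ys : List J) →
    length (cartesianProduct xs ys) ≡ length xs * length ys
  length-cartesianProduct []       ys = refl
  length-cartesianProduct (x ∷ xs) ys = begin
    length (map (x ,_) ys ++ cartesianProduct xs ys)            ≡⟨ length-++ (map (x ,_) ys) ⟩
    length (map (x ,_) ys) + length (cartesianProduct xs ys)    ≡⟨ cong₂ _+_ (length-map (x ,_) ys) (length-cartesianProduct xs ys) ⟩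
    length ys + length xs * length ys                           ∎
    where open ≡-Reasoning

  unique-⊆⇒length≤ : {xs ys : List I} → Unique xs → xs ⊆ ys → length xs ≤ length ys
  unique-⊆⇒length≤ {xs = []}     _        _     = z≤n
  unique-⊆⇒length≤ {xs = x ∷ xs} (x∉ ∷ u) sub with ∈-∃++ (sub (here refl))
  ... | ps , qs , refl = begin
    suc (length xs)                ≤⟨ s≤s (unique-⊆⇒length≤ u sub′) ⟩
    suc (length (ps ++ qs))        ≡⟨ cong suc (length-++ ps) ⟩
    suc (length ps + length qs)    ≡⟨ +-suc (length ps) (length qs) ⟨
    length ps + suc (length qs)    ≡⟨ length-++ ps ⟨
    length (ps ++ x ∷ qs)          ∎
    where
    open ≤-Reasoning
    sub′ : xs ⊆ ps ++ qs
    sub′ y∈ with ∈-++⁻ ps (sub (there y∈))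
    ... | inj₁ y∈ps         = ∈-++⁺ˡ y∈ps
    ... | inj₂ (here refl)  = ⊥-elim (All.lookup x∉ y∈ refl)
    ... | inj₂ (there y∈qs) = ∈-++⁺ʳ ps y∈qs

  InjectiveOn : (I → J) → List I → Set
  InjectiveOn f xs = ∀ {x y} → x ∈ xs → y ∈ xs → f x ≡ f y → x ≡ y

  unique-map⁺ : {f : I → J} {xs : List I} → InjectiveOn f xs → Unique xs → Unique (map f xs)
  unique-map⁺ {xs = []}     inj []       = []
  unique-map⁺ {f = f} {xs = x ∷ xs} inj (x∉ ∷ u) =
    All.tabulate fx∉ ∷ unique-map⁺ (λ p q → inj (there p) (there q)) u
    where
    fx∉ : ∀ {y} → y ∈ map f xs → f x ≢ y
    fx∉ y∈ eq with ∈-map⁻ f y∈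
    ... | z , z∈ , refl = All.lookup x∉ z∈ (inj (here refl) (there z∈) eq)

  injection⇒length≤ : (f : I → J) {xs : List I} {ys : List J} → Unique xs →
    (∀ {x} → x ∈ xs → f x ∈ ys) → InjectiveOn f xs → length xs ≤ length ys
  injection⇒length≤ f {xs} {ys} u into inj = begin
    length xs          ≡⟨ length-map f xs ⟨
    length (map f xs)  ≤⟨ unique-⊆⇒length≤ (unique-map⁺ inj u) into′ ⟩
    length ys          ∎
    where
    open ≤-Reasoning
    into′ : map f xs ⊆ ys
    into′ y∈ with ∈-map⁻ f y∈
    ... | x , x∈ , refl = into x∈

  length-filter-split : {P : Pred I 0ℓ} (P? : Decidable P) (xs : List I) →
    length xs ≤ length (filter P? xs) + length (filter (¬? ∘ P?) xs)
  length-filter-split P? []       = z≤n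
  length-filter-split P? (x ∷ xs) with P? x
  ... | yes _ = s≤s (length-filter-split P? xs)
  ... | no  _ = ≤-trans (s≤s (length-filter-split P? xs)) (≤-reflexive (sym (+-suc _ _)))

  fiber : (_≟_ : DecidableEquality B) (h : I → B) (xs : List I) (k : B) → List I
  fiber _≟_ h xs k = filter (λ x → h x ≟ k) xs

  module Fibers (_≟_ : DecidableEquality B) where

    ∈-fiber⁺ : (h : I → B) {xs : List I} {k : B} {x : I} → x ∈ xs → h x ≡ k → x ∈ fiber _≟_ h xs k
    ∈-fiber⁺ h {k = k} = ∈-filter⁺ (λ x → h x ≟ k)

    ∈-fiber⁻ : (h : I → B) {xs : List I} {k : B} {x : I} → x ∈ fiber _≟_ h xs k → x ∈ xs × h x ≡ k
    ∈-fiber⁻ h {k = k} = ∈-filter⁻ (λ x → h x ≟ k)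

    -- The multiplier `m` encodes a fibre bound n / m that need not be an integer.
    length-≤-fibers : (h : I → B) (m n : ℕ) {xs : List I} (ks : List B) →
      (∀ {x} → x ∈ xs → h x ∈ ks) →
      (∀ {k} → k ∈ ks → m * length (fiber _≟_ h xs k) ≤ n) →
      m * length xs ≤ length ks * n
    length-≤-fibers h m n {[]}     []       into bound = ≤-reflexive (*-zeroʳ m)
    length-≤-fibers h m n {x ∷ xs} []       into bound with () ← into (here refl)
    length-≤-fibers h m n {xs}     (k ∷ ks) into bound = begin
      m * length xs                                   ≤⟨ *-monoʳ-≤ m (length-filter-split (λ x → h x ≟ k) xs) ⟩
      m * (length (fiber _≟_ h xs k) + length rest)   ≡⟨ *-distribˡ-+ m _ (length rest) ⟩
      m * length (fiber _≟_ h xs k) + m * length rest ≤⟨ +-mono-≤ (bound (here refl)) (length-≤-fibers h m n ks into′ bound′) ⟩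
      n + length ks * n                               ∎
      where
      open ≤-Reasoning
      rest : List _
      rest = filter (¬? ∘ λ x → h x ≟ k) xs
      rest⊆ : ∀ {x} → x ∈ rest → x ∈ xs × h x ≢ k
      rest⊆ = ∈-filter⁻ (¬? ∘ λ x → h x ≟ k)
      into′ : ∀ {x} → x ∈ rest → h x ∈ ks
      into′ x∈ with into (proj₁ (rest⊆ x∈))
      ... | here eq = ⊥-elim (proj₂ (rest⊆ x∈) eq)
      ... | there p = p
      bound′ : ∀ {j} → j ∈ ks → m * length (fiber _≟_ h rest j) ≤ n
      bound′ {j} j∈ = ≤-trans (*-monoʳ-≤ m (fiber-mono xs)) (bound (there j∈))
        where
        fiber-mono : ∀ zs → length (fiber _≟_ h (filter (¬? ∘ λ x → h x ≟ k) zs) j) ≤ length (fiber _≟_ h zs j)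
        fiber-mono [] = z≤n
        fiber-mono (z ∷ zs) with h z ≟ k
        fiber-mono (z ∷ zs) | yes _ with h z ≟ j
        ... | yes _ = m≤n⇒m≤1+n (fiber-mono zs)
        ... | no  _ = fiber-mono zs
        fiber-mono (z ∷ zs) | no _ with h z ≟ j
        ... | yes _ = s≤s (fiber-mono zs)
        ... | no  _ = fiber-mono zs

    fibers-≤-length : (h : I → B) {n : ℕ} {xs : List I} {ks : List B} → Unique ks →
      (∀ {k} → k ∈ ks → n ≤ length (fiber _≟_ h xs k)) → length ks * n ≤ length xs
    fibers-≤-length h {ks = []}     _        bound = z≤n
    fibers-≤-length h {n} {xs} {k ∷ ks} (k∉ ∷ u) bound = begin
      n + length ks * n                         ≤⟨ +-mono-≤ (bound (here refl)) (fibers-≤-length h {n} {rest} u bound′) ⟩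
      length (fiber _≟_ h xs k) + length rest   ≡⟨ split xs ⟩
      length xs                                 ∎
      where
      open ≤-Reasoning
      rest : List _
      rest = filter (¬? ∘ λ x → h x ≟ k) xs
      split : ∀ zs → length (fiber _≟_ h zs k) + length (filter (¬? ∘ λ x → h x ≟ k) zs) ≡ length zs
      split []       = refl
      split (z ∷ zs) with h z ≟ k
      ... | yes _ = cong suc (split zs)
      ... | no  _ = trans (+-suc _ _) (cong suc (split zs))
      bound′ : ∀ {j} → j ∈ ks → n ≤ length (fiber _≟_ h rest j)
      bound′ {j} j∈ = ≤-trans (bound (there j∈)) (≤-reflexive (same xs))
        where
        same : ∀ zs → length (fiber _≟_ h zs j) ≡ length (fiber _≟_ h (filter (¬? ∘ λ x → h x ≟ k) zs) j)
        same []       = refl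
        same (z ∷ zs) with h z ≟ k | h z ≟ j
        same (z ∷ zs) | yes refl | yes eq = ⊥-elim (All.lookup k∉ j∈ eq)
        same (z ∷ zs) | yes _    | no  _  = same zs
        same (z ∷ zs) | no _     | h≟ with h z ≟ j
        same (z ∷ zs) | no _     | yes _ | yes _ = cong suc (same zs)
        same (z ∷ zs) | no _     | no  _ | no  _ = same zs
        same (z ∷ zs) | no _     | yes e | no ne = ⊥-elim (ne e)
        same (z ∷ zs) | no _     | no ne | yes e = ⊥-elim (ne e)

  maximum-on : (g : B → ℕ) (ks : List B) → ks ≡ [] ⊎ ∃ λ k → k ∈ ks × (∀ {j} → j ∈ ks → g j ≤ g k)
  maximum-on g []       = inj₁ refl
  maximum-on g (k ∷ ks) with maximum-on g ks
  ... | inj₁ refl = inj₂ (k , here refl , λ where (here refl) → ≤-refl)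
  ... | inj₂ (j , j∈ , max) with ≤-total (g j) (g k)
  ...   | inj₁ gj≤gk = inj₂ (k , here refl , λ where
                         (here refl) → ≤-refl
                         (there i∈)  → ≤-trans (max i∈) gj≤gk)
  ...   | inj₂ gk≤gj = inj₂ (j , there j∈ , λ where
                         (here refl) → gk≤gj
                         (there i∈)  → max i∈)

  sumOf : (B → ℕ) → List B → ℕ
  sumOf g []       = 0
  sumOf g (k ∷ ks) = g k + sumOf g ks

  ²-cancel-≤ : ∀ {m n} → m * m ≤ n * n → m ≤ n
  ²-cancel-≤ {m} {n} m²≤n² with m ≤? n
  ... | yes m≤n = m≤n
  ... | no  m≰n = ⊥-elim (<⇒≱ (*-mono-< (≰⇒> m≰n) (≰⇒> m≰n)) m²≤n²)

  m≤n⇒4mn≤[m+n]² : ∀ {m n} → m ≤ n → 4 * (m * n) ≤ (m + n) * (m + n)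
  m≤n⇒4mn≤[m+n]² {m} m≤n with m≤n⇒∃[o]m+o≡n m≤n
  ... | d , refl = ≤-trans (m≤m+n _ (d * d)) (≤-reflexive (solve 2 (λ m d →
      con 4 :* (m :* (m :+ d)) :+ d :* d := (m :+ (m :+ d)) :* (m :+ (m :+ d))) refl m d))
    where open +-*-Solver

  4mn≤[m+n]² : ∀ m n → 4 * (m * n) ≤ (m + n) * (m + n)
  4mn≤[m+n]² m n with ≤-total m n
  ... | inj₁ m≤n = m≤n⇒4mn≤[m+n]² m≤n
  ... | inj₂ n≤m = subst₂ _≤_ (cong (4 *_) (*-comm n m)) (cong₂ _*_ (+-comm n m) (+-comm n m)) (m≤n⇒4mn≤[m+n]² n≤m)

  -- Induction on the list. With P² ≤ RS for the tail, the mixed term 2abP of the square is at most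
  -- a²S + b²R by AM-GM for these two numbers, which is checked after squaring.
  cauchy-schwarz : (r s : B → ℕ) (ks : List B) →
    sumOf (λ k → r k * s k) ks * sumOf (λ k → r k * s k) ks ≤
    sumOf (λ k → r k * r k) ks * sumOf (λ k → s k * s k) ks
  cauchy-schwarz r s []       = z≤n
  cauchy-schwarz r s (k ∷ ks) = begin
    (a * b + P) * (a * b + P)                            ≡⟨ lhs ⟩
    a * a * (b * b) + 2 * (a * b * P) + P * P            ≤⟨ +-mono-≤ (+-monoʳ-≤ (a * a * (b * b)) cross) ih ⟩
    a * a * (b * b) + (a * a * S + b * b * R) + R * S    ≡⟨ rhs ⟩
    (a * a + R) * (b * b + S)                            ∎
    where
    open ≤-Reasoning
    open +-*-Solver
    a = r k
    b = s k
    P = sumOf (λ k → r k * s k) ks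
    R = sumOf (λ k → r k * r k) ks
    S = sumOf (λ k → s k * s k) ks
    ih : P * P ≤ R * S
    ih = cauchy-schwarz r s ks
    lhs : (a * b + P) * (a * b + P) ≡ a * a * (b * b) + 2 * (a * b * P) + P * P
    lhs = solve 3 (λ a b P → (a :* b :+ P) :* (a :* b :+ P) :=
            a :* a :* (b :* b) :+ con 2 :* (a :* b :* P) :+ P :* P) refl a b P
    rhs : a * a * (b * b) + (a * a * S + b * b * R) + R * S ≡ (a * a + R) * (b * b + S)
    rhs = solve 4 (λ a b R S → a :* a :* (b :* b) :+ (a :* a :* S :+ b :* b :* R) :+ R :* S :=
            (a :* a :+ R) :* (b :* b :+ S)) refl a b R S
    cross : 2 * (a * b * P) ≤ a * a * S + b * b * R
    cross = ²-cancel-≤ (begin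
      2 * (a * b * P) * (2 * (a * b * P))          ≡⟨ solve 3 (λ a b P → con 2 :* (a :* b :* P) :* (con 2 :* (a :* b :* P)) :=
                                                        con 4 :* (a :* a :* (b :* b) :* (P :* P))) refl a b P ⟩
      4 * (a * a * (b * b) * (P * P))              ≤⟨ *-monoʳ-≤ 4 (*-monoʳ-≤ (a * a * (b * b)) ih) ⟩
      4 * (a * a * (b * b) * (R * S))              ≡⟨ solve 4 (λ a b R S → con 4 :* (a :* a :* (b :* b) :* (R :* S)) :=
                                                        con 4 :* (a :* a :* S :* (b :* b :* R))) refl a b R S ⟩
      4 * (a * a * S * (b * b * R))                ≤⟨ 4mn≤[m+n]² (a * a * S) (b * b * R) ⟩
      (a * a * S + b * b * R) * (a * a * S + b * b * R) ∎)

  -- Coincidences between the values of two maps.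

  module Collisions (_≟_ : DecidableEquality B) where

    open Fibers _≟_ public

    opaque

      collisions : (I → B) → (J → B) → List I → List J → List (I × J)
      collisions f g is js = filter (λ ij → f (proj₁ ij) ≟ g (proj₂ ij)) (cartesianProduct is js)

      ∈-collisions⁺ : {f : I → B} {g : J → B} {is : List I} {js : List J} {i : I} {j : J} →
        i ∈ is → j ∈ js → f i ≡ g j → (i , j) ∈ collisions f g is js
      ∈-collisions⁺ i∈ j∈ eq = ∈-filter⁺ _ (∈-cartesianProduct⁺ i∈ j∈) eq

      ∈-collisions⁻ : {f : I → B} {g : J → B} {is : List I} {js : List J} {i : I} {j : J} →
        (i , j) ∈ collisions f g is js → i ∈ is × j ∈ js × f i ≡ g j
      ∈-collisions⁻ {is = is} {js} p with ∈-filter⁻ _ p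
      ... | q , eq with ∈-cartesianProduct⁻ is js q
      ...   | i∈ , j∈ = i∈ , j∈ , eq

      collisions-! : {f : I → B} {g : J → B} {is : List I} {js : List J} →
        Unique is → Unique js → Unique (collisions f g is js)
      collisions-! u v = Unique.filter⁺ _ (Unique.cartesianProduct⁺ u v)

    private
      count : (I → B) → List I → B → ℕ
      count f is k = length (fiber _≟_ f is k)

      filter-map-, : (f : I → B) (g : J → B) (i : I) (js : List J) →
        length (filter (λ ij → f (proj₁ ij) ≟ g (proj₂ ij)) (map (i ,_) js)) ≡ count g js (f i)
      filter-map-, f g i []       = refl
      filter-map-, f g i (j ∷ js) with f i ≟ g j | g j ≟ f i
      ... | yes _  | yes _  = cong suc (filter-map-, f g i js)
      ... | no  _  | no  _  = filter-map-, f g i js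
      ... | yes eq | no neq = ⊥-elim (neq (sym eq))
      ... | no neq | yes eq = ⊥-elim (neq (sym eq))

      filter-++-length : {P : Pred I 0ℓ} (P? : Decidable P) (xs ys : List I) →
        length (filter P? (xs ++ ys)) ≡ length (filter P? xs) + length (filter P? ys)
      filter-++-length P? []       ys = refl
      filter-++-length P? (x ∷ xs) ys with P? x
      ... | yes _ = cong suc (filter-++-length P? xs ys)
      ... | no  _ = filter-++-length P? xs ys

      opaque
        unfolding collisions

        collisions-length : (f : I → B) (g : J → B) (is : List I) (js : List J) →
          length (collisions f g is js) ≡ sumOf (λ i → count g js (f i)) is
        collisions-length f g []       js = refl
        collisions-length f g (i ∷ is) js =
          trans (filter-++-length _ (map (i ,_) js) (cartesianProduct is js))
                (cong₂ _+_ (filter-map-, f g i js) (collisions-length f g is js))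

      δ : B → B → ℕ → ℕ
      δ k j n with k ≟ j
      ... | yes _ = n
      ... | no  _ = 0

      sum-δ-∉ : (h : B → ℕ) {k : B} (ks : List B) → k ∉ ks → sumOf (λ j → δ k j (h j)) ks ≡ 0
      sum-δ-∉ h         []       k∉ = refl
      sum-δ-∉ h {k} (j ∷ ks) k∉ with k ≟ j
      ... | yes refl = ⊥-elim (k∉ (here refl))
      ... | no  _    = sum-δ-∉ h ks (k∉ ∘ there)

      sum-δ : (h : B → ℕ) {k : B} {ks : List B} → Unique ks → k ∈ ks → sumOf (λ j → δ k j (h j)) ks ≡ h k
      sum-δ h {k} {j ∷ ks} (j∉ ∷ u) k∈ with k ≟ j
      ... | yes refl = trans (cong (h k +_) (sum-δ-∉ h ks (λ p → All.lookup j∉ p refl))) (+-identityʳ (h k))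
      sum-δ h (j∉ ∷ u) (here eq)  | no neq = ⊥-elim (neq eq)
      sum-δ h (j∉ ∷ u) (there k∈) | no neq = sum-δ h u k∈

      sum-+ : (g h : B → ℕ) (ks : List B) → sumOf (λ k → g k + h k) ks ≡ sumOf g ks + sumOf h ks
      sum-+ g h []       = refl
      sum-+ g h (k ∷ ks) rewrite sum-+ g h ks =
        solve 4 (λ a b c d → a :+ b :+ (c :+ d) := a :+ c :+ (b :+ d)) refl (g k) (h k) (sumOf g ks) (sumOf h ks)
        where open +-*-Solver

      sum-cong : {g h : B → ℕ} (ks : List B) → (∀ k → g k ≡ h k) → sumOf g ks ≡ sumOf h ks
      sum-cong []       eq = refl
      sum-cong (k ∷ ks) eq = cong₂ _+_ (eq k) (sum-cong ks eq)

      -- Regroups a sum over indices by the value of `f`, each index contributing a Kronecker delta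
      -- at its key. This turns a collision count into a sum of products of multiplicities, to which
      -- Cauchy-Schwarz applies.
      sum-by-key : (f : I → B) (h : B → ℕ) (is : List I) {ks : List B} → Unique ks →
        (∀ {i} → i ∈ is → f i ∈ ks) → sumOf (λ i → h (f i)) is ≡ sumOf (λ k → count f is k * h k) ks
      sum-by-key f h []       {ks} u into = sym (zeros ks)
        where
        zeros : ∀ ks → sumOf (λ k → 0) ks ≡ 0
        zeros []       = refl
        zeros (_ ∷ ks) = zeros ks
      sum-by-key f h (i ∷ is) {ks} u into = begin
        h (f i) + sumOf (λ i → h (f i)) is
          ≡⟨ cong₂ _+_ (sym (sum-δ h u (into (here refl)))) (sum-by-key f h is u (into ∘ there)) ⟩
        sumOf (λ k → δ (f i) k (h k)) ks + sumOf (λ k → count f is k * h k) ks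
          ≡⟨ sum-+ _ _ ks ⟨
        sumOf (λ k → δ (f i) k (h k) + count f is k * h k) ks
          ≡⟨ sum-cong ks step ⟩
        sumOf (λ k → count f (i ∷ is) k * h k) ks ∎
        where
        open ≡-Reasoning
        step : ∀ k → δ (f i) k (h k) + count f is k * h k ≡ count f (i ∷ is) k * h k
        step k with f i ≟ k
        ... | yes _ = refl
        ... | no  _ = refl

    -- Cauchy-Schwarz for the multiplicities r, s of the common values: the three counts are the
    -- sums of rs, r² and s². Every energy argument below goes through this lemma.
    collisions-² : (f : I → B) (g : J → B) (is : List I) (js : List J) →
      length (collisions f g is js) * length (collisions f g is js) ≤
      length (collisions f f is is) * length (collisions g g js js)
    collisions-² f g is js = begin
      length (collisions f g is js) * length (collisions f g is js)
        ≡⟨ cong₂ _*_ fg fg ⟩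
      sumOf (λ k → r k * s k) ks * sumOf (λ k → r k * s k) ks
        ≤⟨ cauchy-schwarz r s ks ⟩
      sumOf (λ k → r k * r k) ks * sumOf (λ k → s k * s k) ks
        ≡⟨ cong₂ _*_ ff gg ⟨
      length (collisions f f is is) * length (collisions g g js js) ∎
      where
      open ≤-Reasoning
      ks : List B
      ks = deduplicate _≟_ (map f is ++ map g js)
      r s : B → ℕ
      r = count f is
      s = count g js
      u : Unique ks
      u = deduplicate-! _≟_ _
      f∈ : ∀ {i} → i ∈ is → f i ∈ ks
      f∈ i∈ = ∈-deduplicate⁺ _≟_ (∈-++⁺ˡ (∈-map⁺ f i∈))
      g∈ : ∀ {j} → j ∈ js → g j ∈ ks
      g∈ j∈ = ∈-deduplicate⁺ _≟_ (∈-++⁺ʳ (map f is) (∈-map⁺ g j∈))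
      fg : length (collisions f g is js) ≡ sumOf (λ k → r k * s k) ks
      fg = trans (collisions-length f g is js) (sum-by-key f s is u f∈)
      ff : length (collisions f f is is) ≡ sumOf (λ k → r k * r k) ks
      ff = trans (collisions-length f f is is) (sum-by-key f r is u f∈)
      gg : length (collisions g g js js) ≡ sumOf (λ k → s k * s k) ks
      gg = trans (collisions-length g g js js) (sum-by-key g s js u g∈)

  -- Cardinality of the set underlying a list.

  module Cardinality (_≟_ : DecidableEquality B) where

    open DecMembership _≟_ using (_∈?_)

    set : List B → List B
    set = deduplicate _≟_

    set-! : ∀ xs → Unique (set xs)
    set-! = deduplicate-! _≟_

    ∈-set⁺ : ∀ {xs x} → x ∈ xs → x ∈ set xs
    ∈-set⁺ = ∈-deduplicate⁺ _≟_

    ∈-set⁻ : ∀ {xs x} → x ∈ set xs → x ∈ xs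
    ∈-set⁻ {xs} = ∈-deduplicate⁻ _≟_ xs

    private
      split-! : ∀ (R : List B) {xs ys} → Unique xs → Unique ys → (∀ {x} → x ∈ xs → x ∈ ys → x ∈ R) →
        Unique (xs ++ filter (¬? ∘ (_∈? R)) ys)
      split-! R {xs} {ys} u v disj = Unique.++⁺ u (Unique.filter⁺ _ v) λ (p , q) →
        let q∈ , q∉ = ∈-filter⁻ (¬? ∘ (_∈? R)) {xs = ys} q in q∉ (disj p q∈)

    opaque

      -- Sum sets below are lists with repetitions; counting distinct entries spares normalising
      -- them at each step.
      card : List B → ℕ
      card xs = length (set xs)

      card-mono : ∀ {xs ys} → xs ⊆ ys → card xs ≤ card ys
      card-mono {xs} sub = unique-⊆⇒length≤ (set-! xs) (∈-set⁺ ∘ sub ∘ ∈-set⁻)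

      card≤length : ∀ {xs ys} → xs ⊆ ys → card xs ≤ length ys
      card≤length {xs} sub = unique-⊆⇒length≤ (set-! xs) (sub ∘ ∈-set⁻)

      length≤card : ∀ {xs ys} → Unique xs → xs ⊆ ys → length xs ≤ card ys
      length≤card u sub = unique-⊆⇒length≤ u (∈-set⁺ ∘ sub)

      card-unique : ∀ {xs} → Unique xs → card xs ≡ length xs
      card-unique {xs} u = ≤-antisym (card≤length {xs} (λ x → x)) (length≤card {ys = xs} u (λ x → x))

      card-injection : (f : B → B) {xs ys : List B} → (∀ {x} → x ∈ xs → f x ∈ ys) → InjectiveOn f xs → card xs ≤ card ys
      card-injection f {xs} into inj =
        injection⇒length≤ f (set-! xs) (∈-set⁺ ∘ into ∘ ∈-set⁻) (λ p q → inj (∈-set⁻ p) (∈-set⁻ q))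

      card-image : (f : I → B) {xs : List I} {ys : List B} → (∀ {y} → y ∈ ys → ∃ λ x → x ∈ xs × y ≡ f x) → card ys ≤ length xs
      card-image f {xs} {ys} onto = ≤-trans (card≤length sub) (≤-reflexive (length-map f xs))
        where
        sub : ys ⊆ map f xs
        sub y∈ with onto y∈
        ... | x , x∈ , refl = ∈-map⁺ f x∈

      -- This and `card-supermodular` are the two halves of inclusion-exclusion, with inclusions in
      -- place of a union W and an intersection R. In both, Q is split into R and the rest. They
      -- feed the induction in Petridis's inequality.
      card-submodular : ∀ {W P Q R} → W ⊆ P ++ Q → R ⊆ P → R ⊆ Q → card W + card R ≤ card P + card Q
      card-submodular {W} {P} {Q} {R} W⊆ R⊆P R⊆Q = begin
        card W + card R                    ≤⟨ +-monoˡ-≤ (card R) W≤ ⟩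
        card P + length Q∖R + card R       ≡⟨ +-assoc (card P) (length Q∖R) (card R) ⟩
        card P + (length Q∖R + card R)     ≤⟨ +-monoʳ-≤ (card P) Q≥ ⟩
        card P + card Q                    ∎
        where
        open ≤-Reasoning
        Q∖R : List B
        Q∖R = filter (¬? ∘ (_∈? R)) (set Q)
        W⊆′ : W ⊆ set P ++ Q∖R
        W⊆′ {x} x∈ with ∈-++⁻ P (W⊆ x∈) | x ∈? R
        ... | inj₁ p | _     = ∈-++⁺ˡ (∈-set⁺ p)
        ... | inj₂ q | yes r = ∈-++⁺ˡ (∈-set⁺ (R⊆P r))
        ... | inj₂ q | no ¬r = ∈-++⁺ʳ (set P) (∈-filter⁺ _ (∈-set⁺ q) ¬r)
        W≤ : card W ≤ card P + length Q∖R
        W≤ = ≤-trans (card≤length W⊆′) (≤-reflexive (length-++ (set P)))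
        Q≥ : length Q∖R + card R ≤ card Q
        Q≥ = begin
          length Q∖R + card R       ≡⟨ +-comm _ (card R) ⟩
          card R + length Q∖R       ≡⟨ length-++ (set R) ⟨
          length (set R ++ Q∖R)    ≤⟨ length≤card (split-! R (set-! R) (set-! Q) (λ p _ → ∈-set⁻ p)) sub ⟩
          card Q                    ∎
          where
          sub : set R ++ Q∖R ⊆ Q
          sub x∈ with ∈-++⁻ (set R) x∈
          ... | inj₁ r = R⊆Q (∈-set⁻ r)
          ... | inj₂ q = ∈-set⁻ (proj₁ (∈-filter⁻ _ {xs = set Q} q))

      card-supermodular : ∀ {W P Q R} → P ⊆ W → Q ⊆ W → (∀ {x} → x ∈ P → x ∈ Q → x ∈ R) → card P + card Q ≤ card W + card R
      card-supermodular {W} {P} {Q} {R} P⊆ Q⊆ P∩Q⊆R = begin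
        card P + card Q                    ≤⟨ +-monoʳ-≤ (card P) Q≤ ⟩
        card P + (length Q∖R + card R)     ≡⟨ +-assoc (card P) (length Q∖R) (card R) ⟨
        card P + length Q∖R + card R       ≤⟨ +-monoˡ-≤ (card R) W≥ ⟩
        card W + card R                    ∎
        where
        open ≤-Reasoning
        Q∖R : List B
        Q∖R = filter (¬? ∘ (_∈? R)) (set Q)
        Q⊆′ : Q ⊆ Q∖R ++ set R
        Q⊆′ {x} x∈ with x ∈? R
        ... | yes r = ∈-++⁺ʳ Q∖R (∈-set⁺ r)
        ... | no ¬r = ∈-++⁺ˡ (∈-filter⁺ _ (∈-set⁺ x∈) ¬r)
        Q≤ : card Q ≤ length Q∖R + card R
        Q≤ = ≤-trans (card≤length Q⊆′) (≤-reflexive (length-++ Q∖R))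
        W≥ : card P + length Q∖R ≤ card W
        W≥ = ≤-trans (≤-reflexive (sym (length-++ (set P))))
               (length≤card (split-! R (set-! P) (set-! Q) (λ p q → P∩Q⊆R (∈-set⁻ p) (∈-set⁻ q))) sub)
          where
          sub : set P ++ Q∖R ⊆ W
          sub x∈ with ∈-++⁻ (set P) x∈
          ... | inj₁ p = P⊆ (∈-set⁻ p)
          ... | inj₂ q = Q⊆ (∈-set⁻ (proj₁ (∈-filter⁻ _ {xs = set Q} q)))

      card-surjection : (f : B → B) {xs ys : List B} → (∀ {y} → y ∈ ys → ∃ λ x → x ∈ xs × y ≡ f x) → card ys ≤ card xs
      card-surjection f onto = card-image f λ y∈ → let x , x∈ , eq = onto y∈ in x , ∈-set⁺ x∈ , eq

      card-[] : card [] ≡ 0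
      card-[] = refl

      ∈⇒0<card : ∀ {xs x} → x ∈ xs → 0 < card xs
      ∈⇒0<card x∈ = ∈-length (∈-set⁺ x∈)

      card-set : ∀ xs → length (set xs) ≡ card xs
      card-set xs = refl

    -- One representative per value of `f`: values can then be counted by an injection that is
    -- defined on their representatives.
    transversal : (f : I → B) (xs : List I) → ∃ λ ys →
      ys ⊆ xs × Unique (map f ys) × (∀ {x} → x ∈ xs → f x ∈ map f ys)
    transversal f []       = [] , (λ p → p) , [] , λ ()
    transversal f (x ∷ xs) with transversal f xs
    ... | ys , sub , u , onto with f x ∈? map f ys
    ...   | yes p = ys , there ∘ sub , u , λ where
                      (here refl) → p
                      (there q)   → onto q
    ...   | no ¬p = x ∷ ys , ∷⊆∷ , All.tabulate (λ y∈ eq → ¬p (subst (_∈ map f ys) (sym eq) y∈)) ∷ u , λ where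
                      (here refl) → here refl
                      (there q)   → there (onto q)
      where
      ∷⊆∷ : x ∷ ys ⊆ x ∷ xs
      ∷⊆∷ (here eq) = here eq
      ∷⊆∷ (there q) = there (sub q)

  unique-map⇒injectiveOn : (f : I → J) {xs : List I} → Unique (map f xs) → InjectiveOn f xs
  unique-map⇒injectiveOn f u         (here refl) (here refl) eq = refl
  unique-map⇒injectiveOn f (x∉ ∷ u) (here refl) (there q)   eq = ⊥-elim (All.lookup x∉ (∈-map⁺ f q) eq)
  unique-map⇒injectiveOn f (x∉ ∷ u) (there p)   (here refl) eq = ⊥-elim (All.lookup x∉ (∈-map⁺ f p) (sym eq))
  unique-map⇒injectiveOn f (_ ∷ u)  (there p)   (there q)   eq = unique-map⇒injectiveOn f u p q eq

  -- Minimising a ratio over the sublists of a list.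

  -- Ratios are compared by cross-multiplication; positivity of `den` is what makes this comparison
  -- transitive.
  minimal-ratio : (num den : I → ℕ) (c : I) (cs : List I) → (∀ {i} → i ∈ c ∷ cs → 0 < den i) →
    ∃ λ m → m ∈ c ∷ cs × (∀ {i} → i ∈ c ∷ cs → num m * den i ≤ num i * den m)
  minimal-ratio num den c []       pos = c , here refl , λ where (here refl) → ≤-refl
  minimal-ratio num den c (b ∷ cs) pos with minimal-ratio num den b cs (pos ∘ there)
  ... | m , m∈ , min with ≤-total (num c * den m) (num m * den c)
  ...   | inj₂ m≤c = m , there m∈ , λ where
                       (here refl) → m≤c
                       (there i∈)  → min i∈
  ...   | inj₁ c≤m = c , here refl , below
    where
    below : ∀ {i} → i ∈ c ∷ b ∷ cs → num c * den i ≤ num i * den c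
    below     (here refl) = ≤-refl
    below {i} (there i∈)  =
      trans-ratio {num c} {den c} {num m} {den m} {num i} {den i} (pos (there m∈)) c≤m (min i∈)
      where
      trans-ratio : ∀ {n₁ d₁ n₂ d₂ n₃ d₃} → 0 < d₂ → n₁ * d₂ ≤ n₂ * d₁ → n₂ * d₃ ≤ n₃ * d₂ → n₁ * d₃ ≤ n₃ * d₁
      trans-ratio {n₁} {d₁} {n₂} {d₂} {n₃} {d₃} 0<d₂ p q = *-cancelʳ-≤ (n₁ * d₃) (n₃ * d₁) d₂ {{>-nonZero 0<d₂}} (begin
        n₁ * d₃ * d₂    ≡⟨ solve 3 (λ a b c → a :* b :* c := a :* c :* b) refl n₁ d₃ d₂ ⟩
        n₁ * d₂ * d₃    ≤⟨ *-monoˡ-≤ d₃ p ⟩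
        n₂ * d₁ * d₃    ≡⟨ solve 3 (λ a b c → a :* b :* c := a :* c :* b) refl n₂ d₁ d₃ ⟩
        n₂ * d₃ * d₁    ≤⟨ *-monoˡ-≤ d₁ q ⟩
        n₃ * d₂ * d₁    ≡⟨ solve 3 (λ a b c → a :* b :* c := a :* c :* b) refl n₃ d₂ d₁ ⟩
        n₃ * d₁ * d₂    ∎)
        where
        open ≤-Reasoning
        open +-*-Solver

  -- The search space for X: a finite family that contains A and is closed under `filter`, the two
  -- properties on which the minimality of X rests.
  subsequences : List I → List (List I)
  subsequences []       = [] ∷ []
  subsequences (x ∷ xs) = map (x ∷_) (subsequences xs) ++ subsequences xs

  self∈subsequences : (xs : List I) → xs ∈ subsequences xs
  self∈subsequences []       = here refl
  self∈subsequences (x ∷ xs) = ∈-++⁺ˡ (∈-map⁺ (x ∷_) (self∈subsequences xs))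

  filter∈subsequences : {P : Pred I 0ℓ} (P? : Decidable P) (xs : List I) {ys : List I} →
    ys ∈ subsequences xs → filter P? ys ∈ subsequences xs
  filter∈subsequences P? []       (here refl) = here refl
  filter∈subsequences P? (x ∷ xs) ys∈ with ∈-++⁻ (map (x ∷_) (subsequences xs)) ys∈
  ... | inj₂ p = ∈-++⁺ʳ (map (x ∷_) (subsequences xs)) (filter∈subsequences P? xs p)
  ... | inj₁ p with ∈-map⁻ (x ∷_) p
  ...   | zs , zs∈ , refl with P? x
  ...     | yes _ = ∈-++⁺ˡ (∈-map⁺ (x ∷_) (filter∈subsequences P? xs zs∈))
  ...     | no  _ = ∈-++⁺ʳ (map (x ∷_) (subsequences xs)) (filter∈subsequences P? xs zs∈)

  subsequences⇒⊆ : (xs : List I) {ys : List I} → ys ∈ subsequences xs → ys ⊆ xs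
  subsequences⇒⊆ []       (here refl) ()
  subsequences⇒⊆ (x ∷ xs) ys∈ y∈ with ∈-++⁻ (map (x ∷_) (subsequences xs)) ys∈
  ... | inj₂ p = there (subsequences⇒⊆ xs p y∈)
  ... | inj₁ p with ∈-map⁻ (x ∷_) p
  ...   | zs , zs∈ , refl with y∈
  ...     | here eq = here eq
  ...     | there q = there (subsequences⇒⊆ xs zs∈ q)

  subsequences-! : {xs ys : List I} → Unique xs → ys ∈ subsequences xs → Unique ys
  subsequences-! {xs = []}     []       (here refl) = []
  subsequences-! {xs = x ∷ xs} (x∉ ∷ u) ys∈ with ∈-++⁻ (map (x ∷_) (subsequences xs)) ys∈
  ... | inj₂ p = subsequences-! u p
  ... | inj₁ p with ∈-map⁻ (x ∷_) p
  ...   | zs , zs∈ , refl = All.tabulate (λ q → All.lookup x∉ (subsequences⇒⊆ xs zs∈ q)) ∷ subsequences-! u zs∈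

-- Inequalities between powers of |A|, |A - A|, |A² - A²| and p.

module Exponents where

  open import Data.Nat
  open import Data.Nat.Properties
  open import Data.Nat.Solver using (module +-*-Solver)
  open import Data.Bool using (T)
  open import Data.Empty using (⊥; ⊥-elim)
  open import Relation.Nullary using (yes; no)
  open import Data.Sum using (_⊎_; inj₁; inj₂)
  open import Relation.Binary.PropositionalEquality hiding (J)

  -- Opaque, because numerals of this size are expensive to compare.
  opaque
    constant : ℕ
    constant = 100 ^ 3

    ≤constant : ∀ k → {T (k ≤ᵇ 100 ^ 3)} → k ≤ constant
    ≤constant k {k≤} = ≤ᵇ⇒≤ k (100 ^ 3) k≤

  module ExponentArithmetic {a D x S : ℕ} (0<a : 0 < a) (0<S : 0 < S) (0<x : 0 < x) (x≤a : x ≤ a)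
    (a≤D : a ≤ D) (a²≤Dx : a * a ≤ D * x) (a≤2S : a ≤ 2 * S) (D⁵⁴≤a⁵⁵ : D ^ 54 ≤ a ^ 55) where

    open ≤-Reasoning
    open +-*-Solver

    Conclusion : Set
    Conclusion = a ^ 32 ≤ constant * (D ^ 27 * S ^ 3)

    private
      cancelʳ : ∀ {m n} k → 0 < k → m * k ≤ n * k → m ≤ n
      cancelʳ k 0<k = *-cancelʳ-≤ _ _ k {{>-nonZero 0<k}}

      ^-pos : ∀ {m} k → 0 < m → 0 < m ^ k
      ^-pos k 0<m = m^n>0 _ {{>-nonZero 0<m}} k

      0<D : 0 < D
      0<D = ≤-trans 0<a a≤D

      -- That is, K^k ≤ a for k ≤ 54. Multiplying by a^j ≤ D^j completes the exponent of D to the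
      -- one in the hypothesis.
      D^k≤a^k+1 : ∀ k j → k + j ≡ 54 → D ^ k ≤ a ^ suc k
      D^k≤a^k+1 k j eq = cancelʳ (a ^ j) (^-pos j 0<a) (begin
        D ^ k * a ^ j       ≤⟨ *-monoʳ-≤ (D ^ k) (^-monoˡ-≤ j a≤D) ⟩
        D ^ k * D ^ j       ≡⟨ ^-distribˡ-+-* D k j ⟨
        D ^ (k + j)         ≡⟨ cong (D ^_) eq ⟩
        D ^ 54              ≤⟨ D⁵⁴≤a⁵⁵ ⟩
        a ^ 55              ≡⟨ cong (λ e → a ^ suc e) eq ⟨
        a ^ (suc k + j)     ≡⟨ ^-distribˡ-+-* a (suc k) j ⟩
        a ^ suc k * a ^ j   ∎)

      weaken : ∀ {k} → k ≤ constant → a ^ 32 ≤ k * (D ^ 27 * S ^ 3) → Conclusion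
      weaken k≤ p = ≤-trans p (*-monoˡ-≤ (D ^ 27 * S ^ 3) k≤)

      cube : ∀ {m n} k → m ≤ k * n → m ^ 3 ≤ k ^ 3 * n ^ 3
      cube {m} {n} k p = ≤-trans (^-monoˡ-≤ 3 p)
        (≤-reflexive (solve 2 (λ k n → (k :* n) :^ 3 := k :^ 3 :* n :^ 3) refl k n))

    -- The hypothesis says F ≥ px² / (p + x²), which is at least half the smaller of x² and p.
    dichotomy : ∀ {p F} → 0 < p → p * (x * x) ≤ F * (p + x * x) → x * x ≤ 2 * F ⊎ p ≤ 2 * F
    dichotomy {p} {F} 0<p h with ≤-total (x * x) p
    ... | inj₁ x²≤p = inj₁ (cancelʳ p 0<p (begin
      x * x * p              ≡⟨ *-comm (x * x) p ⟩
      p * (x * x)            ≤⟨ h ⟩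
      F * (p + x * x)        ≤⟨ *-monoʳ-≤ F (+-monoʳ-≤ p x²≤p) ⟩
      F * (p + p)            ≡⟨ solve 2 (λ F p → F :* (p :+ p) := con 2 :* F :* p) refl F p ⟩
      2 * F * p              ∎))
    ... | inj₂ p≤x² = inj₂ (cancelʳ (x * x) (*-mono-< 0<x 0<x) (begin
      p * (x * x)            ≤⟨ h ⟩
      F * (p + x * x)        ≤⟨ *-monoʳ-≤ F (+-monoˡ-≤ (x * x) p≤x²) ⟩
      F * (x * x + x * x)    ≡⟨ solve 2 (λ F y → F :* (y :+ y) := con 2 :* F :* y) refl F (x * x) ⟩
      2 * F * (x * x)        ∎))

    -- The numerical constants are kept as variables k until the last moment: the solver
    -- would otherwise unfold them.
    private
      from-a¹⁷ : ∀ k → k ^ 3 ≤ constant → a ^ 17 ≤ k * (D ^ 15 * S) → Conclusion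
      from-a¹⁷ k k³≤ h = weaken k³≤ (cancelʳ (a ^ 19) (^-pos 19 0<a) (begin
        a ^ 32 * a ^ 19                        ≡⟨ solve 1 (λ a → a :^ 32 :* a :^ 19 := (a :^ 17) :^ 3) refl a ⟩
        (a ^ 17) ^ 3                           ≤⟨ cube k h ⟩
        k ^ 3 * (D ^ 15 * S) ^ 3               ≡⟨ solve 3 (λ k D S → k :* (D :^ 15 :* S) :^ 3 := k :* (D :^ 27 :* S :^ 3) :* D :^ 18) refl (k ^ 3) D S ⟩
        k ^ 3 * (D ^ 27 * S ^ 3) * D ^ 18      ≤⟨ *-monoʳ-≤ (k ^ 3 * (D ^ 27 * S ^ 3)) (D^k≤a^k+1 18 36 refl) ⟩
        k ^ 3 * (D ^ 27 * S ^ 3) * a ^ 19      ∎))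

      -- In terms of K: S ≥ a² / (kK²⁵) implies S³ ≫ a⁵ / K²⁷ as soon as K⁴⁸ ≤ a. This is the
      -- largest power of K used up before the final conversion.
      from-a²⁷ : ∀ k → k ^ 3 ≤ constant → a ^ 27 ≤ k * (D ^ 25 * S) → Conclusion
      from-a²⁷ k k³≤ h = weaken k³≤ (cancelʳ (a ^ 49) (^-pos 49 0<a) (begin
        a ^ 32 * a ^ 49                        ≡⟨ solve 1 (λ a → a :^ 32 :* a :^ 49 := (a :^ 27) :^ 3) refl a ⟩
        (a ^ 27) ^ 3                           ≤⟨ cube k h ⟩
        k ^ 3 * (D ^ 25 * S) ^ 3               ≡⟨ solve 3 (λ k D S → k :* (D :^ 25 :* S) :^ 3 := k :* (D :^ 27 :* S :^ 3) :* D :^ 48) refl (k ^ 3) D S ⟩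
        k ^ 3 * (D ^ 27 * S ^ 3) * D ^ 48      ≤⟨ *-monoʳ-≤ (k ^ 3 * (D ^ 27 * S ^ 3)) (D^k≤a^k+1 48 6 refl) ⟩
        k ^ 3 * (D ^ 27 * S ^ 3) * a ^ 49      ∎))

      from-a⁴ : ∀ k → k ^ 3 ≤ constant → a ^ 4 ≤ k * (D ^ 2 * S) → Conclusion
      from-a⁴ k k³≤ h = weaken k³≤ (begin
        a ^ 32                                 ≡⟨ solve 1 (λ a → a :^ 32 := (a :^ 4) :^ 3 :* a :^ 20) refl a ⟩
        (a ^ 4) ^ 3 * a ^ 20                   ≤⟨ *-mono-≤ (cube k h) (≤-trans (^-monoˡ-≤ 20 a≤D) (^-monoʳ-≤ D {{>-nonZero 0<D}} {20} {21} (n≤1+n 20))) ⟩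
        k ^ 3 * (D ^ 2 * S) ^ 3 * D ^ 21       ≡⟨ solve 3 (λ k D S → k :* (D :^ 2 :* S) :^ 3 :* D :^ 21 := k :* (D :^ 27 :* S :^ 3)) refl (k ^ 3) D S ⟩
        k ^ 3 * (D ^ 27 * S ^ 3)               ∎)

      -- Only S² is at hand; the third factor S comes from a ≤ 2S.
      from-a²⁸ : ∀ k → k * 2 ≤ constant → a ^ 28 ≤ k * (D ^ 24 * S ^ 2) → Conclusion
      from-a²⁸ k 2k≤ h = weaken 2k≤ (begin
        a ^ 32                                 ≡⟨ solve 1 (λ a → a :^ 32 := a :^ 28 :* a :* a :^ 3) refl a ⟩
        a ^ 28 * a * a ^ 3                     ≤⟨ *-mono-≤ (*-mono-≤ h a≤2S) (^-monoˡ-≤ 3 a≤D) ⟩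
        k * (D ^ 24 * S ^ 2) * (2 * S) * D ^ 3 ≡⟨ solve 3 (λ k D S → k :* (D :^ 24 :* S :^ 2) :* (con 2 :* S) :* D :^ 3 := k :* con 2 :* (D :^ 27 :* S :^ 3)) refl k D S ⟩
        k * 2 * (D ^ 27 * S ^ 3)               ∎)

      -- Here and in `from-pa²⁶` the bound on p is squared, so that p² can be replaced by the
      -- smaller aDS; one factor DS then cancels.
      from-pa¹³ : ∀ {p} k → a * D * S ≤ p ^ 2 → (k * k) ^ 3 ≤ constant → p * a ^ 13 ≤ k * (D ^ 13 * S) → Conclusion
      from-pa¹³ {p} k aDS≤p² k≤ h = from-a²⁷ (k * k) k≤ (cancelʳ (D * S) (*-mono-< 0<D 0<S) (begin
        a ^ 27 * (D * S)                       ≡⟨ solve 3 (λ a D S → a :^ 27 :* (D :* S) := a :* D :* S :* (a :^ 13 :* a :^ 13)) refl a D S ⟩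
        a * D * S * (a ^ 13 * a ^ 13)          ≤⟨ *-monoˡ-≤ (a ^ 13 * a ^ 13) aDS≤p² ⟩
        p ^ 2 * (a ^ 13 * a ^ 13)              ≡⟨ solve 2 (λ p a → p :^ 2 :* (a :^ 13 :* a :^ 13) := p :* a :^ 13 :* (p :* a :^ 13)) refl p a ⟩
        p * a ^ 13 * (p * a ^ 13)              ≤⟨ *-mono-≤ h h ⟩
        k * (D ^ 13 * S) * (k * (D ^ 13 * S))  ≡⟨ solve 3 (λ k D S → k :* (D :^ 13 :* S) :* (k :* (D :^ 13 :* S)) := k :* k :* (D :^ 25 :* S) :* (D :* S)) refl k D S ⟩
        k * k * (D ^ 25 * S) * (D * S)         ∎))

      from-pa²⁶ : ∀ {p} k → a * D * S ≤ p ^ 2 → k * k ≤ constant → p * a ^ 26 ≤ k * (D ^ 24 * S ^ 2) → Conclusion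
      from-pa²⁶ {p} k aDS≤p² k≤ h = weaken k≤ (cancelʳ (a ^ 21 * (D * S)) (*-mono-< (^-pos 21 0<a) (*-mono-< 0<D 0<S)) (begin
        a ^ 32 * (a ^ 21 * (D * S))            ≡⟨ solve 3 (λ a D S → a :^ 32 :* (a :^ 21 :* (D :* S)) := a :* D :* S :* (a :^ 26 :* a :^ 26)) refl a D S ⟩
        a * D * S * (a ^ 26 * a ^ 26)          ≤⟨ *-monoˡ-≤ (a ^ 26 * a ^ 26) aDS≤p² ⟩
        p ^ 2 * (a ^ 26 * a ^ 26)              ≡⟨ solve 2 (λ p a → p :^ 2 :* (a :^ 26 :* a :^ 26) := p :* a :^ 26 :* (p :* a :^ 26)) refl p a ⟩
        p * a ^ 26 * (p * a ^ 26)              ≤⟨ *-mono-≤ h h ⟩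
        k * (D ^ 24 * S ^ 2) * (k * (D ^ 24 * S ^ 2))
          ≡⟨ solve 3 (λ k D S → k :* (D :^ 24 :* S :^ 2) :* (k :* (D :^ 24 :* S :^ 2)) := k :* k :* (D :^ 27 :* S :^ 3) :* (D :^ 20 :* (D :* S))) refl k D S ⟩
        k * k * (D ^ 27 * S ^ 3) * (D ^ 20 * (D * S)) ≤⟨ *-monoʳ-≤ (k * k * (D ^ 27 * S ^ 3)) (*-monoˡ-≤ (D * S) (D^k≤a^k+1 20 34 refl)) ⟩
        k * k * (D ^ 27 * S ^ 3) * (a ^ 21 * (D * S)) ∎))

    -- k stands for 5.
    module _ (k : ℕ) where

      -- The case in which the size F found by averaging misses the threshold 5D¹³S / a¹³ for f₂. As
      -- F is at least half of x² or of p, S is then large at once; x² is traded for a⁴ / D² by a² ≤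
      -- Dx.
      no-second-dilate : ∀ {p F} → 0 < p → a * D * S ≤ p ^ 2 → p * (x * x) ≤ F * (p + x * x) →
        (2 * k * (2 * k)) ^ 3 ≤ constant → (2 * k) ^ 3 ≤ constant →
        F * a ^ 13 ≤ k * D ^ 13 * S → Conclusion
      no-second-dilate {p} {F} 0<p aDS≤p² spread k₁ k₂ small with dichotomy {p} {F} 0<p spread
      ... | inj₁ x²≤2F = from-a¹⁷ (2 * k) k₂ (begin
        a ^ 17                               ≡⟨ solve 1 (λ a → a :^ 17 := a :* a :* (a :* a) :* a :^ 13) refl a ⟩
        a * a * (a * a) * a ^ 13             ≤⟨ *-monoˡ-≤ (a ^ 13) (*-mono-≤ a²≤Dx a²≤Dx) ⟩
        D * x * (D * x) * a ^ 13             ≡⟨ solve 3 (λ D x a → D :* x :* (D :* x) :* a :^ 13 := D :^ 2 :* (x :* x :* a :^ 13)) refl D x a ⟩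
        D ^ 2 * (x * x * a ^ 13)             ≤⟨ *-monoʳ-≤ (D ^ 2) (*-monoˡ-≤ (a ^ 13) x²≤2F) ⟩
        D ^ 2 * (2 * F * a ^ 13)             ≡⟨ solve 3 (λ D F a → D :^ 2 :* (con 2 :* F :* a :^ 13) := con 2 :* D :^ 2 :* (F :* a :^ 13)) refl D F a ⟩
        2 * D ^ 2 * (F * a ^ 13)             ≤⟨ *-monoʳ-≤ (2 * D ^ 2) small ⟩
        2 * D ^ 2 * (k * D ^ 13 * S)         ≡⟨ solve 3 (λ k D S → con 2 :* D :^ 2 :* (k :* D :^ 13 :* S) := con 2 :* k :* (D :^ 15 :* S)) refl k D S ⟩
        2 * k * (D ^ 15 * S)                 ∎)
      ... | inj₂ p≤2F = from-pa¹³ {p} (2 * k) aDS≤p² k₁ (begin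
        p * a ^ 13                           ≤⟨ *-monoˡ-≤ (a ^ 13) p≤2F ⟩
        2 * F * a ^ 13                       ≡⟨ *-assoc 2 F (a ^ 13) ⟩
        2 * (F * a ^ 13)                     ≤⟨ *-monoʳ-≤ 2 small ⟩
        2 * (k * D ^ 13 * S)                 ≡⟨ solve 3 (λ k D S → con 2 :* (k :* D :^ 13 :* S) := con 2 :* k :* (D :^ 13 :* S)) refl k D S ⟩
        2 * k * (D ^ 13 * S)                 ∎)

      -- Here F misses the threshold for f₁, which contains f₂ as a factor. The bound on f₂ brings
      -- in a second S, and if x² ≤ 2F the factor x² of the threshold cancels.
      no-first-dilate : ∀ {p F f₂} → 0 < p → a * D * S ≤ p ^ 2 → p * (x * x) ≤ F * (p + x * x) →
        2 * (k * k) * 2 ≤ constant → 2 * (k * k) * (2 * (k * k)) ≤ constant →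
        f₂ * a ^ 14 ≤ k * D ^ 14 * S → F * a ^ 14 ≤ k * D ^ 10 * x ^ 2 * S * f₂ → Conclusion
      no-first-dilate {p} {F} {f₂} 0<p aDS≤p² spread k₁ k₂ f₂≤ small = by-cases (dichotomy {p} {F} 0<p spread)
        where
        2Fa²⁸≤ : 2 * F * a ^ 28 ≤ 2 * (k * k) * (D ^ 24 * S ^ 2) * (x * x)
        2Fa²⁸≤ = begin
          2 * F * a ^ 28                                ≡⟨ solve 2 (λ F a → con 2 :* F :* a :^ 28 := con 2 :* (F :* a :^ 14 :* a :^ 14)) refl F a ⟩
          2 * (F * a ^ 14 * a ^ 14)                     ≤⟨ *-monoʳ-≤ 2 (*-monoˡ-≤ (a ^ 14) small) ⟩
          2 * (k * D ^ 10 * x ^ 2 * S * f₂ * a ^ 14)    ≡⟨ cong (2 *_) (*-assoc (k * D ^ 10 * x ^ 2 * S) f₂ (a ^ 14)) ⟩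
          2 * (k * D ^ 10 * x ^ 2 * S * (f₂ * a ^ 14))  ≤⟨ *-monoʳ-≤ 2 (*-monoʳ-≤ (k * D ^ 10 * x ^ 2 * S) f₂≤) ⟩
          2 * (k * D ^ 10 * x ^ 2 * S * (k * D ^ 14 * S)) ≡⟨ solve 4 (λ k D x S → con 2 :* (k :* D :^ 10 :* x :^ 2 :* S :* (k :* D :^ 14 :* S)) := con 2 :* (k :* k) :* (D :^ 24 :* S :^ 2) :* (x :* x)) refl k D x S ⟩
          2 * (k * k) * (D ^ 24 * S ^ 2) * (x * x)      ∎
        by-cases : x * x ≤ 2 * F ⊎ p ≤ 2 * F → Conclusion
        by-cases (inj₁ x²≤2F) = from-a²⁸ (2 * (k * k)) k₁ (cancelʳ (x * x) (*-mono-< 0<x 0<x) (begin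
          a ^ 28 * (x * x)                              ≤⟨ *-monoʳ-≤ (a ^ 28) x²≤2F ⟩
          a ^ 28 * (2 * F)                              ≡⟨ *-comm (a ^ 28) (2 * F) ⟩
          2 * F * a ^ 28                                ≤⟨ 2Fa²⁸≤ ⟩
          2 * (k * k) * (D ^ 24 * S ^ 2) * (x * x)      ∎))
        by-cases (inj₂ p≤2F) = from-pa²⁶ {p} (2 * (k * k)) aDS≤p² k₂ (cancelʳ (a * a) (*-mono-< 0<a 0<a) (begin
          p * a ^ 26 * (a * a)                          ≡⟨ solve 2 (λ p a → p :* a :^ 26 :* (a :* a) := p :* a :^ 28) refl p a ⟩
          p * a ^ 28                                    ≤⟨ *-monoˡ-≤ (a ^ 28) p≤2F ⟩
          2 * F * a ^ 28                                ≤⟨ 2Fa²⁸≤ ⟩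
          2 * (k * k) * (D ^ 24 * S ^ 2) * (x * x)      ≤⟨ *-monoʳ-≤ (2 * (k * k) * (D ^ 24 * S ^ 2)) (*-mono-≤ x≤a x≤a) ⟩
          2 * (k * k) * (D ^ 24 * S ^ 2) * (a * a)      ∎))

      -- The case that fixes the exponents. The three bounds are chained, eliminating f₁ and then
      -- f₂; each contributes one S, the exponent of D is 2 + 11 + 14 and that of a is 5 + 15 + 14,
      -- less the 2 spent on x² ≤ a².
      first-dilate-large : ∀ {f₁ f₂} → 4 * (k * k) ≤ constant → a ^ 5 ≤ 4 * D ^ 2 * f₁ * S →
        f₁ * a ^ 15 ≤ k * D ^ 11 * x ^ 2 * S * f₂ → f₂ * a ^ 14 ≤ k * D ^ 14 * S → Conclusion
      first-dilate-large {f₁} {f₂} k≤ h₀ h₁ h₂ = weaken k≤ (cancelʳ (a ^ 2) (^-pos 2 0<a) (begin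
        a ^ 32 * a ^ 2                                            ≡⟨ solve 1 (λ a → a :^ 32 :* a :^ 2 := a :^ 5 :* (a :^ 15 :* a :^ 14)) refl a ⟩
        a ^ 5 * (a ^ 15 * a ^ 14)                                 ≤⟨ *-monoˡ-≤ (a ^ 15 * a ^ 14) h₀ ⟩
        4 * D ^ 2 * f₁ * S * (a ^ 15 * a ^ 14)                    ≡⟨ solve 4 (λ D f S a → con 4 :* D :^ 2 :* f :* S :* (a :^ 15 :* a :^ 14) := con 4 :* D :^ 2 :* S :* (f :* a :^ 15) :* a :^ 14) refl D f₁ S a ⟩
        4 * D ^ 2 * S * (f₁ * a ^ 15) * a ^ 14                    ≤⟨ *-monoˡ-≤ (a ^ 14) (*-monoʳ-≤ (4 * D ^ 2 * S) h₁) ⟩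
        4 * D ^ 2 * S * (k * D ^ 11 * x ^ 2 * S * f₂) * a ^ 14    ≡⟨ solve 6 (λ k D S x f a → con 4 :* D :^ 2 :* S :* (k :* D :^ 11 :* x :^ 2 :* S :* f) :* a :^ 14 := con 4 :* k :* D :^ 13 :* S :^ 2 :* x :^ 2 :* (f :* a :^ 14)) refl k D S x f₂ a ⟩
        4 * k * D ^ 13 * S ^ 2 * x ^ 2 * (f₂ * a ^ 14)            ≤⟨ *-monoʳ-≤ (4 * k * D ^ 13 * S ^ 2 * x ^ 2) h₂ ⟩
        4 * k * D ^ 13 * S ^ 2 * x ^ 2 * (k * D ^ 14 * S)         ≡⟨ solve 4 (λ k D S x → con 4 :* k :* D :^ 13 :* S :^ 2 :* x :^ 2 :* (k :* D :^ 14 :* S) := con 4 :* (k :* k) :* (D :^ 27 :* S :^ 3) :* x :^ 2) refl k D S x ⟩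
        4 * (k * k) * (D ^ 27 * S ^ 3) * x ^ 2                    ≤⟨ *-monoʳ-≤ (4 * (k * k) * (D ^ 27 * S ^ 3)) (^-monoˡ-≤ 2 x≤a) ⟩
        4 * (k * k) * (D ^ 27 * S ^ 3) * a ^ 2                    ∎))

    first-dilate-trivial : ∀ {f₁} → a ^ 5 ≤ 4 * D ^ 2 * f₁ * S → f₁ ≤ x → Conclusion
    first-dilate-trivial {f₁} h f₁≤x = from-a⁴ 4 (≤constant (4 ^ 3)) (cancelʳ a 0<a (begin
        a ^ 4 * a                      ≡⟨ solve 1 (λ a → a :^ 4 :* a := a :^ 5) refl a ⟩
        a ^ 5                          ≤⟨ h ⟩
        4 * D ^ 2 * f₁ * S             ≤⟨ *-monoˡ-≤ S (*-monoʳ-≤ (4 * D ^ 2) (≤-trans f₁≤x x≤a)) ⟩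
        4 * D ^ 2 * a * S              ≡⟨ solve 3 (λ D a S → con 4 :* D :^ 2 :* a :* S := con 4 :* (D :^ 2 :* S) :* a) refl D a S ⟩
        4 * (D ^ 2 * S) * a            ∎))

    -- The last three conditions make the vertical pairs for l₁, the crossings for l₂ and the vertical pairs
    -- for l₂, in this order, contribute less than the energy Q; f₁ and f₂ are the sizes of X + l₁X and X + l₂X.
    inconsistent : ∀ {Q N f₁ f₂} k → 16 < k * k → 0 < f₁ → 0 < f₂ → a ^ 4 ≤ S * Q →
      Q * (f₁ * a ^ 5) ≤ 2 * a ^ 4 * D ^ 2 * f₁ ^ 2 + D ^ 5 * x ^ 2 * N →
      N ^ 2 * f₂ ^ 2 * a ^ 16 ≤ D ^ 7 * ((a ^ 3 * f₂ ^ 2 + D ^ 3 * x ^ 2 * f₁) * (a ^ 6 * f₂ ^ 2 + D ^ 6 * x ^ 2 * f₁)) →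
      4 * D ^ 2 * f₁ * S ≤ a ^ 5 → k * D ^ 13 * S ≤ f₂ * a ^ 13 → k * D ^ 10 * x ^ 2 * S * f₂ ≤ f₁ * a ^ 14 → ⊥
    inconsistent {Q} {N} {f₁} {f₂} k 16<k² 0<f₁ 0<f₂ a⁴≤SQ energy fibre c₁ c₂ c₃ = <⇒≱ 16w²<k²w² k²w²≤16w²
      where
      w P R : ℕ
      w = a ^ 17 * f₁ * f₂
      P = a ^ 3 * f₂ ^ 2 + D ^ 3 * x ^ 2 * f₁
      R = a ^ 6 * f₂ ^ 2 + D ^ 6 * x ^ 2 * f₁
      0<w : 0 < w
      0<w = *-mono-< (*-mono-< (^-pos 17 0<a) 0<f₁) 0<f₂
      16w²<k²w² : 16 * (w * w) < k * k * (w * w)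
      16w²<k²w² = *-monoˡ-< (w * w) {{>-nonZero (*-mono-< 0<w 0<w)}} 16<k²
      diagonal : 4 * a ^ 4 * D ^ 2 * f₁ ^ 2 ≤ Q * (f₁ * a ^ 5)
      diagonal = begin
        4 * a ^ 4 * D ^ 2 * f₁ ^ 2           ≡⟨ solve 3 (λ a D f → con 4 :* a :^ 4 :* D :^ 2 :* f :^ 2 := con 4 :* D :^ 2 :* f :* (a :^ 4 :* f)) refl a D f₁ ⟩
        4 * D ^ 2 * f₁ * (a ^ 4 * f₁)        ≤⟨ *-monoˡ-≤ (a ^ 4 * f₁) 4D²f₁≤Qa ⟩
        Q * a * (a ^ 4 * f₁)                 ≡⟨ solve 3 (λ Q a f → Q :* a :* (a :^ 4 :* f) := Q :* (f :* a :^ 5)) refl Q a f₁ ⟩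
        Q * (f₁ * a ^ 5)                     ∎
        where
        4D²f₁≤Qa : 4 * D ^ 2 * f₁ ≤ Q * a
        4D²f₁≤Qa = cancelʳ S 0<S (begin
          4 * D ^ 2 * f₁ * S                 ≤⟨ c₁ ⟩
          a * a ^ 4                          ≤⟨ *-monoʳ-≤ a a⁴≤SQ ⟩
          a * (S * Q)                        ≡⟨ solve 3 (λ a S Q → a :* (S :* Q) := Q :* a :* S) refl a S Q ⟩
          Q * a * S                          ∎)
      -- By `diagonal` the first summand of `energy` is at most half of the left-hand side; doubling
      -- and cancelling leaves the crossings to account for the other half.
      crossing : Q * (f₁ * a ^ 5) ≤ 2 * D ^ 5 * x ^ 2 * N
      crossing = +-cancelˡ-≤ (Q * (f₁ * a ^ 5)) _ _ (begin
        Q * (f₁ * a ^ 5) + Q * (f₁ * a ^ 5)                         ≤⟨ +-mono-≤ energy energy ⟩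
        t₁ + t₂ + (t₁ + t₂)                                         ≡⟨ solve 5 (λ a D f x N →
          con 2 :* a :^ 4 :* D :^ 2 :* f :^ 2 :+ D :^ 5 :* x :^ 2 :* N :+ (con 2 :* a :^ 4 :* D :^ 2 :* f :^ 2 :+ D :^ 5 :* x :^ 2 :* N) :=
          con 4 :* a :^ 4 :* D :^ 2 :* f :^ 2 :+ con 2 :* D :^ 5 :* x :^ 2 :* N) refl a D f₁ x N ⟩
        4 * a ^ 4 * D ^ 2 * f₁ ^ 2 + 2 * D ^ 5 * x ^ 2 * N          ≤⟨ +-monoˡ-≤ (2 * D ^ 5 * x ^ 2 * N) diagonal ⟩
        Q * (f₁ * a ^ 5) + 2 * D ^ 5 * x ^ 2 * N                    ∎)
        where
        t₁ = 2 * a ^ 4 * D ^ 2 * f₁ ^ 2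
        t₂ = D ^ 5 * x ^ 2 * N
      -- `a⁴≤SQ` and `crossing` are squared so that N appears as N² and `fibre` applies.
      w²≤ : w * w ≤ 4 * (D ^ 10 * x ^ 2 * S * P) * (D ^ 7 * x ^ 2 * S * R)
      w²≤ = begin
        w * w
          ≡⟨ solve 3 (λ a f g → a :^ 17 :* f :* g :* (a :^ 17 :* f :* g) := a :^ 4 :* a :^ 4 :* (f :* a :^ 5 :* (f :* a :^ 5)) :* (g :^ 2 :* a :^ 16)) refl a f₁ f₂ ⟩
        a ^ 4 * a ^ 4 * (f₁ * a ^ 5 * (f₁ * a ^ 5)) * (f₂ ^ 2 * a ^ 16)
          ≤⟨ *-monoˡ-≤ (f₂ ^ 2 * a ^ 16) (*-monoˡ-≤ (f₁ * a ^ 5 * (f₁ * a ^ 5)) (*-mono-≤ a⁴≤SQ a⁴≤SQ)) ⟩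
        S * Q * (S * Q) * (f₁ * a ^ 5 * (f₁ * a ^ 5)) * (f₂ ^ 2 * a ^ 16)
          ≡⟨ solve 4 (λ S Q u v → S :* Q :* (S :* Q) :* (u :* u) :* v := S :* S :* (Q :* u :* (Q :* u)) :* v) refl S Q (f₁ * a ^ 5) (f₂ ^ 2 * a ^ 16) ⟩
        S * S * (Q * (f₁ * a ^ 5) * (Q * (f₁ * a ^ 5))) * (f₂ ^ 2 * a ^ 16)
          ≤⟨ *-monoˡ-≤ (f₂ ^ 2 * a ^ 16) (*-monoʳ-≤ (S * S) (*-mono-≤ crossing crossing)) ⟩
        S * S * (2 * D ^ 5 * x ^ 2 * N * (2 * D ^ 5 * x ^ 2 * N)) * (f₂ ^ 2 * a ^ 16)
          ≡⟨ solve 6 (λ S D x N f a → S :* S :* (con 2 :* D :^ 5 :* x :^ 2 :* N :* (con 2 :* D :^ 5 :* x :^ 2 :* N)) :* (f :^ 2 :* a :^ 16) :=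
               con 4 :* S :^ 2 :* D :^ 10 :* x :^ 4 :* (N :^ 2 :* f :^ 2 :* a :^ 16)) refl S D x N f₂ a ⟩
        4 * S ^ 2 * D ^ 10 * x ^ 4 * (N ^ 2 * f₂ ^ 2 * a ^ 16)
          ≤⟨ *-monoʳ-≤ (4 * S ^ 2 * D ^ 10 * x ^ 4) fibre ⟩
        4 * S ^ 2 * D ^ 10 * x ^ 4 * (D ^ 7 * (P * R))
          ≡⟨ solve 5 (λ S D x P R → con 4 :* S :^ 2 :* D :^ 10 :* x :^ 4 :* (D :^ 7 :* (P :* R)) := con 4 :* (D :^ 10 :* x :^ 2 :* S :* P) :* (D :^ 7 :* x :^ 2 :* S :* R)) refl S D x P R ⟩
        4 * (D ^ 10 * x ^ 2 * S * P) * (D ^ 7 * x ^ 2 * S * R) ∎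
      by-c₂ : k * D ^ 13 * S * (x ^ 4 * f₁) ≤ w
      by-c₂ = begin
        k * D ^ 13 * S * (x ^ 4 * f₁)        ≤⟨ *-mono-≤ c₂ (*-monoˡ-≤ f₁ (^-monoˡ-≤ 4 x≤a)) ⟩
        f₂ * a ^ 13 * (a ^ 4 * f₁)           ≡⟨ solve 3 (λ g a f → g :* a :^ 13 :* (a :^ 4 :* f) := a :^ 17 :* f :* g) refl f₂ a f₁ ⟩
        w                                    ∎
      by-c₃ : k * D ^ 10 * x ^ 2 * S * f₂ * (a ^ 3 * f₂) ≤ w
      by-c₃ = begin
        k * D ^ 10 * x ^ 2 * S * f₂ * (a ^ 3 * f₂)   ≤⟨ *-monoˡ-≤ (a ^ 3 * f₂) c₃ ⟩
        f₁ * a ^ 14 * (a ^ 3 * f₂)                   ≡⟨ solve 3 (λ g a f → f :* a :^ 14 :* (a :^ 3 :* g) := a :^ 17 :* f :* g) refl f₂ a f₁ ⟩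
        w                                            ∎
      P≤ : k * (D ^ 10 * x ^ 2 * S * P) ≤ 2 * w
      P≤ = begin
        k * (D ^ 10 * x ^ 2 * S * P)
          ≡⟨ solve 7 (λ k D x S a f g → k :* (D :^ 10 :* x :^ 2 :* S :* (a :^ 3 :* g :^ 2 :+ D :^ 3 :* x :^ 2 :* f)) :=
               k :* D :^ 10 :* x :^ 2 :* S :* g :* (a :^ 3 :* g) :+ k :* D :^ 13 :* S :* (x :^ 4 :* f)) refl k D x S a f₁ f₂ ⟩
        k * D ^ 10 * x ^ 2 * S * f₂ * (a ^ 3 * f₂) + k * D ^ 13 * S * (x ^ 4 * f₁) ≤⟨ +-mono-≤ by-c₃ by-c₂ ⟩
        w + w                                ≡⟨ cong (w +_) (+-identityʳ w) ⟨
        2 * w                                ∎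
      -- D⁷R ≤ D¹⁰P term by term because a³ ≤ D³, so the bound is that of `P≤`.
      R≤ : k * (D ^ 7 * x ^ 2 * S * R) ≤ 2 * w
      R≤ = begin
        k * (D ^ 7 * x ^ 2 * S * R)
          ≡⟨ solve 7 (λ k D x S a f g → k :* (D :^ 7 :* x :^ 2 :* S :* (a :^ 6 :* g :^ 2 :+ D :^ 6 :* x :^ 2 :* f)) :=
               k :* D :^ 7 :* x :^ 2 :* S :* g :* (a :^ 3 :* g) :* a :^ 3 :+ k :* D :^ 13 :* S :* (x :^ 4 :* f)) refl k D x S a f₁ f₂ ⟩
        k * D ^ 7 * x ^ 2 * S * f₂ * (a ^ 3 * f₂) * a ^ 3 + k * D ^ 13 * S * (x ^ 4 * f₁)
          ≤⟨ +-monoˡ-≤ _ (*-monoʳ-≤ (k * D ^ 7 * x ^ 2 * S * f₂ * (a ^ 3 * f₂)) (^-monoˡ-≤ 3 a≤D)) ⟩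
        k * D ^ 7 * x ^ 2 * S * f₂ * (a ^ 3 * f₂) * D ^ 3 + k * D ^ 13 * S * (x ^ 4 * f₁)
          ≡⟨ cong (_+ k * D ^ 13 * S * (x ^ 4 * f₁)) (solve 6 (λ k D x S a g → k :* D :^ 7 :* x :^ 2 :* S :* g :* (a :^ 3 :* g) :* D :^ 3 :=
               k :* D :^ 10 :* x :^ 2 :* S :* g :* (a :^ 3 :* g)) refl k D x S a f₂) ⟩
        k * D ^ 10 * x ^ 2 * S * f₂ * (a ^ 3 * f₂) + k * D ^ 13 * S * (x ^ 4 * f₁) ≤⟨ +-mono-≤ by-c₃ by-c₂ ⟩
        w + w                                ≡⟨ cong (w +_) (+-identityʳ w) ⟨
        2 * w                                ∎
      k²w²≤16w² : k * k * (w * w) ≤ 16 * (w * w)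
      k²w²≤16w² = begin
        k * k * (w * w)                                                        ≤⟨ *-monoʳ-≤ (k * k) w²≤ ⟩
        k * k * (4 * (D ^ 10 * x ^ 2 * S * P) * (D ^ 7 * x ^ 2 * S * R))       ≡⟨ solve 3 (λ k u v → k :* k :* (con 4 :* u :* v) := con 4 :* (k :* u :* (k :* v))) refl k (D ^ 10 * x ^ 2 * S * P) (D ^ 7 * x ^ 2 * S * R) ⟩
        4 * (k * (D ^ 10 * x ^ 2 * S * P) * (k * (D ^ 7 * x ^ 2 * S * R)))  ≤⟨ *-monoʳ-≤ 4 (*-mono-≤ P≤ R≤) ⟩
        4 * (2 * w * (2 * w))                                               ≡⟨ solve 1 (λ w → con 4 :* (con 2 :* w :* (con 2 :* w)) := con 16 :* (w :* w)) refl w ⟩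
        16 * (w * w)                                                        ∎

  ^-distribʳ-* : ∀ u v j → (u * v) ^ j ≡ u ^ j * v ^ j
  ^-distribʳ-* u v zero    = refl
  ^-distribʳ-* u v (suc j) = trans (cong (u * v *_) (^-distribʳ-* u v j))
    (solve 4 (λ u v p q → u :* v :* (p :* q) := u :* p :* (v :* q)) refl u v (u ^ j) (v ^ j))
    where open +-*-Solver

  ^-split : ∀ u i j k l m n → i * j ≡ k * l + m * n → (u ^ i) ^ j ≡ (u ^ k) ^ l * (u ^ m) ^ n
  ^-split u i j k l m n eq = begin
    (u ^ i) ^ j                    ≡⟨ ^-*-assoc u i j ⟩
    u ^ (i * j)                    ≡⟨ cong (u ^_) eq ⟩
    u ^ (k * l + m * n)            ≡⟨ ^-distribˡ-+-* u (k * l) (m * n) ⟩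
    u ^ (k * l) * u ^ (m * n)      ≡⟨ cong₂ _*_ (^-*-assoc u k l) (^-*-assoc u m n) ⟨
    (u ^ k) ^ l * (u ^ m) ^ n      ∎
    where open ≡-Reasoning

  ^-swap : ∀ u i j → (u ^ i) ^ j ≡ (u ^ j) ^ i
  ^-swap u i j = trans (^-*-assoc u i j) (trans (cong (u ^_) (*-comm i j)) (sym (^-*-assoc u j i)))

  ^3-cancel-≤ : ∀ {u v} → u ^ 3 ≤ v ^ 3 → u ≤ v
  ^3-cancel-≤ {u} {v} u³≤v³ with u ≤? v
  ... | yes u≤v = u≤v
  ... | no  u≰v = ⊥-elim (<⇒≱ (^-monoˡ-< 3 (≰⇒> u≰v)) u³≤v³)

  -- The 17th power of the hypothesis, with D³⁷⁸ ≤ a³⁸⁵, gives the cube of the claim.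
  a³²-bound⇒a⁵³-bound : ∀ {a D S} k → 0 < k → 0 < a → D ^ 54 ≤ a ^ 55 → a ^ 32 ≤ k * (D ^ 27 * S ^ 3) →
    a ^ 53 ≤ k ^ 6 * (S ^ 17 * D ^ 27)
  a³²-bound⇒a⁵³-bound {a} {D} {S} k 0<k 0<a D⁵⁴≤ a³²≤ =
    ^3-cancel-≤ (*-cancelʳ-≤ ((a ^ 53) ^ 3) _ ((a ^ 55) ^ 7) {{m^n≢0 (a ^ 55) 7 {{m^n≢0 a 55 {{>-nonZero 0<a}}}}}} (begin
      (a ^ 53) ^ 3 * (a ^ 55) ^ 7                 ≡⟨ ^-split a 32 17 53 3 55 7 refl ⟨
      (a ^ 32) ^ 17                               ≤⟨ ^-monoˡ-≤ 17 a³²≤ ⟩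
      (k * (D ^ 27 * S ^ 3)) ^ 17                 ≡⟨ ^-distribʳ-* k (D ^ 27 * S ^ 3) 17 ⟩
      k ^ 17 * (D ^ 27 * S ^ 3) ^ 17              ≡⟨ cong (k ^ 17 *_) (^-distribʳ-* (D ^ 27) (S ^ 3) 17) ⟩
      k ^ 17 * ((D ^ 27) ^ 17 * (S ^ 3) ^ 17)     ≡⟨ cong (k ^ 17 *_) (cong₂ _*_ (^-split D 27 17 27 3 54 7 refl) (^-swap S 3 17)) ⟩
      k ^ 17 * ((D ^ 27) ^ 3 * (D ^ 54) ^ 7 * (S ^ 17) ^ 3)
        ≤⟨ *-mono-≤ k¹⁷≤ (*-monoˡ-≤ ((S ^ 17) ^ 3) (*-monoʳ-≤ ((D ^ 27) ^ 3) (^-monoˡ-≤ 7 D⁵⁴≤))) ⟩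
      (k ^ 6) ^ 3 * ((D ^ 27) ^ 3 * (a ^ 55) ^ 7 * (S ^ 17) ^ 3)
        ≡⟨ collect (k ^ 6) (D ^ 27) ((a ^ 55) ^ 7) (S ^ 17) ⟩
      (k ^ 6 * (S ^ 17 * D ^ 27)) ^ 3 * (a ^ 55) ^ 7   ∎))
    where
    open ≤-Reasoning
    k¹⁷≤ : k ^ 17 ≤ (k ^ 6) ^ 3
    k¹⁷≤ = ≤-trans (^-monoʳ-≤ k {{>-nonZero 0<k}} (n≤1+n 17)) (≤-reflexive (sym (^-*-assoc k 6 3)))
    collect : ∀ u d v s → u ^ 3 * (d ^ 3 * v * s ^ 3) ≡ (u * (s * d)) ^ 3 * v
    collect = solve 4 (λ u d v s → u :^ 3 :* (d :^ 3 :* v :* s :^ 3) := (u :* (s :* d)) :^ 3 :* v) refl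
      where open +-*-Solver

module SumsOfDilates where

  open Counting
  open Exponents
  open import Data.Nat as ℕ using (ℕ; zero; suc; _≤_; _<_; z≤n; s≤s; _^_)
  import Data.Nat.Properties as ℕ
  open import Data.Nat.Solver using (module +-*-Solver)
  open +-*-Solver using () renaming (solve to solveₙ; con to conₙ; _:*_ to _*ₙ_; _:+_ to _+ₙ_; _:^_ to _^ₙ_; _:=_ to _≔_)
  open import Data.Integer as ℤ using (ℤ; +_; -[1+_])
  import Data.Integer.Properties as ℤ
  open import Algebra.Bundles using (CommutativeRing)
  open import Algebra.Structures using (IsCommutativeRing)
  import Algebra.Solver.Ring
  import Algebra.Solver.Ring.AlmostCommutativeRing as ACR
  import Algebra.Properties.Semiring.Mult
  import Algebra.Properties.Ring
  open import Data.List.Base using (List; []; _∷_; _++_; length; map; filter; cartesianProduct; cartesianProductWith)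
  open import Data.List.Membership.Propositional using (_∈_)
  open import Data.List.Membership.Propositional.Properties
  import Data.List.Membership.DecPropositional as DecMembership
  open import Data.List.Relation.Unary.Any using (here; there)
  open import Data.List.Relation.Unary.Unique.Propositional using (Unique)
  import Data.List.Relation.Unary.Unique.Propositional.Properties as Unique
  open import Data.List.Relation.Binary.Subset.Propositional using (_⊆_)
  open import Data.Maybe as Maybe using (Maybe)
  open import Data.Product using (∃; ∃₂; _×_; _,_; proj₁; proj₂)
  open import Data.Product.Properties using (≡-dec)
  open import Data.Sum using (_⊎_; inj₁; inj₂)
  open import Data.Empty using (⊥-elim)
  open import Data.Unit using (tt)
  open import Function using (_∘_)
  open import Level using (0ℓ)
  open import Relation.Nullary using (yes; no)
  open import Relation.Nullary.Decidable using (¬?; dec⇒maybe)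
  open import Relation.Unary using (Pred; Decidable)
  open import Relation.Binary.Definitions using (DecidableEquality)
  open import Relation.Binary.PropositionalEquality hiding (J)

  -- Abstract prime fields of odd characteristic, with a ring solver.

  record FiniteDomain : Set₁ where
    infixl 6 _+_ _-_
    infixl 7 _*_
    infix  8 -_
    infix  4 _≟_
    field
      F                 : Set
      _+_ _*_           : F → F → F
      -_                : F → F
      0# 1#             : F
      isCommutativeRing : IsCommutativeRing _≡_ _+_ _*_ -_ 0# 1#
      integral          : ∀ {x y} → x * y ≡ 0# → x ≡ 0# ⊎ y ≡ 0#
      _≟_               : DecidableEquality F
      elements          : List F
      elements-!        : Unique elements
      ∈-elements        : ∀ x → x ∈ elements

    _-_ : F → F → F
    x - y = x + - y

    commutativeRing : CommutativeRing 0ℓ 0ℓ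
    commutativeRing = record { isCommutativeRing = isCommutativeRing }

    open CommutativeRing commutativeRing public
      using (ring; semiring; +-assoc; +-comm; +-identityˡ; +-identityʳ; -‿inverseʳ; *-identityˡ)
    open Algebra.Properties.Semiring.Mult semiring public
      using (×1-homo-*) renaming (_×_ to _×ₙ_; ×-homo-+ to ×ₙ-homo-+)
    open Algebra.Properties.Ring ring public
      using (-‿distribˡ-*; -‿distribʳ-*; -‿involutive; -0#≈0#; -‿+-comm; x∙y⁻¹≈ε⇒x≈y)

    2# : F
    2# = 2 ×ₙ 1#

    field
      2#≢0#     : 2# ≢ 0#
      -- Every element is reached from 0 by repeatedly subtracting 1. Here the field is prime, and
      -- this is what lets the walk along dilates end at any prescribed one.
      generated : ∀ x → ∃ λ k → x ≡ - (k ×ₙ 1#)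

    -- The coefficient map of the ring solver: integer coefficients let it handle identities
    -- containing literals such as 0 and 2.
    fromℤ : ℤ → F
    fromℤ (+ n)    = n ×ₙ 1#
    fromℤ -[1+ n ] = - (suc n ×ₙ 1#)

    private
      fromℤ-⊖ : ∀ m n → fromℤ (m ℤ.⊖ n) ≡ m ×ₙ 1# - n ×ₙ 1#
      fromℤ-⊖ m       zero    = sym (trans (cong (_+_ (m ×ₙ 1#)) -0#≈0#) (+-identityʳ _))
      fromℤ-⊖ zero    (suc n) = sym (+-identityˡ _)
      fromℤ-⊖ (suc m) (suc n) = begin
        fromℤ (suc m ℤ.⊖ suc n)                       ≡⟨ cong fromℤ (ℤ.[1+m]⊖[1+n]≡m⊖n m n) ⟩
        fromℤ (m ℤ.⊖ n)                               ≡⟨ fromℤ-⊖ m n ⟩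
        x - y                                         ≡⟨ cong (_- y) (+-identityˡ x) ⟨
        0# + x - y                                    ≡⟨ cong (λ z → z + x - y) (-‿inverseʳ 1#) ⟨
        1# - 1# + x - y                               ≡⟨ cong (_- y) (+-assoc 1# (- 1#) x) ⟩
        1# + (- 1# + x) - y                           ≡⟨ cong (λ z → 1# + z - y) (+-comm (- 1#) x) ⟩
        1# + (x - 1#) - y                             ≡⟨ cong (_- y) (+-assoc 1# x (- 1#)) ⟨
        1# + x - 1# - y                               ≡⟨ +-assoc (1# + x) (- 1#) (- y) ⟩
        1# + x + (- 1# - y)                           ≡⟨ cong (_+_ (1# + x)) (-‿+-comm 1# y) ⟩
        1# + x - (1# + y)                             ∎
        where
        open ≡-Reasoning
        x = m ×ₙ 1#
        y = n ×ₙ 1#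

      fromℤ-homo-+ : ∀ i j → fromℤ (i ℤ.+ j) ≡ fromℤ i + fromℤ j
      fromℤ-homo-+ (+ m)    (+ n)    = ×ₙ-homo-+ 1# m n
      fromℤ-homo-+ (+ m)    -[1+ n ] = fromℤ-⊖ m (suc n)
      fromℤ-homo-+ -[1+ m ] (+ n)    = trans (fromℤ-⊖ n (suc m)) (+-comm _ _)
      fromℤ-homo-+ -[1+ m ] -[1+ n ] = begin
        - (suc (suc (m ℕ.+ n)) ×ₙ 1#)          ≡⟨ cong (λ k → - (k ×ₙ 1#)) (ℕ.+-suc (suc m) n) ⟨
        - ((suc m ℕ.+ suc n) ×ₙ 1#)            ≡⟨ cong -_ (×ₙ-homo-+ 1# (suc m) (suc n)) ⟩
        - (suc m ×ₙ 1# + suc n ×ₙ 1#)          ≡⟨ -‿+-comm _ _ ⟨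
        - (suc m ×ₙ 1#) - suc n ×ₙ 1#          ∎
        where open ≡-Reasoning

      fromℤ-homo-neg : ∀ i → fromℤ (ℤ.- i) ≡ - fromℤ i
      fromℤ-homo-neg (+ zero)  = sym -0#≈0#
      fromℤ-homo-neg (+ suc n) = refl
      fromℤ-homo-neg -[1+ n ]  = sym (-‿involutive _)

      fromℤ-homo-*⁺ : ∀ m j → fromℤ (+ m ℤ.* j) ≡ m ×ₙ 1# * fromℤ j
      fromℤ-homo-*⁺ m (+ n)    = trans (cong fromℤ (sym (ℤ.pos-* m n))) (×1-homo-* m n)
      fromℤ-homo-*⁺ m -[1+ n ] = begin
        fromℤ (+ m ℤ.* ℤ.- (+ suc n))       ≡⟨ cong fromℤ (ℤ.neg-distribʳ-* (+ m) (+ suc n)) ⟨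
        fromℤ (ℤ.- (+ m ℤ.* + suc n))       ≡⟨ fromℤ-homo-neg (+ m ℤ.* + suc n) ⟩
        - fromℤ (+ m ℤ.* + suc n)           ≡⟨ cong -_ (fromℤ-homo-*⁺ m (+ suc n)) ⟩
        - (m ×ₙ 1# * suc n ×ₙ 1#)           ≡⟨ -‿distribʳ-* _ _ ⟩
        m ×ₙ 1# * - (suc n ×ₙ 1#)           ∎
        where open ≡-Reasoning

      fromℤ-homo-* : ∀ i j → fromℤ (i ℤ.* j) ≡ fromℤ i * fromℤ j
      fromℤ-homo-* (+ m)    j = fromℤ-homo-*⁺ m j
      fromℤ-homo-* -[1+ m ] j = begin
        fromℤ (ℤ.- (+ suc m) ℤ.* j)         ≡⟨ cong fromℤ (ℤ.neg-distribˡ-* (+ suc m) j) ⟨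
        fromℤ (ℤ.- (+ suc m ℤ.* j))         ≡⟨ fromℤ-homo-neg (+ suc m ℤ.* j) ⟩
        - fromℤ (+ suc m ℤ.* j)             ≡⟨ cong -_ (fromℤ-homo-*⁺ (suc m) j) ⟩
        - (suc m ×ₙ 1# * fromℤ j)           ≡⟨ -‿distribˡ-* _ _ ⟩
        - (suc m ×ₙ 1#) * fromℤ j           ∎
        where open ≡-Reasoning

      almostCommutativeRing : ACR.AlmostCommutativeRing 0ℓ 0ℓ
      almostCommutativeRing = ACR.fromCommutativeRing commutativeRing

      morphism : ℤ.+-*-rawRing ACR.-Raw-AlmostCommutative⟶ almostCommutativeRing
      morphism = record
        { ⟦_⟧    = fromℤ
        ; +-homo = fromℤ-homo-+
        ; *-homo = fromℤ-homo-*
        ; -‿homo = fromℤ-homo-neg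
        ; 0-homo = refl
        ; 1-homo = +-identityʳ 1#
        }

      fromℤ-≟ : ∀ i j → Maybe (fromℤ i ≡ fromℤ j)
      fromℤ-≟ i j = Maybe.map (cong fromℤ) (dec⇒maybe (i ℤ.≟ j))

    module Solver = Algebra.Solver.Ring ℤ.+-*-rawRing almostCommutativeRing morphism fromℤ-≟

    open Solver using (solve; con; _:=_; _:+_; _:*_; _:-_; :-_)

    *-cancelˡ : ∀ {a x y} → a ≢ 0# → a * x ≡ a * y → x ≡ y
    *-cancelˡ {a} {x} {y} a≢0 eq with integral {a} {x - y} (begin
        a * (x - y)     ≡⟨ solve 3 (λ a x y → a :* (x :- y) := a :* x :- a :* y) refl a x y ⟩
        a * x - a * y   ≡⟨ cong (_- a * y) eq ⟩
        a * y - a * y   ≡⟨ -‿inverseʳ (a * y) ⟩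
        0#              ∎)
      where open ≡-Reasoning
    ... | inj₁ a≡0 = ⊥-elim (a≢0 a≡0)
    ... | inj₂ eq′ = x∙y⁻¹≈ε⇒x≈y x y eq′

  -- Sum sets, dilates and Petridis's inequality.

  module Sumsets (𝔻 : FiniteDomain) where

    open FiniteDomain 𝔻 public
    open Cardinality _≟_ public
    open DecMembership _≟_ public using (_∈?_)
    open Solver using (solve; con; _:=_; _:+_; _:*_; _:-_; :-_)

    infixl 6 _⊞_ _⊟_
    infixr 7 _∙_

    opaque

      _⊞_ _⊟_ : List F → List F → List F
      _⊞_ = cartesianProductWith _+_
      _⊟_ = cartesianProductWith _-_

      _∙_ : F → List F → List F
      l ∙ X = map (l *_) X

      ∈-⊞⁺ : ∀ {X Y x y} → x ∈ X → y ∈ Y → x + y ∈ X ⊞ Y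
      ∈-⊞⁺ = ∈-cartesianProductWith⁺ _+_

      ∈-⊟⁺ : ∀ {X Y x y} → x ∈ X → y ∈ Y → x - y ∈ X ⊟ Y
      ∈-⊟⁺ = ∈-cartesianProductWith⁺ _-_

      ∈-⊞⁻ : ∀ {X Y z} → z ∈ X ⊞ Y → ∃₂ λ x y → x ∈ X × y ∈ Y × z ≡ x + y
      ∈-⊞⁻ = ∈-cartesianProductWith⁻ _+_ _ _

      ∈-⊟⁻ : ∀ {X Y z} → z ∈ X ⊟ Y → ∃₂ λ x y → x ∈ X × y ∈ Y × z ≡ x - y
      ∈-⊟⁻ = ∈-cartesianProductWith⁻ _-_ _ _

      ∈-∙⁺ : ∀ l {X x} → x ∈ X → l * x ∈ l ∙ X
      ∈-∙⁺ l = ∈-map⁺ (l *_)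

      ∈-∙⁻ : ∀ l {X y} → y ∈ l ∙ X → ∃ λ x → x ∈ X × y ≡ l * x
      ∈-∙⁻ l = ∈-map⁻ (l *_)

      []⊞ : ∀ {Y} → [] ⊞ Y ≡ []
      []⊞ = refl

      []⊟ : ∀ {Y} → [] ⊟ Y ≡ []
      []⊟ = refl

    ⊞-mono : ∀ {X X′ Y Y′} → X ⊆ X′ → Y ⊆ Y′ → X ⊞ Y ⊆ X′ ⊞ Y′
    ⊞-mono p q z∈ with ∈-⊞⁻ z∈
    ... | x , y , x∈ , y∈ , refl = ∈-⊞⁺ (p x∈) (q y∈)

    ⊟-mono : ∀ {X X′ Y Y′} → X ⊆ X′ → Y ⊆ Y′ → X ⊟ Y ⊆ X′ ⊟ Y′
    ⊟-mono p q z∈ with ∈-⊟⁻ z∈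
    ... | x , y , x∈ , y∈ , refl = ∈-⊟⁺ (p x∈) (q y∈)

    +-cancelˡ : ∀ {z x y} → z + x ≡ z + y → x ≡ y
    +-cancelˡ {z} {x} {y} eq = begin
      x              ≡⟨ solve 2 (λ z x → x := z :+ x :- z) refl z x ⟩
      z + x - z      ≡⟨ cong (_- z) eq ⟩
      z + y - z      ≡⟨ solve 2 (λ z x → x := z :+ x :- z) refl z y ⟨
      y              ∎
      where open ≡-Reasoning

    +-cancelʳ : ∀ {z x y} → x + z ≡ y + z → x ≡ y
    +-cancelʳ eq = +-cancelˡ (trans (+-comm _ _) (trans eq (+-comm _ _)))

    -- X has the least ratio |Y - A| / |Y| among its subsets Y, each given by a decidable predicate.
    -- Cross-multiplied, the condition also makes sense for empty Y, where both sides vanish.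
    MinimalDifference : List F → List F → Set₁
    MinimalDifference X A = {P : Pred F 0ℓ} (P? : Decidable P) →
      card (X ⊟ A) ℕ.* card (filter P? X) ≤ card (filter P? X ⊟ A) ℕ.* card X

    private
      petridis-arithmetic : ∀ {w w₀ w₁ m n n₁ v v₀} →
        w ℕ.+ w₁ ≤ w₀ ℕ.+ m → v₀ ℕ.+ n ≤ v ℕ.+ n₁ → m ℕ.* n₁ ≤ w₁ ℕ.* n → w₀ ℕ.* n ≤ m ℕ.* v₀ →
        w ℕ.* n ≤ m ℕ.* v
      petridis-arithmetic {w} {w₀} {w₁} {m} {n} {n₁} {v} {v₀} sub sup min ih = ℕ.+-cancelʳ-≤ (w₁ ℕ.* n) _ _ (begin
        w ℕ.* n ℕ.+ w₁ ℕ.* n     ≡⟨ ℕ.*-distribʳ-+ n w w₁ ⟨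
        (w ℕ.+ w₁) ℕ.* n         ≤⟨ ℕ.*-monoˡ-≤ n sub ⟩
        (w₀ ℕ.+ m) ℕ.* n         ≡⟨ ℕ.*-distribʳ-+ n w₀ m ⟩
        w₀ ℕ.* n ℕ.+ m ℕ.* n     ≤⟨ ℕ.+-monoˡ-≤ (m ℕ.* n) ih ⟩
        m ℕ.* v₀ ℕ.+ m ℕ.* n     ≡⟨ ℕ.*-distribˡ-+ m v₀ n ⟨
        m ℕ.* (v₀ ℕ.+ n)         ≤⟨ ℕ.*-monoʳ-≤ m sup ⟩
        m ℕ.* (v ℕ.+ n₁)         ≡⟨ ℕ.*-distribˡ-+ m v n₁ ⟩
        m ℕ.* v ℕ.+ m ℕ.* n₁     ≤⟨ ℕ.+-monoʳ-≤ (m ℕ.* v) min ⟩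
        m ℕ.* v ℕ.+ w₁ ℕ.* n     ∎)
        where open ℕ.≤-Reasoning

    -- Petridis's induction on Z. A new z adds z + lX to Z + lX, except for the part z + lX₁ already
    -- present; it adds z + l(X - A) to Z + lX - lA, of which at least z + l(X₁ - A) was present.
    -- Minimality, applied to X₁, says that the second overlap is large enough relative to the
    -- first.
    petridis : ∀ {X A l} → MinimalDifference X A → l ≢ 0# → ∀ Z →
      card (Z ⊞ l ∙ X ⊟ l ∙ A) ℕ.* card X ≤ card (X ⊟ A) ℕ.* card (Z ⊞ l ∙ X)
    petridis {X} {A} {l} minimal l≢0 [] rewrite []⊞ {l ∙ X} | []⊟ {l ∙ A} | card-[] = z≤n
    petridis {X} {A} {l} minimal l≢0 (z ∷ Z) =
      petridis-arithmetic {w₀ = card (Z ⊞ l ∙ X ⊟ l ∙ A)} {card (X₁ ⊟ A)} {card (X ⊟ A)} {n₁ = card X₁} sub sup (minimal old?) (petridis minimal l≢0 Z)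
      where
      open ℕ.≤-Reasoning
      g : F → F
      g v = z + l * v
      g-injective : ∀ {v w} → g v ≡ g w → v ≡ w
      g-injective eq = *-cancelˡ l≢0 (+-cancelˡ eq)
      old? : Decidable (λ x → g x ∈ Z ⊞ l ∙ X)
      old? x = g x ∈? (Z ⊞ l ∙ X)
      X₁ : List F
      X₁ = filter old? X
      g-⊟ : ∀ x a → z + l * x - l * a ≡ g (x - a)
      g-⊟ x a = solve 4 (λ z l x a → z :+ l :* x :- l :* a := z :+ l :* (x :- a)) refl z l x a
      card-map-g : ∀ Y → card (map g Y) ≤ card Y
      card-map-g Y = card-surjection g (∈-map⁻ g)
      card-g-map : ∀ Y → card Y ≤ card (map g Y)
      card-g-map Y = card-injection g (∈-map⁺ g) (λ _ _ → g-injective)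
      sub : card ((z ∷ Z) ⊞ l ∙ X ⊟ l ∙ A) ℕ.+ card (X₁ ⊟ A) ≤ card (Z ⊞ l ∙ X ⊟ l ∙ A) ℕ.+ card (X ⊟ A)
      sub = begin
        card ((z ∷ Z) ⊞ l ∙ X ⊟ l ∙ A) ℕ.+ card (X₁ ⊟ A)          ≤⟨ ℕ.+-monoʳ-≤ _ (card-g-map (X₁ ⊟ A)) ⟩
        card ((z ∷ Z) ⊞ l ∙ X ⊟ l ∙ A) ℕ.+ card (map g (X₁ ⊟ A))  ≤⟨ card-submodular W⊆ R⊆P R⊆Q ⟩
        card (Z ⊞ l ∙ X ⊟ l ∙ A) ℕ.+ card (map g (X ⊟ A))         ≤⟨ ℕ.+-monoʳ-≤ _ (card-map-g (X ⊟ A)) ⟩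
        card (Z ⊞ l ∙ X ⊟ l ∙ A) ℕ.+ card (X ⊟ A)                 ∎
        where
        W⊆ : (z ∷ Z) ⊞ l ∙ X ⊟ l ∙ A ⊆ (Z ⊞ l ∙ X ⊟ l ∙ A) ++ map g (X ⊟ A)
        W⊆ w∈ with ∈-⊟⁻ w∈
        ... | _ , _ , v∈ , la∈ , refl with ∈-⊞⁻ {X = z ∷ Z} v∈ | ∈-∙⁻ l la∈
        ...   | z′ , _ , z∈ , lx∈ , refl | a , a∈ , refl with z∈ | ∈-∙⁻ l lx∈
        ...     | there z∈Z | _ = ∈-++⁺ˡ (∈-⊟⁺ (∈-⊞⁺ z∈Z lx∈) la∈)
        ...     | here refl | x , x∈ , refl =
          ∈-++⁺ʳ (Z ⊞ l ∙ X ⊟ l ∙ A) (subst (_∈ map g (X ⊟ A)) (sym (g-⊟ x a)) (∈-map⁺ g (∈-⊟⁺ x∈ a∈)))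
        R⊆P : map g (X₁ ⊟ A) ⊆ Z ⊞ l ∙ X ⊟ l ∙ A
        R⊆P r∈ with ∈-map⁻ g r∈
        ... | v , v∈ , refl with ∈-⊟⁻ v∈
        ...   | x , a , x∈ , a∈ , refl =
          subst (_∈ Z ⊞ l ∙ X ⊟ l ∙ A) (g-⊟ x a) (∈-⊟⁺ (proj₂ (∈-filter⁻ old? {xs = X} x∈)) (∈-∙⁺ l a∈))
        R⊆Q : map g (X₁ ⊟ A) ⊆ map g (X ⊟ A)
        R⊆Q r∈ with ∈-map⁻ g r∈
        ... | v , v∈ , refl = ∈-map⁺ g (⊟-mono (proj₁ ∘ ∈-filter⁻ old? {xs = X}) (λ p → p) v∈)
      sup : card (Z ⊞ l ∙ X) ℕ.+ card X ≤ card ((z ∷ Z) ⊞ l ∙ X) ℕ.+ card X₁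
      sup = begin
        card (Z ⊞ l ∙ X) ℕ.+ card X                   ≤⟨ ℕ.+-monoʳ-≤ _ (card-g-map X) ⟩
        card (Z ⊞ l ∙ X) ℕ.+ card (map g X)           ≤⟨ card-supermodular P⊆ Q⊆ P∩Q⊆R ⟩
        card ((z ∷ Z) ⊞ l ∙ X) ℕ.+ card (map g X₁)    ≤⟨ ℕ.+-monoʳ-≤ _ (card-map-g X₁) ⟩
        card ((z ∷ Z) ⊞ l ∙ X) ℕ.+ card X₁            ∎
        where
        P⊆ : Z ⊞ l ∙ X ⊆ (z ∷ Z) ⊞ l ∙ X
        P⊆ = ⊞-mono there (λ p → p)
        Q⊆ : map g X ⊆ (z ∷ Z) ⊞ l ∙ X
        Q⊆ q∈ with ∈-map⁻ g q∈
        ... | x , x∈ , refl = ∈-⊞⁺ {X = z ∷ Z} (here refl) (∈-∙⁺ l x∈)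
        P∩Q⊆R : ∀ {v} → v ∈ Z ⊞ l ∙ X → v ∈ map g X → v ∈ map g X₁
        P∩Q⊆R v∈ q∈ with ∈-map⁻ g q∈
        ... | x , x∈ , refl = ∈-map⁺ g (∈-filter⁺ old? x∈ v∈)

    exists-minimalDifference : ∀ {A a₀} → Unique A → a₀ ∈ A → ∃ λ X →
      Unique X × X ⊆ A × 0 < card X × MinimalDifference X A ×
      card (X ⊟ A) ℕ.* card A ≤ card (A ⊟ A) ℕ.* card X
    exists-minimalDifference {A} {a₀} u a₀∈ =
      X , subsequences-! u X∈subs , subsequences⇒⊆ A X∈subs , pos X∈ , minimal , below-A
      where
      nonempty? : Decidable (λ Y → 0 < card Y)
      nonempty? Y = 0 ℕ.<? card Y
      candidates : List (List F)
      candidates = filter nonempty? (subsequences A)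
      A∈ : A ∈ candidates
      A∈ = ∈-filter⁺ nonempty? (self∈subsequences A) (∈⇒0<card a₀∈)
      pos : ∀ {Y} → Y ∈ A ∷ candidates → 0 < card Y
      pos (here refl) = ∈⇒0<card a₀∈
      pos (there Y∈)  = proj₂ (∈-filter⁻ nonempty? {xs = subsequences A} Y∈)
      -- `A` heads the list besides occurring in `candidates`: this makes the list visibly non-empty
      -- and yields `below-A` directly.
      minimiser = minimal-ratio (λ Y → card (Y ⊟ A)) card A candidates pos
      X = proj₁ minimiser
      X∈ = proj₁ (proj₂ minimiser)
      below = proj₂ (proj₂ minimiser)
      X∈subs : X ∈ subsequences A
      X∈subs with X∈
      ... | here eq = subst (_∈ subsequences A) (sym eq) (self∈subsequences A)
      ... | there p = proj₁ (∈-filter⁻ nonempty? {xs = subsequences A} p)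
      below-A : card (X ⊟ A) ℕ.* card A ≤ card (A ⊟ A) ℕ.* card X
      below-A = below (here refl)
      minimal : MinimalDifference X A
      minimal P? with 0 ℕ.<? card (filter P? X)
      ... | yes 0<  = below (there (∈-filter⁺ nonempty? (filter∈subsequences P? A X∈subs) 0<))
      ... | no 0≮ = ℕ.≤-trans (ℕ.≤-reflexive (trans (cong (card (X ⊟ A) ℕ.*_) (ℕ.n≤0⇒n≡0 (ℕ.≮⇒≥ 0≮))) (ℕ.*-zeroʳ (card (X ⊟ A))))) z≤n

  -- Lower and upper bounds for sums of dilates.

  module Dilates (𝔻 : FiniteDomain) where

    open Sumsets 𝔻 public
    open Solver using (solve; con; _:=_; _:+_; _:*_; _:-_; :-_)

    -- An injection in the style of Ruzsa's triangle inequality: since (x + lr + z) + l(y - r) - z =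
    -- x + ly, the pair (x + lr + z, y - r) determines x + ly, hence the chosen representative (x,
    -- y), and then r.
    card-⊞-∙-* : ∀ {X Y R G H} l z → Unique R →
      (∀ {x r} → x ∈ X → r ∈ R → x + l * r + z ∈ G) → (∀ {y r} → y ∈ Y → r ∈ R → y - r ∈ H) →
      card (X ⊞ l ∙ Y) ℕ.* length R ≤ card G ℕ.* card H
    card-⊞-∙-* {X} {Y} {R} {G} {H} l z u toG toH with transversal (λ (x , y) → x + l * y) (cartesianProduct X Y)
    ... | ps , ps⊆ , key-! , onto = begin
      card (X ⊞ l ∙ Y) ℕ.* length R                    ≤⟨ ℕ.*-monoˡ-≤ (length R) card≤ ⟩
      length ps ℕ.* length R                           ≡⟨ length-cartesianProduct ps R ⟨
      length (cartesianProduct ps R)                   ≤⟨ injection⇒length≤ shift (Unique.cartesianProduct⁺ (Unique.map⁻ key-!) u) into inj ⟩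
      length (cartesianProduct (set G) (set H))        ≡⟨ length-cartesianProduct (set G) (set H) ⟩
      length (set G) ℕ.* length (set H)                ≡⟨ cong₂ ℕ._*_ (card-set G) (card-set H) ⟩
      card G ℕ.* card H                                ∎
      where
      open ℕ.≤-Reasoning
      key : F × F → F
      key (x , y) = x + l * y
      card≤ : card (X ⊞ l ∙ Y) ≤ length ps
      card≤ = card-image key sub
        where
        sub : ∀ {v} → v ∈ X ⊞ l ∙ Y → ∃ λ q → q ∈ ps × v ≡ key q
        sub v∈ with ∈-⊞⁻ v∈
        ... | x , _ , x∈ , ly∈ , refl with ∈-∙⁻ l ly∈
        ...   | y , y∈ , refl = ∈-map⁻ key (onto (∈-cartesianProduct⁺ x∈ y∈))
      shift : (F × F) × F → F × F
      shift ((x , y) , r) = x + l * r + z , y - r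
      into : ∀ {q} → q ∈ cartesianProduct ps R → shift q ∈ cartesianProduct (set G) (set H)
      into q∈ with ∈-cartesianProduct⁻ ps R q∈
      ... | p∈ , r∈ with ∈-cartesianProduct⁻ X Y (ps⊆ p∈)
      ...   | x∈ , y∈ = ∈-cartesianProduct⁺ (∈-set⁺ (toG x∈ r∈)) (∈-set⁺ (toH y∈ r∈))
      inj : InjectiveOn shift (cartesianProduct ps R)
      inj {(x , y) , r} {(x′ , y′) , r′} p∈ q∈ eq = cong₂ _,_ same-pair same-r
        where
        recover : ∀ x y r → key (x , y) ≡ (x + l * r + z) + l * (y - r) - z
        recover x y r = solve 5 (λ l z x y r → x :+ l :* y := (x :+ l :* r :+ z) :+ l :* (y :- r) :- z) refl l z x y r
        same-pair : (x , y) ≡ (x′ , y′)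
        same-pair = unique-map⇒injectiveOn key key-! (proj₁ (∈-cartesianProduct⁻ ps R p∈)) (proj₁ (∈-cartesianProduct⁻ ps R q∈))
          (trans (recover x y r) (trans (cong (λ (v , w) → v + l * w - z) eq) (sym (recover x′ y′ r′))))
        same-r : r ≡ r′
        same-r = trans (double-minus y r) (trans (cong₂ _-_ (cong proj₂ same-pair) (cong proj₂ eq)) (sym (double-minus y′ r′)))
          where
          double-minus : ∀ y r → r ≡ y - (y - r)
          double-minus = solve 2 (λ y r → r := y :- (y :- r)) refl

    p : ℕ
    p = length elements

    -- Averaging the additive energy of X and l ∙ X over all l, then Cauchy–Schwarz.
    exists-large-dilate-sum : ∀ {X} → Unique X → 0 < length X → ∃ λ l →
      p ℕ.* (length X ℕ.* length X) ≤ card (X ⊞ l ∙ X) ℕ.* (p ℕ.+ length X ℕ.* length X)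
    exists-large-dilate-sum {X} u 0<x = l , ℕ.*-cancelʳ-≤ _ _ n {{ℕ.>-nonZero (ℕ.*-mono-< 0<x 0<x)}} (begin
      p ℕ.* n ℕ.* n                                    ≡⟨ ℕ.*-assoc p n n ⟩
      p ℕ.* (n ℕ.* n)                                  ≤⟨ ℕ.*-monoʳ-≤ p (energy-lower l) ⟩
      p ℕ.* (f ℕ.* e l)                                ≡⟨ solveₙ 3 (λ p f e → p *ₙ (f *ₙ e) ≔ f *ₙ (p *ₙ e)) refl p f (e l) ⟩
      f ℕ.* (p ℕ.* e l)                                ≤⟨ ℕ.*-monoʳ-≤ f (fibers-≤-length proj₁ {xs = quintuples} elements-! minimal) ⟩
      f ℕ.* length quintuples                          ≤⟨ ℕ.*-monoʳ-≤ f quintuples-≤ ⟩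
      f ℕ.* (p ℕ.* n ℕ.+ n ℕ.* n)                      ≡⟨ solveₙ 3 (λ p f n → f *ₙ (p *ₙ n +ₙ n *ₙ n) ≔ f *ₙ (p +ₙ n) *ₙ n) refl p f n ⟩
      f ℕ.* (p ℕ.+ n) ℕ.* n                            ∎)
      where
      open ℕ.≤-Reasoning
      open Collisions _≟_
      n : ℕ
      n = length X ℕ.* length X
      X² : List (F × F)
      X² = cartesianProduct X X
      X²-! : Unique X²
      X²-! = Unique.cartesianProduct⁺ u u
      ∣X²∣ : length X² ≡ n
      ∣X²∣ = length-cartesianProduct X X
      key : F → F × F → F
      key l (x , y) = x + l * y
      quintuple? : Decidable λ (q : F × (F × F) × (F × F)) → key (proj₁ q) (proj₁ (proj₂ q)) ≡ key (proj₁ q) (proj₂ (proj₂ q))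
      quintuple? (l , v , w) = key l v ≟ key l w
      quintuples : List (F × (F × F) × (F × F))
      quintuples = filter quintuple? (cartesianProduct elements (cartesianProduct X² X²))
      quintuples-! : Unique quintuples
      quintuples-! = Unique.filter⁺ quintuple? (Unique.cartesianProduct⁺ elements-! (Unique.cartesianProduct⁺ X²-! X²-!))
      e : F → ℕ
      e l = length (fiber _≟_ proj₁ quintuples l)
      -- With all denominators 1 this is a plain minimum: l has the least energy, which is at most
      -- the average.
      minimiser = minimal-ratio e (λ _ → 1) 0# elements (λ _ → s≤s z≤n)
      l : F
      l = proj₁ minimiser
      minimal : ∀ {k} → k ∈ elements → e l ≤ e k
      minimal k∈ = subst₂ _≤_ (ℕ.*-identityʳ _) (ℕ.*-identityʳ _) (proj₂ (proj₂ minimiser) (there k∈))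
      f : ℕ
      f = card (X ⊞ l ∙ X)
      energy-lower : ∀ l → n ℕ.* n ≤ card (X ⊞ l ∙ X) ℕ.* e l
      energy-lower l = begin
        n ℕ.* n                                                             ≤⟨ ℕ.*-mono-≤ n≤ n≤ ⟩
        length (collisions (key l) (λ v → v) X² V) ℕ.* length (collisions (key l) (λ v → v) X² V)
                                                                            ≤⟨ collisions-² (key l) (λ v → v) X² V ⟩
        length (collisions (key l) (key l) X² X²) ℕ.* length (collisions (λ v → v) (λ v → v) V V)
                                                                            ≤⟨ ℕ.*-mono-≤ e≥ v≥ ⟩
        e l ℕ.* card (X ⊞ l ∙ X)                                            ≡⟨ ℕ.*-comm (e l) _ ⟩
        card (X ⊞ l ∙ X) ℕ.* e l                                            ∎
        where
        V : List F
        V = set (X ⊞ l ∙ X)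
        n≤ : n ≤ length (collisions (key l) (λ v → v) X² V)
        n≤ = ℕ.≤-trans (ℕ.≤-reflexive (sym ∣X²∣)) (injection⇒length≤ (λ q → q , key l q) X²-! into (λ _ _ → cong proj₁))
          where
          into : ∀ {q} → q ∈ X² → (q , key l q) ∈ collisions (key l) (λ v → v) X² V
          into q∈ with ∈-cartesianProduct⁻ X X q∈
          ... | x∈ , y∈ = ∈-collisions⁺ q∈ (∈-set⁺ (∈-⊞⁺ x∈ (∈-∙⁺ l y∈))) refl
        e≥ : length (collisions (key l) (key l) X² X²) ≤ e l
        e≥ = injection⇒length≤ (l ,_) (collisions-! X²-! X²-!) into (λ _ _ → cong proj₂)
          where
          into : ∀ {q} → q ∈ collisions (key l) (key l) X² X² → (l , q) ∈ fiber _≟_ proj₁ quintuples l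
          into q∈ with ∈-collisions⁻ q∈
          ... | v∈ , w∈ , eq = ∈-fiber⁺ proj₁ (∈-filter⁺ quintuple? (∈-cartesianProduct⁺ (∈-elements l) (∈-cartesianProduct⁺ v∈ w∈)) eq) refl
        v≥ : length (collisions (λ v → v) (λ v → v) V V) ≤ card (X ⊞ l ∙ X)
        v≥ = ℕ.≤-trans (injection⇒length≤ proj₁ (collisions-! (set-! _) (set-! _)) (proj₁ ∘ ∈-collisions⁻) inj) (ℕ.≤-reflexive (card-set _))
          where
          inj : InjectiveOn proj₁ (collisions (λ v → v) (λ v → v) V V)
          inj p∈ q∈ refl with ∈-collisions⁻ p∈ | ∈-collisions⁻ q∈
          ... | _ , _ , refl | _ , _ , refl = refl
      same? : Decidable λ (q : F × (F × F) × (F × F)) → proj₂ (proj₁ (proj₂ q)) ≡ proj₂ (proj₂ (proj₂ q))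
      same? (_ , (_ , y) , (_ , y′)) = y ≟ y′
      -- In x + ly = x′ + ly′, y = y′ forces x = x′ and leaves l free, giving pn solutions; y ≠ y′
      -- determines l, giving at most n². Here n = |X|².
      quintuples-≤ : length quintuples ≤ p ℕ.* n ℕ.+ n ℕ.* n
      quintuples-≤ = ℕ.≤-trans (length-filter-split same? quintuples) (ℕ.+-mono-≤ same≤ different≤)
        where
        member : ∀ {l v w} → (l , v , w) ∈ quintuples → v ∈ X² × w ∈ X² × key l v ≡ key l w
        member q∈ with ∈-filter⁻ quintuple? {xs = cartesianProduct elements (cartesianProduct X² X²)} q∈
        ... | q∈′ , eq with ∈-cartesianProduct⁻ X² X² (proj₂ (∈-cartesianProduct⁻ elements _ q∈′))
        ...   | v∈ , w∈ = v∈ , w∈ , eq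
        same≤ : length (filter same? quintuples) ≤ p ℕ.* n
        same≤ = ℕ.≤-trans (injection⇒length≤ (λ (l , v , w) → l , v) (Unique.filter⁺ same? quintuples-!) into inj)
                  (ℕ.≤-reflexive (trans (length-cartesianProduct elements X²) (cong (p ℕ.*_) ∣X²∣)))
          where
          into : ∀ {q} → q ∈ filter same? quintuples → (proj₁ q , proj₁ (proj₂ q)) ∈ cartesianProduct elements X²
          into q∈ = ∈-cartesianProduct⁺ (∈-elements _) (proj₁ (member (proj₁ (∈-filter⁻ same? {xs = quintuples} q∈))))
          determined : ∀ {l v w} → (l , v , w) ∈ filter same? quintuples → w ≡ v
          determined {l} {x , y} {x′ , y′} q∈ with ∈-filter⁻ same? {xs = quintuples} q∈
          ... | q∈′ , refl = cong (_, y) (+-cancelʳ (sym (proj₂ (proj₂ (member q∈′)))))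
          inj : InjectiveOn (λ (l , v , w) → l , v) (filter same? quintuples)
          inj p∈ q∈ refl = cong (λ w → _ , _ , w) (trans (determined p∈) (sym (determined q∈)))
        different≤ : length (filter (¬? ∘ same?) quintuples) ≤ n ℕ.* n
        different≤ = ℕ.≤-trans (injection⇒length≤ proj₂ (Unique.filter⁺ (¬? ∘ same?) quintuples-!) into inj)
                       (ℕ.≤-reflexive (trans (length-cartesianProduct X² X²) (cong₂ ℕ._*_ ∣X²∣ ∣X²∣)))
          where
          into : ∀ {q} → q ∈ filter (¬? ∘ same?) quintuples → proj₂ q ∈ cartesianProduct X² X²
          into q∈ with member (proj₁ (∈-filter⁻ (¬? ∘ same?) {xs = quintuples} q∈))
          ... | v∈ , w∈ , _ = ∈-cartesianProduct⁺ v∈ w∈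
          inj : InjectiveOn proj₂ (filter (¬? ∘ same?) quintuples)
          inj {l , (x , y) , (x′ , y′)} {l′ , _} p∈ q∈ refl
            with ∈-filter⁻ (¬? ∘ same?) {xs = quintuples} p∈ | ∈-filter⁻ (¬? ∘ same?) {xs = quintuples} q∈
          ... | p∈′ , y≢y′ | q∈′ , _ = cong (_, _) (*-cancelˡ (y≢y′ ∘ x∙y⁻¹≈ε⇒x≈y y y′) (trans (slope l (proj₂ (proj₂ (member p∈′)))) (sym (slope l′ (proj₂ (proj₂ (member q∈′)))))))
            where
            slope : ∀ l → x + l * y ≡ x′ + l * y′ → (y - y′) * l ≡ x′ - x
            slope l eq = trans
              (solve 4 (λ x y y′ l → (y :- y′) :* l := x :+ l :* y :- x :- l :* y′) refl x y y′ l) (trans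
              (cong (λ v → v - x - l * y′) eq)
              (solve 4 (λ x x′ y′ l → x′ :+ l :* y′ :- x :- l :* y′ := x′ :- x) refl x x′ y′ l))

  -- Sizes of the auxiliary sets, by Petridis's inequality.

  module EnergyBounds (𝔻 : FiniteDomain) where

    open Dilates 𝔻
    open Solver using (solve; con; _:=_; _:+_; _:*_; _:-_; :-_)
    open ℕ.≤-Reasoning

    module _ {A X : List F}
      (A-! : Unique A) (X-! : Unique X) (X⊆A : X ⊆ A) (0<x : 0 < card X) (minimal : MinimalDifference X A)
      (below-A : card (X ⊟ A) ℕ.* card A ≤ card (A ⊟ A) ℕ.* card X) (a≤D : card A ≤ card (A ⊟ A)) where

      a D x : ℕ
      a = card A
      D = card (A ⊟ A)
      x = card X

      f : F → ℕ
      f l = card (X ⊞ l ∙ X)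

      x₀∈X : ∃ (_∈ X)
      x₀∈X = go refl
        where
        go : ∀ {Y} → Y ≡ X → ∃ (_∈ X)
        go {[]}    refl = ⊥-elim (ℕ.<⇒≢ 0<x (sym card-[]))
        go {y ∷ _} refl = y , here refl

      -- Petridis's inequality with |X - A| / |X| replaced by the larger K. The case l = 0 is
      -- separate: subtracting 0 changes nothing, and a ≤ D suffices.
      petridis-A : ∀ l Z → card (Z ⊞ l ∙ X ⊟ l ∙ A) ℕ.* a ≤ D ℕ.* card (Z ⊞ l ∙ X)
      petridis-A l Z with l ≟ 0#
      ... | no l≢0 = ℕ.*-cancelʳ-≤ _ _ x {{ℕ.>-nonZero 0<x}} (begin
        w ℕ.* a ℕ.* x                  ≡⟨ solveₙ 3 (λ w a x → w *ₙ a *ₙ x ≔ w *ₙ x *ₙ a) refl w a x ⟩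
        w ℕ.* x ℕ.* a                  ≤⟨ ℕ.*-monoˡ-≤ a (petridis minimal l≢0 Z) ⟩
        card (X ⊟ A) ℕ.* v ℕ.* a       ≡⟨ solveₙ 3 (λ m v a → m *ₙ v *ₙ a ≔ m *ₙ a *ₙ v) refl (card (X ⊟ A)) v a ⟩
        card (X ⊟ A) ℕ.* a ℕ.* v       ≤⟨ ℕ.*-monoˡ-≤ v below-A ⟩
        D ℕ.* x ℕ.* v                  ≡⟨ solveₙ 3 (λ D x v → D *ₙ x *ₙ v ≔ D *ₙ v *ₙ x) refl D x v ⟩
        D ℕ.* v ℕ.* x                  ∎)
        where
        w = card (Z ⊞ l ∙ X ⊟ l ∙ A)
        v = card (Z ⊞ l ∙ X)
      ... | yes refl = ℕ.≤-trans (ℕ.*-mono-≤ (card-mono sub) a≤D) (ℕ.≤-reflexive (ℕ.*-comm _ D))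
        where
        sub : Z ⊞ 0# ∙ X ⊟ 0# ∙ A ⊆ Z ⊞ 0# ∙ X
        sub w∈ with ∈-⊟⁻ w∈
        ... | v , _ , v∈ , 0a∈ , refl with ∈-∙⁻ 0# 0a∈
        ...   | a , _ , refl = subst (_∈ Z ⊞ 0# ∙ X) (solve 2 (λ v a → v := v :- con (+ 0) :* a) refl v a) v∈

      1∙⊆ : ∀ {Y} → 1# ∙ Y ⊆ Y
      1∙⊆ y∈ with ∈-∙⁻ 1# y∈
      ... | y , y∈ , refl = subst (_∈ _) (sym (*-identityˡ y)) y∈

      ⊆1∙ : ∀ {Y} → Y ⊆ 1# ∙ Y
      ⊆1∙ {Y} {y} y∈ = subst (_∈ 1# ∙ Y) (*-identityˡ y) (∈-∙⁺ 1# y∈)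

      petridis-A₁ : ∀ Z → card (Z ⊞ X ⊟ A) ℕ.* a ≤ D ℕ.* card (Z ⊞ X)
      petridis-A₁ Z = begin
        card (Z ⊞ X ⊟ A) ℕ.* a               ≤⟨ ℕ.*-monoˡ-≤ a (card-mono (⊟-mono (⊞-mono (λ p → p) ⊆1∙) ⊆1∙)) ⟩
        card (Z ⊞ 1# ∙ X ⊟ 1# ∙ A) ℕ.* a     ≤⟨ petridis-A 1# Z ⟩
        D ℕ.* card (Z ⊞ 1# ∙ X)              ≤⟨ ℕ.*-monoʳ-≤ D (card-mono (⊞-mono (λ p → p) 1∙⊆)) ⟩
        D ℕ.* card (Z ⊞ X)                   ∎

      -- For a fixed x₀ ∈ X, the map v ↦ x₀ - v sends b + c to -b + x₀ - c, so A + A embeds in -A +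
      -- X - A. Petridis with Z = -A reduces this to X - A, at the cost of one K, and `below-A`
      -- costs another.
      card-A⊞A : card (A ⊞ A) ℕ.* a ^ 2 ≤ D ^ 2 ℕ.* x
      card-A⊞A = begin
        card (A ⊞ A) ℕ.* a ^ 2                          ≤⟨ ℕ.*-monoˡ-≤ (a ^ 2) (card-injection (λ v → proj₁ x₀∈X - v) into (λ _ _ → minus-injective)) ⟩
        card (negA ⊞ X ⊟ A) ℕ.* a ^ 2                   ≡⟨ solveₙ 2 (λ n a → n *ₙ a ^ₙ 2 ≔ n *ₙ a *ₙ a) refl (card (negA ⊞ X ⊟ A)) a ⟩
        card (negA ⊞ X ⊟ A) ℕ.* a ℕ.* a                 ≤⟨ ℕ.*-monoˡ-≤ a (petridis-A₁ negA) ⟩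
        D ℕ.* card (negA ⊞ X) ℕ.* a                     ≤⟨ ℕ.*-monoˡ-≤ a (ℕ.*-monoʳ-≤ D (card-mono negA⊞X⊆)) ⟩
        D ℕ.* card (X ⊟ A) ℕ.* a                        ≡⟨ ℕ.*-assoc D _ a ⟩
        D ℕ.* (card (X ⊟ A) ℕ.* a)                      ≤⟨ ℕ.*-monoʳ-≤ D below-A ⟩
        D ℕ.* (D ℕ.* x)                                 ≡⟨ solveₙ 2 (λ D x → D *ₙ (D *ₙ x) ≔ D ^ₙ 2 *ₙ x) refl D x ⟩
        D ^ 2 ℕ.* x                                     ∎
        where
        negA : List F
        negA = map -_ A
        minus-injective : ∀ {v w} → proj₁ x₀∈X - v ≡ proj₁ x₀∈X - w → v ≡ w
        minus-injective {v} {w} eq = trans (double v) (trans (cong (λ z → proj₁ x₀∈X - z) eq) (sym (double w)))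
          where
          double : ∀ v → v ≡ proj₁ x₀∈X - (proj₁ x₀∈X - v)
          double v = solve 2 (λ x v → v := x :- (x :- v)) refl (proj₁ x₀∈X) v
        into : ∀ {v} → v ∈ A ⊞ A → proj₁ x₀∈X - v ∈ negA ⊞ X ⊟ A
        into v∈ with ∈-⊞⁻ v∈
        ... | b , c , b∈ , c∈ , refl =
          subst (_∈ negA ⊞ X ⊟ A) (solve 3 (λ x b c → (:- b) :+ x :- c := x :- (b :+ c)) refl (proj₁ x₀∈X) b c)
            (∈-⊟⁺ (∈-⊞⁺ (∈-map⁺ -_ b∈) (proj₂ x₀∈X)) c∈)
        negA⊞X⊆ : negA ⊞ X ⊆ X ⊟ A
        negA⊞X⊆ v∈ with ∈-⊞⁻ v∈
        ... | _ , y , nb∈ , y∈ , refl with ∈-map⁻ -_ nb∈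
        ...   | b , b∈ , refl = subst (_∈ X ⊟ A) (+-comm y (- b)) (∈-⊟⁺ y∈ b∈)

      card-A⊞X⊟A : card (A ⊞ X ⊟ A) ℕ.* a ^ 3 ≤ D ^ 3 ℕ.* x
      card-A⊞X⊟A = begin
        card (A ⊞ X ⊟ A) ℕ.* a ^ 3              ≡⟨ ℕ.*-assoc (card (A ⊞ X ⊟ A)) a (a ^ 2) ⟨
        card (A ⊞ X ⊟ A) ℕ.* a ℕ.* a ^ 2        ≤⟨ ℕ.*-monoˡ-≤ (a ^ 2) (petridis-A₁ A) ⟩
        D ℕ.* card (A ⊞ X) ℕ.* a ^ 2            ≤⟨ ℕ.*-monoˡ-≤ (a ^ 2) (ℕ.*-monoʳ-≤ D (card-mono (⊞-mono (λ p → p) X⊆A))) ⟩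
        D ℕ.* card (A ⊞ A) ℕ.* a ^ 2            ≡⟨ ℕ.*-assoc D _ (a ^ 2) ⟩
        D ℕ.* (card (A ⊞ A) ℕ.* a ^ 2)          ≤⟨ ℕ.*-monoʳ-≤ D card-A⊞A ⟩
        D ℕ.* (D ^ 2 ℕ.* x)                     ≡⟨ ℕ.*-assoc D (D ^ 2) x ⟨
        D ^ 3 ℕ.* x                             ∎

      U : List F
      U = set (A ⊟ X)

      neg-flip : ∀ {Y Z} → (∀ {v} → v ∈ Y → - v ∈ Z) → card Y ≤ card Z
      neg-flip into = card-injection -_ into (λ _ _ eq → trans (sym (-‿involutive _)) (trans (cong -_ eq) (-‿involutive _)))

      length-U : length U ℕ.* a ≤ D ℕ.* x
      length-U = begin
        length U ℕ.* a           ≡⟨ cong (ℕ._* a) (card-set (A ⊟ X)) ⟩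
        card (A ⊟ X) ℕ.* a       ≤⟨ ℕ.*-monoˡ-≤ a (neg-flip into) ⟩
        card (X ⊟ A) ℕ.* a       ≤⟨ below-A ⟩
        D ℕ.* x                  ∎
        where
        into : ∀ {v} → v ∈ A ⊟ X → - v ∈ X ⊟ A
        into v∈ with ∈-⊟⁻ v∈
        ... | b , y , b∈ , y∈ , refl = subst (_∈ X ⊟ A) (solve 2 (λ b y → y :- b := :- (b :- y)) refl b y) (∈-⊟⁺ y∈ b∈)

      card-∙⊞X : ∀ l → card (l ∙ X ⊞ X) ≤ f l
      card-∙⊞X l = card-mono λ v∈ → let y , z , y∈ , z∈ , eq = ∈-⊞⁻ v∈ in
        subst (_∈ X ⊞ l ∙ X) (trans (+-comm z y) (sym eq)) (∈-⊞⁺ z∈ y∈)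

      -- All slopes u - lc. It is also the range of the free variable t over which the coincidences
      -- are fibred.
      T : F → List F
      T l = set (U ⊟ l ∙ X)

      length-T : ∀ l → length (T l) ℕ.* a ≤ D ℕ.* f l
      length-T l = begin
        length (T l) ℕ.* a               ≡⟨ cong (ℕ._* a) (card-set (U ⊟ l ∙ X)) ⟩
        card (U ⊟ l ∙ X) ℕ.* a           ≤⟨ ℕ.*-monoˡ-≤ a (neg-flip into) ⟩
        card (l ∙ X ⊞ X ⊟ A) ℕ.* a       ≤⟨ petridis-A₁ (l ∙ X) ⟩
        D ℕ.* card (l ∙ X ⊞ X)           ≤⟨ ℕ.*-monoʳ-≤ D (card-∙⊞X l) ⟩
        D ℕ.* f l                        ∎
        where
        into : ∀ {v} → v ∈ U ⊟ l ∙ X → - v ∈ l ∙ X ⊞ X ⊟ A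
        into v∈ with ∈-⊟⁻ v∈
        ... | _ , w , u∈ , w∈ , refl with ∈-⊟⁻ (∈-set⁻ u∈)
        ...   | b , y , b∈ , y∈ , refl =
          subst (_∈ l ∙ X ⊞ X ⊟ A) (solve 3 (λ b y w → w :+ y :- b := :- (b :- y :- w)) refl b y w) (∈-⊟⁺ (∈-⊞⁺ w∈ y∈) b∈)

      -- Up to sign, T + X + lX lies in lX - lA - A + X - A. Petridis strips off -A, -lA and -A in
      -- turn, each for one K; `swap₁` and `swap₂` bring the matching copy of lX or X next to the
      -- set to be stripped.
      card-T⊞ : ∀ l → card (T l ⊞ (X ⊞ l ∙ X)) ℕ.* a ^ 3 ≤ D ^ 3 ℕ.* f l
      card-T⊞ l = begin
        card (T l ⊞ (X ⊞ l ∙ X)) ℕ.* a ^ 3                          ≤⟨ ℕ.*-monoˡ-≤ (a ^ 3) (neg-flip into) ⟩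
        card (l ∙ X ⊟ l ∙ A ⊟ A ⊞ X ⊟ A) ℕ.* a ^ 3                  ≡⟨ ℕ.*-assoc (card (l ∙ X ⊟ l ∙ A ⊟ A ⊞ X ⊟ A)) a (a ^ 2) ⟨
        card (l ∙ X ⊟ l ∙ A ⊟ A ⊞ X ⊟ A) ℕ.* a ℕ.* a ^ 2            ≤⟨ ℕ.*-monoˡ-≤ (a ^ 2) (petridis-A₁ (l ∙ X ⊟ l ∙ A ⊟ A)) ⟩
        D ℕ.* card (l ∙ X ⊟ l ∙ A ⊟ A ⊞ X) ℕ.* a ^ 2                ≤⟨ ℕ.*-monoˡ-≤ (a ^ 2) (ℕ.*-monoʳ-≤ D (card-mono swap₁)) ⟩
        D ℕ.* card (X ⊟ A ⊞ l ∙ X ⊟ l ∙ A) ℕ.* a ^ 2                ≡⟨ solveₙ 3 (λ D n a → D *ₙ n *ₙ a ^ₙ 2 ≔ D *ₙ (n *ₙ a) *ₙ a) refl D (card (X ⊟ A ⊞ l ∙ X ⊟ l ∙ A)) a ⟩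
        D ℕ.* (card (X ⊟ A ⊞ l ∙ X ⊟ l ∙ A) ℕ.* a) ℕ.* a            ≤⟨ ℕ.*-monoˡ-≤ a (ℕ.*-monoʳ-≤ D (petridis-A l (X ⊟ A))) ⟩
        D ℕ.* (D ℕ.* card (X ⊟ A ⊞ l ∙ X)) ℕ.* a                    ≤⟨ ℕ.*-monoˡ-≤ a (ℕ.*-monoʳ-≤ D (ℕ.*-monoʳ-≤ D (card-mono swap₂))) ⟩
        D ℕ.* (D ℕ.* card (l ∙ X ⊞ X ⊟ A)) ℕ.* a                    ≡⟨ solveₙ 3 (λ D n a → D *ₙ (D *ₙ n) *ₙ a ≔ D *ₙ D *ₙ (n *ₙ a)) refl D (card (l ∙ X ⊞ X ⊟ A)) a ⟩
        D ℕ.* D ℕ.* (card (l ∙ X ⊞ X ⊟ A) ℕ.* a)                    ≤⟨ ℕ.*-monoʳ-≤ (D ℕ.* D) (petridis-A₁ (l ∙ X)) ⟩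
        D ℕ.* D ℕ.* (D ℕ.* card (l ∙ X ⊞ X))                        ≤⟨ ℕ.*-monoʳ-≤ (D ℕ.* D) (ℕ.*-monoʳ-≤ D (card-∙⊞X l)) ⟩
        D ℕ.* D ℕ.* (D ℕ.* f l)                                     ≡⟨ solveₙ 2 (λ D n → D *ₙ D *ₙ (D *ₙ n) ≔ D ^ₙ 3 *ₙ n) refl D (f l) ⟩
        D ^ 3 ℕ.* f l                                               ∎
        where
        into : ∀ {v} → v ∈ T l ⊞ (X ⊞ l ∙ X) → - v ∈ l ∙ X ⊟ l ∙ A ⊟ A ⊞ X ⊟ A
        into v∈ with ∈-⊞⁻ v∈
        ... | _ , _ , t∈ , z∈ , refl with ∈-⊟⁻ (∈-set⁻ t∈) | ∈-⊞⁻ z∈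
        ...   | _ , w , u∈ , w∈ , refl | y′ , _ , y′∈ , w′∈ , refl with ∈-⊟⁻ (∈-set⁻ u∈) | ∈-∙⁻ l w′∈
        ...     | b , y , b∈ , y∈ , refl | c , c∈ , refl =
          subst (_∈ l ∙ X ⊟ l ∙ A ⊟ A ⊞ X ⊟ A)
            (solve 6 (λ b y w y′ l c → w :- l :* c :- y′ :+ y :- b := :- (b :- y :- w :+ (y′ :+ l :* c))) refl b y w y′ l c)
            (∈-⊟⁺ (∈-⊞⁺ (∈-⊟⁺ (∈-⊟⁺ w∈ (∈-∙⁺ l (X⊆A c∈))) (X⊆A y′∈)) y∈) b∈)
        swap₁ : l ∙ X ⊟ l ∙ A ⊟ A ⊞ X ⊆ X ⊟ A ⊞ l ∙ X ⊟ l ∙ A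
        swap₁ v∈ with ∈-⊞⁻ v∈
        ... | _ , y , p∈ , y∈ , refl with ∈-⊟⁻ p∈
        ...   | _ , b , q∈ , b∈ , refl with ∈-⊟⁻ q∈
        ...     | w , w′ , w∈ , w′∈ , refl = subst (_∈ X ⊟ A ⊞ l ∙ X ⊟ l ∙ A)
          (solve 4 (λ w w′ b y → y :- b :+ w :- w′ := w :- w′ :- b :+ y) refl w w′ b y)
          (∈-⊟⁺ (∈-⊞⁺ (∈-⊟⁺ y∈ b∈) w∈) w′∈)
        swap₂ : X ⊟ A ⊞ l ∙ X ⊆ l ∙ X ⊞ X ⊟ A
        swap₂ v∈ with ∈-⊞⁻ v∈
        ... | _ , w , p∈ , w∈ , refl with ∈-⊟⁻ p∈
        ...   | y , b , y∈ , b∈ , refl = subst (_∈ l ∙ X ⊞ X ⊟ A)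
          (solve 3 (λ w b y → w :+ y :- b := y :- b :+ w) refl w b y) (∈-⊟⁺ (∈-⊞⁺ w∈ y∈) b∈)

      -- y + (l - 1)z = lz + y - z, so X + (l - 1)X lies in lX + X - A, one Petridis step away from
      -- lX + X.
      f-step : ∀ l → f (l - 1#) ℕ.* a ≤ D ℕ.* f l
      f-step l = begin
        f (l - 1#) ℕ.* a               ≤⟨ ℕ.*-monoˡ-≤ a (card-mono sub) ⟩
        card (l ∙ X ⊞ X ⊟ A) ℕ.* a     ≤⟨ petridis-A₁ (l ∙ X) ⟩
        D ℕ.* card (l ∙ X ⊞ X)         ≤⟨ ℕ.*-monoʳ-≤ D (card-∙⊞X l) ⟩
        D ℕ.* f l                      ∎
        where
        sub : X ⊞ (l - 1#) ∙ X ⊆ l ∙ X ⊞ X ⊟ A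
        sub v∈ with ∈-⊞⁻ v∈
        ... | y , _ , y∈ , w∈ , refl with ∈-∙⁻ (l - 1#) w∈
        ...   | z , z∈ , refl = subst (_∈ l ∙ X ⊞ X ⊟ A)
          (trans (cong (λ e → l * z + y - e) (sym (*-identityˡ z)))
                 (solve 4 (λ l y z e → l :* z :+ y :- e :* z := y :+ (l :- e) :* z) refl l y z 1#))
          (∈-⊟⁺ (∈-⊞⁺ (∈-∙⁺ l z∈) y∈) (X⊆A z∈))

      f-0 : f 0# ≤ x
      f-0 = card-mono sub
        where
        sub : X ⊞ 0# ∙ X ⊆ X
        sub v∈ with ∈-⊞⁻ v∈
        ... | y , _ , y∈ , w∈ , refl with ∈-∙⁻ 0# w∈
        ...   | z , z∈ , refl = subst (_∈ X) (solve 2 (λ y z → y := y :+ con (+ 0) :* z) refl y z) y∈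

      f-pos : ∀ l → 0 < f l
      f-pos l = ∈⇒0<card (∈-⊞⁺ (proj₂ x₀∈X) (∈-∙⁺ l (proj₂ x₀∈X)))

      -- Walking l = 0, -1, -2, … the size f l grows by a factor of at most D / a per step,
      -- and every element of the field is reached.
      first-dilate : (m n : ℕ) {l₀ : F} → n ≤ f l₀ ℕ.* m →
        ∃ λ l → n ≤ f l ℕ.* m × (f l ≤ x ⊎ ∃ λ l′ → f l′ ℕ.* m < n × f l ℕ.* a ≤ D ℕ.* f l′)
      first-dilate m n {l₀} large with generated l₀
      ... | k , refl = search k large
        where
        search : ∀ k → n ≤ f (- (k ×ₙ 1#)) ℕ.* m →
          ∃ λ l → n ≤ f l ℕ.* m × (f l ≤ x ⊎ ∃ λ l′ → f l′ ℕ.* m < n × f l ℕ.* a ≤ D ℕ.* f l′)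
        search zero    large = - 0# , large , inj₁ (subst (λ l → f l ≤ x) (sym -0#≈0#) f-0)
        search (suc k) large with n ℕ.≤? f (- (k ×ₙ 1#)) ℕ.* m
        ... | yes large′ = search k large′
        ... | no ¬large  = - (suc k ×ₙ 1#) , large , inj₂ (- (k ×ₙ 1#) , ℕ.≰⇒> ¬large ,
          subst (λ l → f l ℕ.* a ≤ D ℕ.* f (- (k ×ₙ 1#)))
            (solve 2 (λ k e → (:- k) :- e := :- (e :+ k)) refl (k ×ₙ 1#) 1#) (f-step (- (k ×ₙ 1#))))

      -- The points of X × U on the line u = z + lc, recorded by their first coordinate.
      strand : F → F → List F
      strand l z = filter (λ c → (z + l * c) ∈? U) X

      -- Rich lines of slope l force X + lX to be small. In `card-⊞-∙-*`, with R the strand, y + (z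
      -- + lc) lies in X + U, hence in A + X - A, and y - c in X - A; these sets have sizes at most
      -- K³x and Kx.
      length-strand : ∀ l z → f l ℕ.* a ^ 4 ℕ.* length (strand l z) ≤ D ^ 4 ℕ.* x ^ 2
      length-strand l z = begin
        f l ℕ.* a ^ 4 ℕ.* r                                    ≡⟨ solveₙ 3 (λ f a r → f *ₙ a ^ₙ 4 *ₙ r ≔ f *ₙ r *ₙ a ^ₙ 4) refl (f l) a r ⟩
        f l ℕ.* r ℕ.* a ^ 4                                    ≤⟨ ℕ.*-monoˡ-≤ (a ^ 4) (card-⊞-∙-* l z R-! toG toH) ⟩
        card (A ⊞ X ⊟ A) ℕ.* card (X ⊟ A) ℕ.* a ^ 4            ≡⟨ solveₙ 3 (λ g h a → g *ₙ h *ₙ a ^ₙ 4 ≔ g *ₙ a ^ₙ 3 *ₙ (h *ₙ a)) refl (card (A ⊞ X ⊟ A)) (card (X ⊟ A)) a ⟩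
        card (A ⊞ X ⊟ A) ℕ.* a ^ 3 ℕ.* (card (X ⊟ A) ℕ.* a)    ≤⟨ ℕ.*-mono-≤ card-A⊞X⊟A below-A ⟩
        D ^ 3 ℕ.* x ℕ.* (D ℕ.* x)                              ≡⟨ solveₙ 2 (λ D x → D ^ₙ 3 *ₙ x *ₙ (D *ₙ x) ≔ D ^ₙ 4 *ₙ x ^ₙ 2) refl D x ⟩
        D ^ 4 ℕ.* x ^ 2                                        ∎
        where
        strand? : Decidable (λ c → z + l * c ∈ U)
        strand? c = (z + l * c) ∈? U
        R = strand l z
        r = length R
        R-! : Unique R
        R-! = Unique.filter⁺ strand? X-!
        toG : ∀ {y c} → y ∈ X → c ∈ R → y + l * c + z ∈ A ⊞ X ⊟ A
        toG {y} {c} y∈ c∈ with ∈-⊟⁻ (∈-set⁻ (proj₂ (∈-filter⁻ strand? {xs = X} c∈)))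
        ... | b , y′ , b∈ , y′∈ , eq = subst (_∈ A ⊞ X ⊟ A)
          (trans (solve 3 (λ b y y′ → b :+ y :- y′ := y :+ (b :- y′)) refl b y y′) (trans (cong (_+_ y) (sym eq))
                 (solve 3 (λ y z w → y :+ (z :+ w) := y :+ w :+ z) refl y z (l * c))))
          (∈-⊟⁺ (∈-⊞⁺ b∈ y∈) (X⊆A y′∈))
        toH : ∀ {y c} → y ∈ X → c ∈ R → y - c ∈ X ⊟ A
        toH y∈ c∈ = ∈-⊟⁺ y∈ (X⊆A (proj₁ (∈-filter⁻ strand? {xs = X} c∈)))

      length-X : length X ≡ x
      length-X = sym (card-unique X-!)

      length-A : length A ≡ a
      length-A = sym (card-unique A-!)

      U-! : Unique U
      U-! = set-! (A ⊟ X)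

      _≟²_ : DecidableEquality (F × F)
      _≟²_ = ≡-dec _≟_ _≟_

      _≟³_ : DecidableEquality (F × F × F)
      _≟³_ = ≡-dec _≟_ _≟²_

      module C  = Collisions _≟_
      module C³ = Collisions _≟³_

      -- The energy, fibred over the slopes.

      sq : F → F
      sq y = y * y

      module _ (val : F → F) (Y : List F) where

        difference : F × F → F
        difference (b , y) = sq b - val y

        -- Used in two forms: `val` = `sq` and `Y` = `A` for the energy Q of the squares, and `val`
        -- the identity for the sets that arise in bounding N. `Fibration` serves both.
        energy : ℕ
        energy = length (C.collisions difference difference (cartesianProduct A Y) (cartesianProduct A Y))

      -- A solution b² - v(y) = b′² - v(y′) with b = u + c, b′ = u′ + c′ reads
      -- 2uc + (c² - u′² - v(y)) = 2u′c′ + (c′² - u² - v(y′)), which in terms of the indices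
      -- i = (c , u′ , y), j = (c′ , u , y′) and the slopes s(i) = u′ - lc, s(j) = u - lc′ becomes
      -- 2s(j)c + w(i) = 2s(i)c′ + w(j): the cross terms lcc′ cancel for every l.
      module Fibration (l : F) (val : F → F) {Y : List F} (Y-! : Unique Y) where

        Index : Set
        Index = F × F × F

        indices : List Index
        indices = cartesianProduct X (cartesianProduct U Y)

        indices-! : Unique indices
        indices-! = Unique.cartesianProduct⁺ X-! (Unique.cartesianProduct⁺ U-! Y-!)

        slope : Index → F
        slope (c , u , y) = u - l * c

        value : Index → F → F
        value (c , u , y) t = 2# * t * c + c * c - u * u - val y

        -- For a solution with indices i and j, put t = s(j) on the side of i and t = s(i) on the
        -- side of j. Then `key` of the one and `key′` of the other both start with s(i), s(j), and
        -- the equation is the agreement of the last components.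
        key key′ : Index × F → F × F × F
        key  (i , t) = slope i , t , value i t
        key′ (i , t) = t , slope i , value i t

        points : List (Index × F)
        points = cartesianProduct indices (T l)

        points-! : Unique points
        points-! = Unique.cartesianProduct⁺ indices-! (set-! (U ⊟ l ∙ X))

        ∈-points⁺ : ∀ {c u y t} → c ∈ X → u ∈ U → y ∈ Y → t ∈ T l → ((c , u , y) , t) ∈ points
        ∈-points⁺ c∈ u∈ y∈ t∈ = ∈-cartesianProduct⁺ (∈-cartesianProduct⁺ c∈ (∈-cartesianProduct⁺ u∈ y∈)) t∈

        ∈-points⁻ : ∀ {c u y t} → ((c , u , y) , t) ∈ points → c ∈ X × u ∈ U × y ∈ Y × t ∈ T l
        ∈-points⁻ p∈ with ∈-cartesianProduct⁻ indices (T l) p∈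
        ... | i∈ , t∈ with ∈-cartesianProduct⁻ X (cartesianProduct U Y) i∈
        ...   | c∈ , uy∈ with ∈-cartesianProduct⁻ U Y uy∈
        ...     | u∈ , y∈ = c∈ , u∈ , y∈ , t∈

        Pair : Set
        Pair = (Index × F) × (Index × F)

        pairs : List Pair
        pairs = C³.collisions key key points points

        pairs-! : Unique pairs
        pairs-! = C³.collisions-! points-! points-!

        -- Each solution is lifted |X|² times, once for each choice of c and c′, to a collision of
        -- `key` with `key′`. Cauchy-Schwarz replaces these by collisions of `key` with itself,
        -- because `key′` differs only by a swap of components.
        energy-≤-pairs : length X ℕ.* length X ℕ.* energy val Y ≤ length pairs
        energy-≤-pairs = ℕ.≤-trans solutions-≤-mixed mixed-≤-pairs
          where
          mixed : List Pair
          mixed = C³.collisions key key′ points points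
          solutions : List ((F × F) × (F × F))
          solutions = C.collisions (difference val Y) (difference val Y) (cartesianProduct A Y) (cartesianProduct A Y)
          solutions-! : Unique solutions
          solutions-! = C.collisions-! AY-! AY-!
            where
            AY-! = Unique.cartesianProduct⁺ A-! Y-!
          shear : (F × F) × ((F × F) × (F × F)) → Pair
          shear ((c , c′) , ((b , y) , (b′ , y′))) =
            ((c , b′ - c′ , y) , b - c - l * c′) , ((c′ , b - c , y′) , b′ - c′ - l * c)
          into : ∀ {q} → q ∈ cartesianProduct (cartesianProduct X X) solutions → shear q ∈ mixed
          into {(c , c′) , ((b , y) , (b′ , y′))} q∈ with ∈-cartesianProduct⁻ (cartesianProduct X X) solutions q∈
          ... | cc∈ , s∈ with ∈-cartesianProduct⁻ X X cc∈ | C.∈-collisions⁻ s∈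
          ...   | c∈ , c′∈ | by∈ , by′∈ , eq with ∈-cartesianProduct⁻ A Y by∈ | ∈-cartesianProduct⁻ A Y by′∈
          ...     | b∈ , y∈ | b′∈ , y′∈ =
            C³.∈-collisions⁺ (∈-points⁺ c∈ u′∈ y∈ (∈-set⁺ (∈-⊟⁺ u∈ (∈-∙⁺ l c′∈))))
                             (∈-points⁺ c′∈ u∈ y′∈ (∈-set⁺ (∈-⊟⁺ u′∈ (∈-∙⁺ l c∈))))
                             (cong (λ v → b′ - c′ - l * c , b - c - l * c′ , v) same-value)
            where
            u∈ : b - c ∈ U
            u∈ = ∈-set⁺ (∈-⊟⁺ b∈ c∈)
            u′∈ : b′ - c′ ∈ U
            u′∈ = ∈-set⁺ (∈-⊟⁺ b′∈ c′∈)
            same-value : value (c , b′ - c′ , y) (b - c - l * c′) ≡ value (c′ , b - c , y′) (b′ - c′ - l * c)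
            same-value = trans
              (solve 6 (λ b b′ c c′ l v → con (+ 2) :* (b :- c :- l :* c′) :* c :+ c :* c :- (b′ :- c′) :* (b′ :- c′) :- v :=
                 b :* b :- v :- (b :- c) :* (b :- c) :- (b′ :- c′) :* (b′ :- c′) :- con (+ 2) :* l :* c :* c′)
                 refl b b′ c c′ l (val y)) (trans
              (cong (λ v → v - (b - c) * (b - c) - (b′ - c′) * (b′ - c′) - 2# * l * c * c′) eq)
              (solve 6 (λ b b′ c c′ l v → b′ :* b′ :- v :- (b :- c) :* (b :- c) :- (b′ :- c′) :* (b′ :- c′) :- con (+ 2) :* l :* c :* c′ :=
                 con (+ 2) :* (b′ :- c′ :- l :* c) :* c′ :+ c′ :* c′ :- (b :- c) :* (b :- c) :- v)
                 refl b b′ c c′ l (val y′)))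
          inj : InjectiveOn shear (cartesianProduct (cartesianProduct X X) solutions)
          inj {(c , c′) , ((b , y) , (b′ , y′))} {(e , e′) , ((d , z) , (d′ , z′))} _ _ eq
            with cong (proj₁ ∘ proj₁ ∘ proj₁) eq | cong (proj₁ ∘ proj₁ ∘ proj₂) eq
               | cong (proj₂ ∘ proj₂ ∘ proj₁ ∘ proj₁) eq | cong (proj₂ ∘ proj₂ ∘ proj₁ ∘ proj₂) eq
          ... | refl | refl | refl | refl
            with +-cancelʳ (cong (proj₁ ∘ proj₂ ∘ proj₁ ∘ proj₁) eq) | +-cancelʳ (cong (proj₁ ∘ proj₂ ∘ proj₁ ∘ proj₂) eq)
          ... | refl | refl = refl
          solutions-≤-mixed : length X ℕ.* length X ℕ.* energy val Y ≤ length mixed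
          solutions-≤-mixed = begin
            length X ℕ.* length X ℕ.* energy val Y                       ≡⟨ cong (ℕ._* length solutions) (length-cartesianProduct X X) ⟨
            length (cartesianProduct X X) ℕ.* length solutions           ≡⟨ length-cartesianProduct (cartesianProduct X X) solutions ⟨
            length (cartesianProduct (cartesianProduct X X) solutions)   ≤⟨ injection⇒length≤ shear (Unique.cartesianProduct⁺ (Unique.cartesianProduct⁺ X-! X-!) solutions-!) into inj ⟩
            length mixed                                                 ∎
          swapped-≤ : length (C³.collisions key′ key′ points points) ≤ length pairs
          swapped-≤ = injection⇒length≤ (λ q → q) (C³.collisions-! points-! points-!) swap (λ _ _ eq → eq)
            where
            swap : ∀ {q} → q ∈ C³.collisions key′ key′ points points → q ∈ pairs
            swap q∈ with C³.∈-collisions⁻ q∈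
            ... | i∈ , j∈ , eq = C³.∈-collisions⁺ i∈ j∈ (cong (λ (t , s , v) → s , t , v) eq)
          mixed-≤-pairs : length mixed ≤ length pairs
          mixed-≤-pairs = ²-cancel-≤ (ℕ.≤-trans (C³.collisions-² key key′ points points) (ℕ.*-monoʳ-≤ (length pairs) swapped-≤))

        first : Pair → F
        first (((c , _) , _) , _) = c

        second : Pair → F
        second (_ , ((c , _) , _)) = c

        vertical? : Decidable (λ q → first q ≡ second q)
        vertical? q = first q ≟ second q

        crossings : List Pair
        crossings = filter (¬? ∘ vertical?) pairs

        crossings-! : Unique crossings
        crossings-! = Unique.filter⁺ (¬? ∘ vertical?) pairs-!

        -- The slopes being equal, c = c′ forces u = u′, and then `val y` = `val y′` is the only
        -- condition left. This is the diagonal term.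
        verticals-≤ : length (filter vertical? pairs) ≤
          length (T l) ℕ.* (length X ℕ.* (length U ℕ.* length (C.collisions val val Y Y)))
        verticals-≤ = begin
          length (filter vertical? pairs)     ≤⟨ injection⇒length≤ flatten (Unique.filter⁺ vertical? pairs-!) into inj ⟩
          length (cartesianProduct (T l) (cartesianProduct X (cartesianProduct U same-values)))
            ≡⟨ length-cartesianProduct (T l) _ ⟩
          length (T l) ℕ.* length (cartesianProduct X (cartesianProduct U same-values))
            ≡⟨ cong (length (T l) ℕ.*_) (trans (length-cartesianProduct X _) (cong (length X ℕ.*_) (length-cartesianProduct U same-values))) ⟩
          length (T l) ℕ.* (length X ℕ.* (length U ℕ.* length same-values))  ∎
          where
          same-values : List (F × F)
          same-values = C.collisions val val Y Y
          flatten : Pair → F × F × F × F × F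
          flatten (((c , u , y) , t) , ((_ , _ , y′) , _)) = t , c , u , y , y′
          same : ∀ {c u y t c′ u′ y′ t′} → (((c , u , y) , t) , ((c′ , u′ , y′) , t′)) ∈ filter vertical? pairs →
            c ≡ c′ × u ≡ u′ × t ≡ t′ × val y ≡ val y′
          same {c} {u} {y} {t} {c′} {u′} {y′} {t′} q∈ with ∈-filter⁻ vertical? {xs = pairs} q∈
          ... | q∈′ , refl with C³.∈-collisions⁻ q∈′
          ...   | _ , _ , eq with +-cancelʳ (cong proj₁ eq) | cong (proj₁ ∘ proj₂) eq
          ...     | refl | refl = refl , refl , refl , trans (sym (-‿involutive _)) (trans (cong -_ (+-cancelˡ (cong (proj₂ ∘ proj₂) eq))) (-‿involutive _))
          into : ∀ {q} → q ∈ filter vertical? pairs →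
            flatten q ∈ cartesianProduct (T l) (cartesianProduct X (cartesianProduct U same-values))
          into q∈ with C³.∈-collisions⁻ (proj₁ (∈-filter⁻ vertical? {xs = pairs} q∈))
          ... | i∈ , j∈ , _ with ∈-points⁻ i∈ | ∈-points⁻ j∈
          ...   | c∈ , u∈ , y∈ , t∈ | _ , _ , y′∈ , _ =
            ∈-cartesianProduct⁺ t∈ (∈-cartesianProduct⁺ c∈ (∈-cartesianProduct⁺ u∈
              (C.∈-collisions⁺ y∈ y′∈ (proj₂ (proj₂ (proj₂ (same q∈)))))))
          inj : InjectiveOn flatten (filter vertical? pairs)
          inj p∈ q∈ eq with same p∈ | same q∈
          inj p∈ q∈ refl | refl , refl , refl , _ | refl , refl , refl , _ = refl

        energy-≤ : length X ℕ.* length X ℕ.* energy val Y ≤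
          length (T l) ℕ.* (length X ℕ.* (length U ℕ.* length (C.collisions val val Y Y))) ℕ.+ length crossings
        energy-≤ = begin
          length X ℕ.* length X ℕ.* energy val Y                   ≤⟨ energy-≤-pairs ⟩
          length pairs                                             ≤⟨ length-filter-split vertical? pairs ⟩
          length (filter vertical? pairs) ℕ.+ length crossings     ≤⟨ ℕ.+-monoˡ-≤ _ verticals-≤ ⟩
          _                                                        ∎

      -- Crossings and the energy of an arbitrary set.

      slope₂ : F → F × F → F
      slope₂ l (c , u) = u - l * c

      crosses? : Decidable (λ (q : (F × F) × (F × F)) → proj₁ (proj₁ q) ≢ proj₁ (proj₂ q))
      crosses? q = ¬? (proj₁ (proj₁ q) ≟ proj₁ (proj₂ q))

      -- Two distinct points of X × U on a common line of slope l, so with differences δ and lδ, δ ≠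
      -- 0.
      quadruples : F → List ((F × F) × (F × F))
      quadruples l = filter crosses? (C.collisions (slope₂ l) (slope₂ l) (cartesianProduct X U) (cartesianProduct X U))

      quadruples-! : ∀ l → Unique (quadruples l)
      quadruples-! l = Unique.filter⁺ crosses? (C.collisions-! XU-! XU-!)
        where
        XU-! = Unique.cartesianProduct⁺ X-! U-!

      ∈-quadruples⁻ : ∀ {l c u c′ u′} → ((c , u) , (c′ , u′)) ∈ quadruples l →
        (c ∈ X × u ∈ U) × (c′ ∈ X × u′ ∈ U) × u - l * c ≡ u′ - l * c′ × c ≢ c′
      ∈-quadruples⁻ {l} q∈ with ∈-filter⁻ crosses? {xs = C.collisions (slope₂ l) (slope₂ l) (cartesianProduct X U) (cartesianProduct X U)} q∈
      ... | q∈′ , c≢c′ with C.∈-collisions⁻ q∈′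
      ...   | cu∈ , cu′∈ , eq = ∈-cartesianProduct⁻ X U cu∈ , ∈-cartesianProduct⁻ X U cu′∈ , eq , c≢c′

      -- The first point has |X||U| ≤ Kx² choices, and the second lies in the strand through it, of
      -- size at most K⁴x² / f(l).
      length-quadruples : ∀ l → f l ℕ.* a ^ 5 ℕ.* length (quadruples l) ≤ D ^ 5 ℕ.* x ^ 4
      length-quadruples l = begin
        f l ℕ.* a ^ 5 ℕ.* length (quadruples l)
          ≡⟨ solveₙ 3 (λ f a q → f *ₙ a ^ₙ 5 *ₙ q ≔ f *ₙ a ^ₙ 4 *ₙ q *ₙ a) refl (f l) a (length (quadruples l)) ⟩
        f l ℕ.* a ^ 4 ℕ.* length (quadruples l) ℕ.* a
          ≤⟨ ℕ.*-monoˡ-≤ a (C″.length-≤-fibers proj₁ (f l ℕ.* a ^ 4) (D ^ 4 ℕ.* x ^ 2) (cartesianProduct X U) into bound) ⟩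
        length (cartesianProduct X U) ℕ.* (D ^ 4 ℕ.* x ^ 2) ℕ.* a
          ≡⟨ cong (λ n → n ℕ.* (D ^ 4 ℕ.* x ^ 2) ℕ.* a) (trans (length-cartesianProduct X U) (cong (ℕ._* length U) length-X)) ⟩
        x ℕ.* length U ℕ.* (D ^ 4 ℕ.* x ^ 2) ℕ.* a
          ≡⟨ solveₙ 4 (λ x u D a → x *ₙ u *ₙ (D ^ₙ 4 *ₙ x ^ₙ 2) *ₙ a ≔ u *ₙ a *ₙ (D ^ₙ 4 *ₙ x ^ₙ 3)) refl x (length U) D a ⟩
        length U ℕ.* a ℕ.* (D ^ 4 ℕ.* x ^ 3)
          ≤⟨ ℕ.*-monoˡ-≤ (D ^ 4 ℕ.* x ^ 3) length-U ⟩
        D ℕ.* x ℕ.* (D ^ 4 ℕ.* x ^ 3)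
          ≡⟨ solveₙ 2 (λ D x → D *ₙ x *ₙ (D ^ₙ 4 *ₙ x ^ₙ 3) ≔ D ^ₙ 5 *ₙ x ^ₙ 4) refl D x ⟩
        D ^ 5 ℕ.* x ^ 4  ∎
        where
        module C″ = Fibers _≟²_
        into : ∀ {q} → q ∈ quadruples l → proj₁ q ∈ cartesianProduct X U
        into q∈ with ∈-quadruples⁻ q∈
        ... | (c∈ , u∈) , _ = ∈-cartesianProduct⁺ c∈ u∈
        bound : ∀ {k} → k ∈ cartesianProduct X U → f l ℕ.* a ^ 4 ℕ.* length (fiber _≟²_ proj₁ (quadruples l) k) ≤ D ^ 4 ℕ.* x ^ 2
        bound {c , u} _ = ℕ.≤-trans (ℕ.*-monoʳ-≤ (f l ℕ.* a ^ 4)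
            (injection⇒length≤ (proj₁ ∘ proj₂) (Unique.filter⁺ _ (quadruples-! l)) into-strand inj))
          (length-strand l (u - l * c))
          where
          endpoint : ∀ {c′ u′ k} → (k , (c′ , u′)) ∈ fiber _≟²_ proj₁ (quadruples l) (c , u) → c′ ∈ X × u′ ∈ U × u - l * c + l * c′ ≡ u′ × k ≡ (c , u)
          endpoint {c′} {u′} q∈ with C″.∈-fiber⁻ proj₁ {xs = quadruples l} q∈
          ... | q∈′ , refl with ∈-quadruples⁻ q∈′
          ...   | _ , (c′∈ , u′∈) , eq , _ = c′∈ , u′∈ , trans (cong (_+ l * c′) eq) (solve 2 (λ u w → u :- w :+ w := u) refl u′ (l * c′)) , refl
          into-strand : ∀ {q} → q ∈ fiber _≟²_ proj₁ (quadruples l) (c , u) → proj₁ (proj₂ q) ∈ strand l (u - l * c)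
          into-strand q∈ with endpoint q∈
          ... | c′∈ , u′∈ , eq , _ = ∈-filter⁺ (λ e → (u - l * c + l * e) ∈? U) c′∈ (subst (_∈ U) (sym eq) u′∈)
          inj : InjectiveOn (proj₁ ∘ proj₂) (fiber _≟²_ proj₁ (quadruples l) (c , u))
          inj p∈ q∈ refl with endpoint p∈ | endpoint q∈
          ... | _ , _ , refl , refl | _ , _ , refl , refl = refl

      offset : F → (F × F) × (F × F) → F
      offset l ((c , u) , (c′ , u′)) = c + c′ - l * (u + u′)

      module _ (l : F) (val : F → F) {Y : List F} (Y-! : Unique Y) where

        open Fibration l val Y-!

        quadruple : Pair → (F × F) × (F × F)
        quadruple (((c , u , _) , _) , ((c′ , u′ , _) , _)) = (c , u) , (c′ , u′)

        -- The two values agree at the same t, so v(y) - v(y′) = 2t(c - c′) + c² - c′² - (u² - u′²).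
        -- Equal slopes give u - u′ = l(c - c′), so δ = c - c′ factors out, and `offset` is the κ
        -- that remains.
        ∈-crossings⁻ : ∀ {c u y t c′ u′ y′ t′} → (((c , u , y) , t) , ((c′ , u′ , y′) , t′)) ∈ crossings →
          ((c , u) , (c′ , u′)) ∈ quadruples l × (y ∈ Y × y′ ∈ Y × t ∈ T l) × t ≡ t′ ×
          val y - val y′ ≡ (c - c′) * (2# * t + offset l ((c , u) , (c′ , u′)))
        ∈-crossings⁻ {c} {u} {y} {t} {c′} {u′} {y′} q∈ with ∈-filter⁻ (¬? ∘ vertical?) {xs = pairs} q∈
        ... | q∈′ , c≢c′ with C³.∈-collisions⁻ q∈′
        ...   | i∈ , j∈ , eq with ∈-points⁻ i∈ | ∈-points⁻ j∈ | cong proj₁ eq | cong (proj₁ ∘ proj₂) eq | cong (proj₂ ∘ proj₂) eq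
        ...     | c∈ , u∈ , y∈ , t∈ | c′∈ , u′∈ , y′∈ , _ | slopes | refl | values =
          ∈-filter⁺ crosses? (C.∈-collisions⁺ (∈-cartesianProduct⁺ c∈ u∈) (∈-cartesianProduct⁺ c′∈ u′∈) slopes) c≢c′ ,
          (y∈ , y′∈ , t∈) , refl , equation
          where
          rise : u - u′ ≡ l * (c - c′)
          rise = trans
            (solve 5 (λ u u′ l c c′ → u :- u′ := u :- l :* c :- (u′ :- l :* c′) :+ l :* (c :- c′)) refl u u′ l c c′) (trans
            (cong (λ s → s - (u′ - l * c′) + l * (c - c′)) slopes)
            (solve 2 (λ s r → s :- s :+ r := r) refl (u′ - l * c′) (l * (c - c′))))
          equation : val y - val y′ ≡ (c - c′) * (2# * t + (c + c′ - l * (u + u′)))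
          equation = trans
            (solve 5 (λ t c u v v′ → v :- v′ := con (+ 2) :* t :* c :+ c :* c :- u :* u :- (con (+ 2) :* t :* c :+ c :* c :- u :* u :- v) :- v′)
              refl t c u (val y) (val y′)) (trans
            (cong (λ w → 2# * t * c + c * c - u * u - w - val y′) values) (trans
            (solve 6 (λ t c u c′ u′ v′ →
                con (+ 2) :* t :* c :+ c :* c :- u :* u :- (con (+ 2) :* t :* c′ :+ c′ :* c′ :- u′ :* u′ :- v′) :- v′ :=
                (c :- c′) :* (con (+ 2) :* t :+ (c :+ c′)) :- (u :- u′) :* (u :+ u′))
              refl t c u c′ u′ (val y′)) (trans
            (cong (λ r → (c - c′) * (2# * t + (c + c′)) - r * (u + u′)) rise)
            (solve 6 (λ t c u c′ u′ l →
                (c :- c′) :* (con (+ 2) :* t :+ (c :+ c′)) :- l :* (c :- c′) :* (u :+ u′) :=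
                (c :- c′) :* (con (+ 2) :* t :+ (c :+ c′ :- l :* (u :+ u′))))
              refl t c u c′ u′ l))))

      c≢c′⇒δ≢0 : ∀ {l c u c′ u′} → ((c , u) , (c′ , u′)) ∈ quadruples l → c - c′ ≢ 0#
      c≢c′⇒δ≢0 {c = c} {c′ = c′} q∈ eq = proj₂ (proj₂ (proj₂ (∈-quadruples⁻ q∈))) (x∙y⁻¹≈ε⇒x≈y c c′ eq)

      solve-for-t : ∀ {δ t t′ κ} → δ ≢ 0# → δ * (2# * t + κ) ≡ δ * (2# * t′ + κ) → t ≡ t′
      solve-for-t δ≢0 eq = *-cancelˡ 2#≢0# (+-cancelʳ (*-cancelˡ δ≢0 eq))

      -- In y - y′ = δ(2t + κ) the quadruple fixes δ and κ, and 2δ ≠ 0, so y and y′ determine t.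
      crossings-set-≤ : ∀ l {Y} (Y-! : Unique Y) →
        length (Fibration.crossings l (λ y → y) Y-!) ≤ length (quadruples l) ℕ.* (length Y ℕ.* length Y)
      crossings-set-≤ l {Y} Y-! = begin
        length crossings                                               ≤⟨ injection⇒length≤ forget crossings-! into inj ⟩
        length (cartesianProduct (quadruples l) (cartesianProduct Y Y)) ≡⟨ length-cartesianProduct (quadruples l) _ ⟩
        length (quadruples l) ℕ.* length (cartesianProduct Y Y)        ≡⟨ cong (length (quadruples l) ℕ.*_) (length-cartesianProduct Y Y) ⟩
        length (quadruples l) ℕ.* (length Y ℕ.* length Y)              ∎
        where
        open Fibration l (λ y → y) Y-!
        cross = ∈-crossings⁻ l (λ y → y) Y-!
        forget : Pair → ((F × F) × (F × F)) × (F × F)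
        forget (((c , u , y) , _) , ((c′ , u′ , y′) , _)) = ((c , u) , (c′ , u′)) , (y , y′)
        into : ∀ {q} → q ∈ crossings → forget q ∈ cartesianProduct (quadruples l) (cartesianProduct Y Y)
        into q∈ with cross q∈
        ... | quad∈ , (y∈ , y′∈ , _) , _ = ∈-cartesianProduct⁺ quad∈ (∈-cartesianProduct⁺ y∈ y′∈)
        inj : InjectiveOn forget crossings
        inj p∈ q∈ refl with cross p∈ | cross q∈
        ... | quad∈ , _ , refl , eq | _ , _ , refl , eq′ with solve-for-t (c≢c′⇒δ≢0 quad∈) (trans (sym eq) eq′)
        ...   | refl = refl

      length-repetitions : ∀ {Y} → Unique Y → length (C.collisions (λ y → y) (λ y → y) Y Y) ≤ length Y
      length-repetitions {Y} Y-! = injection⇒length≤ proj₁ (C.collisions-! Y-! Y-!) (proj₁ ∘ C.∈-collisions⁻) inj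
        where
        inj : InjectiveOn proj₁ (C.collisions (λ y → y) (λ y → y) Y Y)
        inj p∈ q∈ refl with C.∈-collisions⁻ p∈ | C.∈-collisions⁻ q∈
        ... | _ , _ , refl | _ , _ , refl = refl

      -- In terms of K, the energy is at most K²f|Y| + K⁵x²|Y|² / f: the verticals and the
      -- crossings, divided by the x² lifts of each solution.
      energy-set-≤ : ∀ l {Y} → Unique Y → energy (λ y → y) Y ℕ.* (f l ℕ.* a ^ 5) ≤
        a ^ 3 ℕ.* D ^ 2 ℕ.* f l ^ 2 ℕ.* length Y ℕ.+ D ^ 5 ℕ.* x ^ 2 ℕ.* length Y ^ 2
      energy-set-≤ l {Y} Y-! = ℕ.*-cancelʳ-≤ _ _ (x ℕ.* x) {{ℕ.>-nonZero (ℕ.*-mono-< 0<x 0<x)}} (begin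
        E ℕ.* (f l ℕ.* a ^ 5) ℕ.* (x ℕ.* x)
          ≡⟨ solveₙ 4 (λ E f a x → E *ₙ (f *ₙ a ^ₙ 5) *ₙ (x *ₙ x) ≔ x *ₙ x *ₙ E *ₙ (f *ₙ a ^ₙ 5)) refl E (f l) a x ⟩
        x ℕ.* x ℕ.* E ℕ.* (f l ℕ.* a ^ 5)
          ≤⟨ ℕ.*-monoˡ-≤ (f l ℕ.* a ^ 5) main ⟩
        (t ℕ.* (x ℕ.* (u ℕ.* y)) ℕ.+ q ℕ.* (y ℕ.* y)) ℕ.* (f l ℕ.* a ^ 5)
          ≡⟨ solveₙ 7 (λ t x u y q f a → (t *ₙ (x *ₙ (u *ₙ y)) +ₙ q *ₙ (y *ₙ y)) *ₙ (f *ₙ a ^ₙ 5) ≔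
               (t *ₙ a) *ₙ (u *ₙ a) *ₙ (x *ₙ y *ₙ f *ₙ a ^ₙ 3) +ₙ f *ₙ a ^ₙ 5 *ₙ q *ₙ (y *ₙ y)) refl t x u y q (f l) a ⟩
        (t ℕ.* a) ℕ.* (u ℕ.* a) ℕ.* (x ℕ.* y ℕ.* f l ℕ.* a ^ 3) ℕ.+ f l ℕ.* a ^ 5 ℕ.* q ℕ.* (y ℕ.* y)
          ≤⟨ ℕ.+-mono-≤ (ℕ.*-monoˡ-≤ (x ℕ.* y ℕ.* f l ℕ.* a ^ 3) (ℕ.*-mono-≤ (length-T l) length-U)) (ℕ.*-monoˡ-≤ (y ℕ.* y) (length-quadruples l)) ⟩
        (D ℕ.* f l) ℕ.* (D ℕ.* x) ℕ.* (x ℕ.* y ℕ.* f l ℕ.* a ^ 3) ℕ.+ D ^ 5 ℕ.* x ^ 4 ℕ.* (y ℕ.* y)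
          ≡⟨ solveₙ 5 (λ D f x y a → (D *ₙ f) *ₙ (D *ₙ x) *ₙ (x *ₙ y *ₙ f *ₙ a ^ₙ 3) +ₙ D ^ₙ 5 *ₙ x ^ₙ 4 *ₙ (y *ₙ y) ≔
               (a ^ₙ 3 *ₙ D ^ₙ 2 *ₙ f ^ₙ 2 *ₙ y +ₙ D ^ₙ 5 *ₙ x ^ₙ 2 *ₙ y ^ₙ 2) *ₙ (x *ₙ x)) refl D (f l) x y a ⟩
        (a ^ 3 ℕ.* D ^ 2 ℕ.* f l ^ 2 ℕ.* y ℕ.+ D ^ 5 ℕ.* x ^ 2 ℕ.* y ^ 2) ℕ.* (x ℕ.* x)  ∎)
        where
        E = energy (λ y → y) Y
        t = length (T l)
        u = length U
        y = length Y
        q = length (quadruples l)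
        main : x ℕ.* x ℕ.* E ≤ t ℕ.* (x ℕ.* (u ℕ.* y)) ℕ.+ q ℕ.* (y ℕ.* y)
        main = begin
          x ℕ.* x ℕ.* E                                        ≡⟨ cong (λ n → n ℕ.* n ℕ.* E) length-X ⟨
          length X ℕ.* length X ℕ.* E                          ≤⟨ Fibration.energy-≤ l (λ y → y) Y-! ⟩
          t ℕ.* (length X ℕ.* (u ℕ.* length (C.collisions (λ y → y) (λ y → y) Y Y))) ℕ.+ length (Fibration.crossings l (λ y → y) Y-!)
            ≤⟨ ℕ.+-mono-≤ (ℕ.*-monoʳ-≤ t (ℕ.*-mono-≤ (ℕ.≤-reflexive length-X) (ℕ.*-monoʳ-≤ u (length-repetitions Y-!)))) (crossings-set-≤ l Y-!) ⟩
          t ℕ.* (x ℕ.* (u ℕ.* y)) ℕ.+ q ℕ.* (y ℕ.* y)  ∎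

      -- The energy of the squares and the second dilate.

      length-equal-squares : length (C.collisions sq sq A A) ≤ 2 ℕ.* a
      length-equal-squares = begin
        length (C.collisions sq sq A A)                                   ≤⟨ length-filter-split diagonal? (C.collisions sq sq A A) ⟩
        _                                                                 ≤⟨ ℕ.+-mono-≤ (inject diagonal? inj) (inject (¬? ∘ diagonal?) inj′) ⟩
        length A ℕ.+ length A                                             ≡⟨ cong (length A ℕ.+_) (ℕ.+-identityʳ (length A)) ⟨
        2 ℕ.* length A                                                    ≡⟨ cong (2 ℕ.*_) length-A ⟩
        2 ℕ.* a                                                           ∎
        where
        diagonal? : Decidable (λ (q : F × F) → proj₁ q ≡ proj₂ q)
        diagonal? (y , y′) = y ≟ y′
        inject : {P : Pred (F × F) 0ℓ} (P? : Decidable P) → InjectiveOn proj₁ (filter P? (C.collisions sq sq A A)) →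
          length (filter P? (C.collisions sq sq A A)) ≤ length A
        inject P? = injection⇒length≤ proj₁ (Unique.filter⁺ P? (C.collisions-! A-! A-!))
          (proj₁ ∘ C.∈-collisions⁻ ∘ proj₁ ∘ ∈-filter⁻ P? {xs = C.collisions sq sq A A})
        inj : InjectiveOn proj₁ (filter diagonal? (C.collisions sq sq A A))
        inj p∈ q∈ refl with ∈-filter⁻ diagonal? {xs = C.collisions sq sq A A} p∈ | ∈-filter⁻ diagonal? {xs = C.collisions sq sq A A} q∈
        ... | _ , refl | _ , refl = refl
        negated : ∀ {y y′} → (y , y′) ∈ filter (¬? ∘ diagonal?) (C.collisions sq sq A A) → y′ ≡ - y
        negated {y} {y′} p∈ with ∈-filter⁻ (¬? ∘ diagonal?) {xs = C.collisions sq sq A A} p∈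
        ... | p∈′ , y≢y′ with C.∈-collisions⁻ p∈′
        ...   | _ , _ , eq with integral {y - y′} {y + y′} (trans
                (solve 2 (λ y z → (y :- z) :* (y :+ z) := y :* y :- z :* z) refl y y′) (trans (cong (_- y′ * y′) eq) (-‿inverseʳ (y′ * y′))))
        ...     | inj₁ y-y′≡0 = ⊥-elim (y≢y′ (x∙y⁻¹≈ε⇒x≈y y y′ y-y′≡0))
        ...     | inj₂ y+y′≡0 = trans (solve 2 (λ y z → z := y :+ z :- y) refl y y′) (trans (cong (_- y) y+y′≡0) (+-identityˡ (- y)))
        inj′ : InjectiveOn proj₁ (filter (¬? ∘ diagonal?) (C.collisions sq sq A A))
        inj′ p∈ q∈ refl = cong (_ ,_) (trans (negated p∈) (sym (negated q∈)))

      -- For fixed q, every y² - y′² = δ(2t + κ) and every z in X + lX gives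
      -- y² - 2δ(t + z) = y′² - (2δz - δκ), a coincidence between two energies of the kind bounded above.
      module _ (l : F) where

        open Fibration l sq A-!

        quadruple-fiber : (F × F) × (F × F) → List Pair
        quadruple-fiber = fiber (≡-dec _≟²_ _≟²_) (quadruple l sq A-!) crossings

        quadruple-fiber-≤ : ∀ {q} → q ∈ quadruples l → ∃₂ λ Y₁ Y₂ → Unique Y₁ × Unique Y₂ ×
          length Y₁ ≤ card (T l ⊞ (X ⊞ l ∙ X)) × length Y₂ ≤ f l ×
          (length (quadruple-fiber q) ℕ.* f l) ^ 2 ≤ energy (λ y → y) Y₁ ℕ.* energy (λ y → y) Y₂
        quadruple-fiber-≤ {q@((c , u) , (c′ , u′))} q∈ =
          Y₁ , Y₂ , set-! _ , set-! _ , Y₁≤ , Y₂≤ , ℕ.≤-trans squares (C.collisions-² h h (cartesianProduct A Y₁) (cartesianProduct A Y₂))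
          where
          δ κ : F
          δ = c - c′
          κ = offset l q
          g₁ g₂ : F → F
          g₁ w = 2# * δ * w
          g₂ z = 2# * δ * z - δ * κ
          Y₁ Y₂ Z : List F
          Z  = X ⊞ l ∙ X
          Y₁ = set (map g₁ (T l ⊞ Z))
          Y₂ = set (map g₂ Z)
          Y₁≤ : length Y₁ ≤ card (T l ⊞ Z)
          Y₁≤ = ℕ.≤-trans (ℕ.≤-reflexive (card-set _)) (card-surjection g₁ (∈-map⁻ g₁))
          Y₂≤ : length Y₂ ≤ f l
          Y₂≤ = ℕ.≤-trans (ℕ.≤-reflexive (card-set _)) (card-surjection g₂ (∈-map⁻ g₂))
          h : F × F → F
          h = difference (λ y → y) []
          coincidences : List ((F × F) × (F × F))
          coincidences = C.collisions h h (cartesianProduct A Y₁) (cartesianProduct A Y₂)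
          -- The free z in X + lX multiplies each element of the fibre into f(l) coincidences. Since
          -- 2δ ≠ 0, the second side returns z and the first t + z, so nothing is counted twice.
          φ : Pair × F → (F × F) × (F × F)
          φ ((((_ , _ , y) , t) , ((_ , _ , y′) , _)) , z) = (y , g₁ (t + z)) , (y′ , g₂ z)
          member : ∀ {e u₁ y t e′ u₁′ y′ t′} → (((e , u₁ , y) , t) , ((e′ , u₁′ , y′) , t′)) ∈ quadruple-fiber q →
            (y ∈ A × y′ ∈ A × t ∈ T l) × t ≡ t′ × sq y - sq y′ ≡ δ * (2# * t + κ) × ((e , u₁) , (e′ , u₁′)) ≡ q
          member p∈ with Fibers.∈-fiber⁻ (≡-dec _≟²_ _≟²_) (quadruple l sq A-!) {xs = crossings} p∈
          ... | p∈′ , refl with ∈-crossings⁻ l sq A-! p∈′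
          ...   | _ , yyt∈ , t≡t′ , eq = yyt∈ , t≡t′ , eq , refl
          into : ∀ {r} → r ∈ cartesianProduct (quadruple-fiber q) (set Z) → φ r ∈ coincidences
          into {(((_ , _ , y) , t) , ((_ , _ , y′) , _)) , z} r∈ with ∈-cartesianProduct⁻ (quadruple-fiber q) (set Z) r∈
          ... | p∈ , z∈ with member p∈
          ...   | (y∈ , y′∈ , t∈) , _ , eq , _ = C.∈-collisions⁺
            (∈-cartesianProduct⁺ y∈ (∈-set⁺ (∈-map⁺ g₁ (∈-⊞⁺ t∈ (∈-set⁻ z∈)))))
            (∈-cartesianProduct⁺ y′∈ (∈-set⁺ (∈-map⁺ g₂ (∈-set⁻ z∈))))
            (trans (solve 5 (λ y y′ δ t z → y :* y :- con (+ 2) :* δ :* (t :+ z) := y :* y :- y′ :* y′ :+ y′ :* y′ :- con (+ 2) :* δ :* (t :+ z)) refl y y′ δ t z)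
            (trans (cong (λ v → v + y′ * y′ - 2# * δ * (t + z)) eq)
                   (solve 5 (λ y′ δ t z κ → δ :* (con (+ 2) :* t :+ κ) :+ y′ :* y′ :- con (+ 2) :* δ :* (t :+ z) := y′ :* y′ :- (con (+ 2) :* δ :* z :- δ :* κ)) refl y′ δ t z κ)))
          2δ≢0 : 2# * δ ≢ 0#
          2δ≢0 eq with integral eq
          ... | inj₁ 2≡0 = 2#≢0# 2≡0
          ... | inj₂ δ≡0 = c≢c′⇒δ≢0 q∈ δ≡0
          inj : InjectiveOn φ (cartesianProduct (quadruple-fiber q) (set Z))
          inj {r} {s} r∈ s∈ eq with ∈-cartesianProduct⁻ (quadruple-fiber q) (set Z) r∈ | ∈-cartesianProduct⁻ (quadruple-fiber q) (set Z) s∈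
          ... | p∈ , _ | p∈′ , _ with member p∈ | member p∈′
          ...   | _ , refl , _ , refl | _ , refl , _ , refl with cong (proj₁ ∘ proj₁) eq | cong (proj₁ ∘ proj₂) eq
                  | *-cancelˡ 2δ≢0 (+-cancelʳ (cong (proj₂ ∘ proj₂) eq)) | *-cancelˡ 2δ≢0 (cong (proj₂ ∘ proj₁) eq)
          ...     | refl | refl | refl | t+z with +-cancelʳ t+z
          ...       | refl = refl
          squares : (length (quadruple-fiber q) ℕ.* f l) ^ 2 ≤ length coincidences ℕ.* length coincidences
          squares = begin
            (length (quadruple-fiber q) ℕ.* f l) ^ 2     ≡⟨ cong (n ℕ.*_) (ℕ.*-identityʳ n) ⟩
            n ℕ.* n                                      ≤⟨ ℕ.*-mono-≤ fiber-≤ fiber-≤ ⟩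
            length coincidences ℕ.* length coincidences  ∎
            where
            n : ℕ
            n = length (quadruple-fiber q) ℕ.* f l
            fiber-≤ : length (quadruple-fiber q) ℕ.* f l ≤ length coincidences
            fiber-≤ = begin
              length (quadruple-fiber q) ℕ.* f l                       ≡⟨ cong (length (quadruple-fiber q) ℕ.*_) (card-set Z) ⟨
              length (quadruple-fiber q) ℕ.* length (set Z)            ≡⟨ length-cartesianProduct (quadruple-fiber q) (set Z) ⟨
              length (cartesianProduct (quadruple-fiber q) (set Z))    ≤⟨ injection⇒length≤ φ (Unique.cartesianProduct⁺ (Unique.filter⁺ _ crossings-!) (set-! Z)) into inj ⟩
              length coincidences                                      ∎

      S Q : ℕ
      S = card (map sq A ⊟ map sq A)
      Q = energy sq A

      -- N is the size of the fullest fibre. If there are no quadruples there are no crossings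
      -- either, and 0 is the default.
      ∃-fiber-bound : ∀ l → ∃ λ N →
        length (Fibration.crossings l sq A-!) ≤ length (quadruples l) ℕ.* N ×
        (N ≡ 0 ⊎ ∃ λ q → q ∈ quadruples l × N ≡ length (quadruple-fiber l q))
      ∃-fiber-bound l with maximum-on (length ∘ quadruple-fiber l) (quadruples l)
      ... | inj₁ none = 0 , bound , inj₁ refl
        where
        into : ∀ {r} → r ∈ Fibration.crossings l sq A-! → quadruple l sq A-! r ∈ quadruples l
        into r∈ = proj₁ (∈-crossings⁻ l sq A-! r∈)
        bound : length (Fibration.crossings l sq A-!) ≤ length (quadruples l) ℕ.* 0
        bound = subst (_≤ length (quadruples l) ℕ.* 0) (ℕ.*-identityˡ _)
          (Fibers.length-≤-fibers (≡-dec _≟²_ _≟²_) (quadruple l sq A-!) 1 0 (quadruples l) into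
            λ {k} k∈ → ⊥-elim (nothing-in none k∈))
          where
          nothing-in : ∀ {k ks} → ks ≡ [] → k ∈ ks → _
          nothing-in refl ()
      ... | inj₂ (q , q∈ , max) = length (quadruple-fiber l q) , bound , inj₂ (q , q∈ , refl)
        where
        into : ∀ {r} → r ∈ Fibration.crossings l sq A-! → quadruple l sq A-! r ∈ quadruples l
        into r∈ = proj₁ (∈-crossings⁻ l sq A-! r∈)
        bound : length (Fibration.crossings l sq A-!) ≤ length (quadruples l) ℕ.* length (quadruple-fiber l q)
        bound = subst (_≤ length (quadruples l) ℕ.* length (quadruple-fiber l q)) (ℕ.*-identityˡ _)
          (Fibers.length-≤-fibers (≡-dec _≟²_ _≟²_) (quadruple l sq A-!) 1 _ (quadruples l) into
            λ k∈ → ℕ.≤-trans (ℕ.≤-reflexive (ℕ.*-identityˡ _)) (max k∈))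

      -- In terms of K: Q ≤ 2K²af + K⁵x²N / f. The 2 counts the roots ±y of a square.
      energy-squares-≤ : ∀ l N → length (Fibration.crossings l sq A-!) ≤ length (quadruples l) ℕ.* N →
        Q ℕ.* (f l ℕ.* a ^ 5) ≤ 2 ℕ.* a ^ 4 ℕ.* D ^ 2 ℕ.* f l ^ 2 ℕ.+ D ^ 5 ℕ.* x ^ 2 ℕ.* N
      energy-squares-≤ l N crossings≤ = ℕ.*-cancelʳ-≤ _ _ (x ℕ.* x) {{ℕ.>-nonZero (ℕ.*-mono-< 0<x 0<x)}} (begin
        Q ℕ.* (f l ℕ.* a ^ 5) ℕ.* (x ℕ.* x)
          ≡⟨ solveₙ 4 (λ E f a x → E *ₙ (f *ₙ a ^ₙ 5) *ₙ (x *ₙ x) ≔ x *ₙ x *ₙ E *ₙ (f *ₙ a ^ₙ 5)) refl Q (f l) a x ⟩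
        x ℕ.* x ℕ.* Q ℕ.* (f l ℕ.* a ^ 5)
          ≤⟨ ℕ.*-monoˡ-≤ (f l ℕ.* a ^ 5) main ⟩
        (t ℕ.* (x ℕ.* (u ℕ.* (2 ℕ.* a))) ℕ.+ q ℕ.* N) ℕ.* (f l ℕ.* a ^ 5)
          ≡⟨ solveₙ 7 (λ t x u q N f a → (t *ₙ (x *ₙ (u *ₙ (conₙ 2 *ₙ a))) +ₙ q *ₙ N) *ₙ (f *ₙ a ^ₙ 5) ≔
               (t *ₙ a) *ₙ (u *ₙ a) *ₙ (conₙ 2 *ₙ x *ₙ f *ₙ a ^ₙ 4) +ₙ f *ₙ a ^ₙ 5 *ₙ q *ₙ N) refl t x u q N (f l) a ⟩
        (t ℕ.* a) ℕ.* (u ℕ.* a) ℕ.* (2 ℕ.* x ℕ.* f l ℕ.* a ^ 4) ℕ.+ f l ℕ.* a ^ 5 ℕ.* q ℕ.* N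
          ≤⟨ ℕ.+-mono-≤ (ℕ.*-monoˡ-≤ (2 ℕ.* x ℕ.* f l ℕ.* a ^ 4) (ℕ.*-mono-≤ (length-T l) length-U)) (ℕ.*-monoˡ-≤ N (length-quadruples l)) ⟩
        (D ℕ.* f l) ℕ.* (D ℕ.* x) ℕ.* (2 ℕ.* x ℕ.* f l ℕ.* a ^ 4) ℕ.+ D ^ 5 ℕ.* x ^ 4 ℕ.* N
          ≡⟨ solveₙ 5 (λ D f x N a → (D *ₙ f) *ₙ (D *ₙ x) *ₙ (conₙ 2 *ₙ x *ₙ f *ₙ a ^ₙ 4) +ₙ D ^ₙ 5 *ₙ x ^ₙ 4 *ₙ N ≔
               (conₙ 2 *ₙ a ^ₙ 4 *ₙ D ^ₙ 2 *ₙ f ^ₙ 2 +ₙ D ^ₙ 5 *ₙ x ^ₙ 2 *ₙ N) *ₙ (x *ₙ x)) refl D (f l) x N a ⟩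
        (2 ℕ.* a ^ 4 ℕ.* D ^ 2 ℕ.* f l ^ 2 ℕ.+ D ^ 5 ℕ.* x ^ 2 ℕ.* N) ℕ.* (x ℕ.* x)  ∎)
        where
        t = length (T l)
        u = length U
        q = length (quadruples l)
        main : x ℕ.* x ℕ.* Q ≤ t ℕ.* (x ℕ.* (u ℕ.* (2 ℕ.* a))) ℕ.+ q ℕ.* N
        main = begin
          x ℕ.* x ℕ.* Q                                        ≡⟨ cong (λ n → n ℕ.* n ℕ.* Q) length-X ⟨
          length X ℕ.* length X ℕ.* Q                          ≤⟨ Fibration.energy-≤ l sq A-! ⟩
          t ℕ.* (length X ℕ.* (u ℕ.* length (C.collisions sq sq A A))) ℕ.+ length (Fibration.crossings l sq A-!)
            ≤⟨ ℕ.+-mono-≤ (ℕ.*-monoʳ-≤ t (ℕ.*-mono-≤ (ℕ.≤-reflexive length-X) (ℕ.*-monoʳ-≤ u length-equal-squares))) crossings≤ ⟩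
          t ℕ.* (x ℕ.* (u ℕ.* (2 ℕ.* a))) ℕ.+ q ℕ.* N  ∎

      -- Here the second dilate `m` enters, chosen independently of `l`: both energies in
      -- `quadruple-fiber-≤` are bounded by `energy-set-≤ m`, with |Y₁| ≤ K³f(l) and |Y₂| ≤ f(l).
      -- The f(l)² gained from the free z cancels against a factor f(l) in each bound.
      fiber-≤ : ∀ l m {q} → q ∈ quadruples l → let N = length (quadruple-fiber l q) in
        N ^ 2 ℕ.* f m ^ 2 ℕ.* a ^ 16 ≤
        D ^ 7 ℕ.* ((a ^ 3 ℕ.* f m ^ 2 ℕ.+ D ^ 3 ℕ.* x ^ 2 ℕ.* f l) ℕ.* (a ^ 6 ℕ.* f m ^ 2 ℕ.+ D ^ 6 ℕ.* x ^ 2 ℕ.* f l))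
      fiber-≤ l m {q} q∈ with quadruple-fiber-≤ l q∈
      ... | Y₁ , Y₂ , Y₁-! , Y₂-! , y₁≤ , y₂≤ , squares =
        ℕ.*-cancelʳ-≤ _ _ (f l ℕ.* f l) {{ℕ.>-nonZero (ℕ.*-mono-< (f-pos l) (f-pos l))}} (begin
        N ^ 2 ℕ.* g ^ 2 ℕ.* a ^ 16 ℕ.* (h ℕ.* h)
          ≡⟨ solveₙ 4 (λ N g a h → N ^ₙ 2 *ₙ g ^ₙ 2 *ₙ a ^ₙ 16 *ₙ (h *ₙ h) ≔
               (N *ₙ h) ^ₙ 2 *ₙ (g *ₙ a ^ₙ 5 *ₙ a ^ₙ 6 *ₙ (g *ₙ a ^ₙ 5))) refl N g a h ⟩
        (N ℕ.* h) ^ 2 ℕ.* (g ℕ.* a ^ 5 ℕ.* a ^ 6 ℕ.* (g ℕ.* a ^ 5))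
          ≤⟨ ℕ.*-monoˡ-≤ _ squares ⟩
        -- The extra a⁶ clears the denominator of |Y₁|² ≤ (D³f(l) / a³)².
        E₁ ℕ.* E₂ ℕ.* (g ℕ.* a ^ 5 ℕ.* a ^ 6 ℕ.* (g ℕ.* a ^ 5))
          ≡⟨ solveₙ 4 (λ E F u v → E *ₙ F *ₙ (u *ₙ v *ₙ u) ≔ E *ₙ u *ₙ v *ₙ (F *ₙ u)) refl E₁ E₂ (g ℕ.* a ^ 5) (a ^ 6) ⟩
        E₁ ℕ.* (g ℕ.* a ^ 5) ℕ.* a ^ 6 ℕ.* (E₂ ℕ.* (g ℕ.* a ^ 5))
          ≤⟨ ℕ.*-mono-≤ E₁≤ E₂≤ ⟩
        (a ^ 6 ℕ.* D ^ 5 ℕ.* g ^ 2 ℕ.* h ℕ.+ D ^ 11 ℕ.* x ^ 2 ℕ.* h ^ 2) ℕ.* (a ^ 3 ℕ.* D ^ 2 ℕ.* g ^ 2 ℕ.* h ℕ.+ D ^ 5 ℕ.* x ^ 2 ℕ.* h ^ 2)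
          ≡⟨ solveₙ 5 (λ a D g h x →
               (a ^ₙ 6 *ₙ D ^ₙ 5 *ₙ g ^ₙ 2 *ₙ h +ₙ D ^ₙ 11 *ₙ x ^ₙ 2 *ₙ h ^ₙ 2) *ₙ (a ^ₙ 3 *ₙ D ^ₙ 2 *ₙ g ^ₙ 2 *ₙ h +ₙ D ^ₙ 5 *ₙ x ^ₙ 2 *ₙ h ^ₙ 2) ≔
               D ^ₙ 7 *ₙ ((a ^ₙ 3 *ₙ g ^ₙ 2 +ₙ D ^ₙ 3 *ₙ x ^ₙ 2 *ₙ h) *ₙ (a ^ₙ 6 *ₙ g ^ₙ 2 +ₙ D ^ₙ 6 *ₙ x ^ₙ 2 *ₙ h)) *ₙ (h *ₙ h)) refl a D g h x ⟩
        D ^ 7 ℕ.* ((a ^ 3 ℕ.* g ^ 2 ℕ.+ D ^ 3 ℕ.* x ^ 2 ℕ.* h) ℕ.* (a ^ 6 ℕ.* g ^ 2 ℕ.+ D ^ 6 ℕ.* x ^ 2 ℕ.* h)) ℕ.* (h ℕ.* h)  ∎)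
        where
        N = length (quadruple-fiber l q)
        g = f m
        h = f l
        E₁ = energy (λ y → y) Y₁
        E₂ = energy (λ y → y) Y₂
        y₁ = length Y₁
        y₁a³≤ : y₁ ℕ.* a ^ 3 ≤ D ^ 3 ℕ.* h
        y₁a³≤ = ℕ.≤-trans (ℕ.*-monoˡ-≤ (a ^ 3) y₁≤) (card-T⊞ l)
        E₁≤ : E₁ ℕ.* (g ℕ.* a ^ 5) ℕ.* a ^ 6 ≤ a ^ 6 ℕ.* D ^ 5 ℕ.* g ^ 2 ℕ.* h ℕ.+ D ^ 11 ℕ.* x ^ 2 ℕ.* h ^ 2
        E₁≤ = begin
          E₁ ℕ.* (g ℕ.* a ^ 5) ℕ.* a ^ 6
            ≤⟨ ℕ.*-monoˡ-≤ (a ^ 6) (energy-set-≤ m Y₁-!) ⟩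
          (a ^ 3 ℕ.* D ^ 2 ℕ.* g ^ 2 ℕ.* y₁ ℕ.+ D ^ 5 ℕ.* x ^ 2 ℕ.* y₁ ^ 2) ℕ.* a ^ 6
            ≡⟨ solveₙ 5 (λ a D g y x → (a ^ₙ 3 *ₙ D ^ₙ 2 *ₙ g ^ₙ 2 *ₙ y +ₙ D ^ₙ 5 *ₙ x ^ₙ 2 *ₙ y ^ₙ 2) *ₙ a ^ₙ 6 ≔
                 a ^ₙ 6 *ₙ D ^ₙ 2 *ₙ g ^ₙ 2 *ₙ (y *ₙ a ^ₙ 3) +ₙ D ^ₙ 5 *ₙ x ^ₙ 2 *ₙ (y *ₙ a ^ₙ 3) ^ₙ 2) refl a D g y₁ x ⟩
          a ^ 6 ℕ.* D ^ 2 ℕ.* g ^ 2 ℕ.* (y₁ ℕ.* a ^ 3) ℕ.+ D ^ 5 ℕ.* x ^ 2 ℕ.* (y₁ ℕ.* a ^ 3) ^ 2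
            ≤⟨ ℕ.+-mono-≤ (ℕ.*-monoʳ-≤ (a ^ 6 ℕ.* D ^ 2 ℕ.* g ^ 2) y₁a³≤) (ℕ.*-monoʳ-≤ (D ^ 5 ℕ.* x ^ 2) (ℕ.^-monoˡ-≤ 2 y₁a³≤)) ⟩
          a ^ 6 ℕ.* D ^ 2 ℕ.* g ^ 2 ℕ.* (D ^ 3 ℕ.* h) ℕ.+ D ^ 5 ℕ.* x ^ 2 ℕ.* (D ^ 3 ℕ.* h) ^ 2
            ≡⟨ solveₙ 5 (λ a D g h x → a ^ₙ 6 *ₙ D ^ₙ 2 *ₙ g ^ₙ 2 *ₙ (D ^ₙ 3 *ₙ h) +ₙ D ^ₙ 5 *ₙ x ^ₙ 2 *ₙ (D ^ₙ 3 *ₙ h) ^ₙ 2 ≔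
                 a ^ₙ 6 *ₙ D ^ₙ 5 *ₙ g ^ₙ 2 *ₙ h +ₙ D ^ₙ 11 *ₙ x ^ₙ 2 *ₙ h ^ₙ 2) refl a D g h x ⟩
          a ^ 6 ℕ.* D ^ 5 ℕ.* g ^ 2 ℕ.* h ℕ.+ D ^ 11 ℕ.* x ^ 2 ℕ.* h ^ 2  ∎
        E₂≤ : E₂ ℕ.* (g ℕ.* a ^ 5) ≤ a ^ 3 ℕ.* D ^ 2 ℕ.* g ^ 2 ℕ.* h ℕ.+ D ^ 5 ℕ.* x ^ 2 ℕ.* h ^ 2
        E₂≤ = ℕ.≤-trans (energy-set-≤ m Y₂-!)
          (ℕ.+-mono-≤ (ℕ.*-monoʳ-≤ (a ^ 3 ℕ.* D ^ 2 ℕ.* g ^ 2) y₂≤) (ℕ.*-monoʳ-≤ (D ^ 5 ℕ.* x ^ 2) (ℕ.^-monoˡ-≤ 2 y₂≤)))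

      a⁴≤SQ : a ^ 4 ≤ S ℕ.* Q
      a⁴≤SQ = begin
        a ^ 4                                     ≡⟨ solveₙ 1 (λ a → a ^ₙ 4 ≔ a *ₙ a *ₙ (a *ₙ a)) refl a ⟩
        a ℕ.* a ℕ.* (a ℕ.* a)                     ≤⟨ ℕ.*-mono-≤ a²≤ a²≤ ⟩
        length mixed ℕ.* length mixed             ≤⟨ C.collisions-² (difference sq A) (λ v → v) (cartesianProduct A A) V ⟩
        Q ℕ.* length (C.collisions (λ v → v) (λ v → v) V V) ≤⟨ ℕ.*-monoʳ-≤ Q (length-repetitions (set-! _)) ⟩
        Q ℕ.* length V                            ≡⟨ cong (Q ℕ.*_) (card-set _) ⟩
        Q ℕ.* S                                   ≡⟨ ℕ.*-comm Q S ⟩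
        S ℕ.* Q                                   ∎
        where
        V : List F
        V = set (map sq A ⊟ map sq A)
        mixed : List ((F × F) × F)
        mixed = C.collisions (difference sq A) (λ v → v) (cartesianProduct A A) V
        a²≤ : a ℕ.* a ≤ length mixed
        a²≤ = begin
          a ℕ.* a                           ≡⟨ cong₂ ℕ._*_ length-A length-A ⟨
          length A ℕ.* length A             ≡⟨ length-cartesianProduct A A ⟨
          length (cartesianProduct A A)     ≤⟨ injection⇒length≤ (λ q → q , difference sq A q) (Unique.cartesianProduct⁺ A-! A-!) into (λ _ _ → cong proj₁) ⟩
          length mixed                      ∎
          where
          into : ∀ {q} → q ∈ cartesianProduct A A → (q , difference sq A q) ∈ mixed
          into q∈ with ∈-cartesianProduct⁻ A A q∈
          ... | b∈ , y∈ = C.∈-collisions⁺ q∈ (∈-set⁺ (∈-⊟⁺ (∈-map⁺ sq b∈) (∈-map⁺ sq y∈))) refl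

      0<a : 0 < a
      0<a = ℕ.≤-trans 0<x (card-mono X⊆A)

      -- A square has at most two roots, so A² has at least a / 2 elements; a translate of A² lies
      -- in A² - A².
      a≤2S : a ≤ 2 ℕ.* S
      a≤2S = ℕ.*-cancelʳ-≤ _ _ a {{ℕ.>-nonZero 0<a}} (begin
        a ℕ.* a                                   ≤⟨ ℕ.*-mono-≤ a≤ a≤ ⟩
        length mixed ℕ.* length mixed             ≤⟨ C.collisions-² sq (λ v → v) A V ⟩
        length (C.collisions sq sq A A) ℕ.* length (C.collisions (λ v → v) (λ v → v) V V)
                                                  ≤⟨ ℕ.*-mono-≤ length-equal-squares (length-repetitions (set-! _)) ⟩
        2 ℕ.* a ℕ.* length V                      ≤⟨ ℕ.*-monoʳ-≤ (2 ℕ.* a) (ℕ.≤-trans (ℕ.≤-reflexive (card-set _)) translate) ⟩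
        2 ℕ.* a ℕ.* S                             ≡⟨ solveₙ 2 (λ a S → conₙ 2 *ₙ a *ₙ S ≔ conₙ 2 *ₙ S *ₙ a) refl a S ⟩
        2 ℕ.* S ℕ.* a                             ∎)
        where
        V : List F
        V = set (map sq A)
        mixed : List (F × F)
        mixed = C.collisions sq (λ v → v) A V
        a≤ : a ≤ length mixed
        a≤ = ℕ.≤-trans (ℕ.≤-reflexive (sym length-A)) (injection⇒length≤ (λ y → y , sq y) A-!
          (λ y∈ → C.∈-collisions⁺ y∈ (∈-set⁺ (∈-map⁺ sq y∈)) refl) (λ _ _ → cong proj₁))
        translate : card (map sq A) ≤ S
        translate = card-injection (λ v → v - sq (proj₁ x₀∈X))
          (λ v∈ → ∈-⊟⁺ v∈ (∈-map⁺ sq (X⊆A (proj₂ x₀∈X)))) (λ _ _ → +-cancelʳ)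

      -- X is not much smaller than A: x ≥ a / K, because X - A contains a translate of -A.
      a²≤Dx : a ℕ.* a ≤ D ℕ.* x
      a²≤Dx = ℕ.≤-trans (ℕ.*-monoˡ-≤ a translate) below-A
        where
        translate : a ≤ card (X ⊟ A)
        translate = card-injection (λ v → proj₁ x₀∈X - v) (∈-⊟⁺ (proj₂ x₀∈X))
          (λ {v} {w} _ _ eq → trans (sym (-‿involutive v)) (trans (cong -_ (+-cancelˡ eq)) (-‿involutive w)))

      -- Choosing the two dilates.

      -- The second dilate `m` is chosen first, since the threshold for the first dilate `l`
      -- contains f(m). Unless the walk ends at dilate 0, each size exceeds its threshold by a
      -- factor of at most K. Then 4D²f(l)S ≤ a⁵ would contradict `inconsistent`, and its negation
      -- is the lower bound for S. When a threshold is out of reach or the walk ends at 0, the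
      -- bounds are correspondingly simpler.
      difference-of-squares-bound : D ^ 54 ≤ a ^ 55 → a ℕ.* D ℕ.* S ≤ p ^ 2 → a ^ 32 ≤ constant ℕ.* (D ^ 27 ℕ.* S ^ 3)
      difference-of-squares-bound D⁵⁴≤a⁵⁵ aDS≤p² with exists-large-dilate-sum X-! (subst (0 <_) (sym length-X) 0<x)
      ... | l₀ , spread′ = second
        where
        0<S : 0 < S
        0<S = ℕ.n≢0⇒n>0 λ S≡0 → ℕ.<⇒≱ 0<a (subst (λ s → a ≤ 2 ℕ.* s) S≡0 a≤2S)
        x≤a : x ≤ a
        x≤a = card-mono X⊆A
        open ExponentArithmetic 0<a 0<S 0<x x≤a a≤D a²≤Dx a≤2S D⁵⁴≤a⁵⁵
        0<p : 0 < p
        0<p = ∈-length (∈-elements 0#)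
        spread : p ℕ.* (x ℕ.* x) ≤ f l₀ ℕ.* (p ℕ.+ x ℕ.* x)
        spread = subst (λ n → p ℕ.* (n ℕ.* n) ≤ f l₀ ℕ.* (p ℕ.+ n ℕ.* n)) length-X spread′

        first : ∀ m → 5 ℕ.* D ^ 13 ℕ.* S ≤ f m ℕ.* a ^ 13 → f m ℕ.* a ^ 14 ≤ 5 ℕ.* D ^ 14 ℕ.* S → Conclusion
        first m m-large m-small with (5 ℕ.* D ^ 10 ℕ.* x ^ 2 ℕ.* S ℕ.* f m) ℕ.≤? (f l₀ ℕ.* a ^ 14)
        ... | no ¬large = no-first-dilate 5 {F = f l₀} 0<p aDS≤p² spread (≤constant _) (≤constant _) m-small (ℕ.<⇒≤ (ℕ.≰⇒> ¬large))
        ... | yes large with first-dilate (a ^ 14) _ large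
        ...   | l , l-large , l-size with (4 ℕ.* D ^ 2 ℕ.* f l ℕ.* S) ℕ.≤? (a ^ 5)
        ...     | yes l-small = ⊥-elim contradiction
          where
          contradiction : _
          contradiction with ∃-fiber-bound l
          -- 5 is the least k with 16 < k².
          ... | N , crossings≤ , N-is = inconsistent 5 (ℕ.≤ᵇ⇒≤ 17 25 tt) (f-pos l) (f-pos m) a⁴≤SQ (energy-squares-≤ l N crossings≤) (fibre N-is) l-small m-large l-large
            where
            fibre : ∀ {N} → (N ≡ 0 ⊎ ∃ λ q → q ∈ quadruples l × N ≡ length (quadruple-fiber l q)) →
              N ^ 2 ℕ.* f m ^ 2 ℕ.* a ^ 16 ≤
              D ^ 7 ℕ.* ((a ^ 3 ℕ.* f m ^ 2 ℕ.+ D ^ 3 ℕ.* x ^ 2 ℕ.* f l) ℕ.* (a ^ 6 ℕ.* f m ^ 2 ℕ.+ D ^ 6 ℕ.* x ^ 2 ℕ.* f l))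
            fibre (inj₁ refl)            = z≤n
            fibre (inj₂ (q , q∈ , refl)) = fiber-≤ l m q∈
        ...     | no ¬small with l-size
        ...       | inj₁ fl≤x = first-dilate-trivial (ℕ.<⇒≤ (ℕ.≰⇒> ¬small)) fl≤x
        ...       | inj₂ (l′ , l′-small , step) = first-dilate-large 5 (≤constant _) (ℕ.<⇒≤ (ℕ.≰⇒> ¬small)) (begin
          f l ℕ.* a ^ 15                                     ≡⟨ ℕ.*-assoc (f l) a (a ^ 14) ⟨
          f l ℕ.* a ℕ.* a ^ 14                               ≤⟨ ℕ.*-monoˡ-≤ (a ^ 14) step ⟩
          D ℕ.* f l′ ℕ.* a ^ 14                              ≡⟨ ℕ.*-assoc D (f l′) (a ^ 14) ⟩
          D ℕ.* (f l′ ℕ.* a ^ 14)                            ≤⟨ ℕ.*-monoʳ-≤ D (ℕ.<⇒≤ l′-small) ⟩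
          D ℕ.* (5 ℕ.* D ^ 10 ℕ.* x ^ 2 ℕ.* S ℕ.* f m)       ≡⟨ solveₙ 5 (λ k D x S g → D *ₙ (k *ₙ D ^ₙ 10 *ₙ x ^ₙ 2 *ₙ S *ₙ g) ≔ k *ₙ D ^ₙ 11 *ₙ x ^ₙ 2 *ₙ S *ₙ g) refl 5 D x S (f m) ⟩
          5 ℕ.* D ^ 11 ℕ.* x ^ 2 ℕ.* S ℕ.* f m               ∎) m-small

        second : Conclusion
        second with (5 ℕ.* D ^ 13 ℕ.* S) ℕ.≤? (f l₀ ℕ.* a ^ 13)
        -- The first numerical condition reads (2 · 5 · (2 · 5))³ ≤ `constant`. It is the tightest
        -- of all and accounts for the value 100³.
        ... | no ¬large = no-second-dilate 5 {F = f l₀} 0<p aDS≤p² spread (≤constant _) (≤constant _) (ℕ.<⇒≤ (ℕ.≰⇒> ¬large))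
        ... | yes large with first-dilate (a ^ 13) _ large
        -- The walk ended at dilate 0, with f(m) ≤ x ≤ a; a ≤ 2S then supplies the factor S of the
        -- upper bound.
        ...   | m , m-large , inj₁ fm≤x = first m m-large (begin
          f m ℕ.* a ^ 14                  ≤⟨ ℕ.*-mono-≤ (ℕ.≤-trans fm≤x (ℕ.≤-trans x≤a a≤2S)) (ℕ.^-monoˡ-≤ 14 a≤D) ⟩
          2 ℕ.* S ℕ.* D ^ 14              ≤⟨ ℕ.*-monoˡ-≤ (D ^ 14) (ℕ.*-monoˡ-≤ S (ℕ.≤ᵇ⇒≤ 2 5 tt)) ⟩
          5 ℕ.* S ℕ.* D ^ 14              ≡⟨ solveₙ 3 (λ k S D → k *ₙ S *ₙ D ≔ k *ₙ D *ₙ S) refl 5 S (D ^ 14) ⟩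
          5 ℕ.* D ^ 14 ℕ.* S              ∎)
        ...   | m , m-large , inj₂ (m′ , m′-small , step) = first m m-large (begin
          f m ℕ.* a ^ 14                  ≡⟨ ℕ.*-assoc (f m) a (a ^ 13) ⟨
          f m ℕ.* a ℕ.* a ^ 13            ≤⟨ ℕ.*-monoˡ-≤ (a ^ 13) step ⟩
          D ℕ.* f m′ ℕ.* a ^ 13           ≡⟨ ℕ.*-assoc D (f m′) (a ^ 13) ⟩
          D ℕ.* (f m′ ℕ.* a ^ 13)         ≤⟨ ℕ.*-monoʳ-≤ D (ℕ.<⇒≤ m′-small) ⟩
          D ℕ.* (5 ℕ.* D ^ 13 ℕ.* S)      ≡⟨ solveₙ 3 (λ k D S → D *ₙ (k *ₙ D ^ₙ 13 *ₙ S) ≔ k *ₙ D ^ₙ 14 *ₙ S) refl 5 D S ⟩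
          5 ℕ.* D ^ 14 ℕ.* S              ∎)

  differences-of-squares : ∀ 𝔻 → let open Dilates 𝔻 in ∀ {A : List F} {b a D S n} → Unique A → b ∈ A →
    card A ≡ a → card (A ⊟ A) ≡ D → card (map (λ y → y * y) A ⊟ map (λ y → y * y) A) ≡ S → n ≡ p →
    a ℕ.* D ℕ.* S ≤ n ^ 2 → a ≤ D → D ^ 54 ≤ a ^ 55 →
    a ^ 53 ≤ constant ^ 6 ℕ.* (S ^ 17 ℕ.* D ^ 27)
  differences-of-squares 𝔻 {a = a} {D} {S} A-! b∈ refl refl refl refl aDS≤p² a≤D D⁵⁴≤a⁵⁵ with Sumsets.exists-minimalDifference 𝔻 A-! b∈
  ... | X , X-! , X⊆A , 0<x , minimal , below-A =
    a³²-bound⇒a⁵³-bound {a} {D} {S} constant (≤constant 1) (Sumsets.∈⇒0<card 𝔻 b∈) D⁵⁴≤a⁵⁵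
      (EnergyBounds.difference-of-squares-bound 𝔻 A-! X-! X⊆A 0<x minimal below-A a≤D D⁵⁴≤a⁵⁵ aDS≤p²)

open import Defs
open Exponents using (constant; ^-distribʳ-*)
open SumsOfDilates using (FiniteDomain; module Sumsets; differences-of-squares)
open import Data.Nat as ℕ using (ℕ; zero; suc; _≤_; _<_; z≤n; s≤s; _^_; _*_; _+_; _∸_; NonZero)
import Data.Nat.Properties as ℕ
open import Data.Nat.DivMod
open import Data.Nat.Divisibility using (_∣_; ∣⇒≤; m%n≡0⇒n∣m)
open import Data.Nat.Primality using (Prime; euclidsLemma)
open import Data.Bool using (true; false)
open import Data.Fin using (Fin; zero; suc; toℕ)
open import Data.Fin.Properties using (toℕ-injective; toℕ-fromℕ<; toℕ<n; any?)
open import Data.Fin.Subset using (Subset; ∣_∣) renaming (_∈_ to _∈ₛ_)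
open import Data.Fin.Subset.Properties using (∣p∣≤n; _∈?_)
open import Data.Vec using ([]; _∷_; here; there; tabulate)
open import Data.Vec.Properties using (lookup∘tabulate; []=⇒lookup; lookup⇒[]=)
open import Data.List.Base using (List; []; _∷_; length; map; allFin)
open import Data.List.Properties using (length-map; length-tabulate)
open import Data.List.Membership.Propositional using (_∈_)
open import Data.List.Membership.Propositional.Properties using (∈-map⁺; ∈-map⁻; ∈-allFin)
import Data.List.Relation.Unary.Any as Any
open import Data.List.Relation.Unary.All as All using ()
open import Data.List.Relation.Unary.AllPairs using ([]; _∷_)
open import Data.List.Relation.Unary.Unique.Propositional using (Unique)
import Data.List.Relation.Unary.Unique.Propositional.Properties as Unique
open import Data.List.Relation.Binary.Subset.Propositional using (_⊆_)
open import Data.Product using (∃; _×_; _,_; proj₁; proj₂)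
open import Data.Sum using (_⊎_; inj₁; inj₂)
open import Data.Empty using (⊥-elim)
open import Relation.Nullary using (Dec; does; yes)
open import Relation.Nullary.Decidable using (dec-true; _×-dec_)
open import Algebra.Structures using (IsCommutativeRing)
open import Relation.Binary.PropositionalEquality hiding (J; [_])

-- Residues modulo an odd prime as a finite domain.

module ResidueField (n : ℕ) .{{_ : NonZero n}} (n-prime : Prime n) (2<n : 2 < n) where

  [_] : ℕ → Fin n
  [ k ] = k mod n

  infixl 6 _⊕_
  infixl 7 _⊗_

  _⊕_ _⊗_ : Fin n → Fin n → Fin n
  x ⊕ y = [ toℕ x + toℕ y ]
  x ⊗ y = [ toℕ x * toℕ y ]

  ⊖_ : Fin n → Fin n
  ⊖ x = [ n ∸ toℕ x ]

  toℕ-[] : ∀ k → toℕ [ k ] ≡ k % n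
  toℕ-[] k = toℕ-fromℕ< (m%n<n k n)

  []-cong : ∀ {j k} → j % n ≡ k % n → [ j ] ≡ [ k ]
  []-cong {j} {k} eq = toℕ-injective (trans (toℕ-[] j) (trans eq (sym (toℕ-[] k))))

  [toℕ] : ∀ x → [ toℕ x ] ≡ x
  [toℕ] x = toℕ-injective (trans (toℕ-[] (toℕ x)) (m<n⇒m%n≡m (toℕ<n x)))

  -- Reduction commutes with addition. With `[]-⊗` and the variants that have only one reduced
  -- argument, it carries the associative, distributive and unit laws of ℕ over to residues.
  []-⊕ : ∀ j k → [ j ] ⊕ [ k ] ≡ [ j + k ]
  []-⊕ j k = []-cong (trans (cong₂ (λ a b → (a + b) % n) (toℕ-[] j) (toℕ-[] k)) (sym (%-distribˡ-+ j k n)))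

  []-⊗ : ∀ j k → [ j ] ⊗ [ k ] ≡ [ j * k ]
  []-⊗ j k = []-cong (trans (cong₂ (λ a b → (a * b) % n) (toℕ-[] j) (toℕ-[] k)) (sym (%-distribˡ-* j k n)))

  []⊕ : ∀ j x → [ j ] ⊕ x ≡ [ j + toℕ x ]
  []⊕ j x = trans (cong ([ j ] ⊕_) (sym ([toℕ] x))) ([]-⊕ j (toℕ x))

  ⊕[] : ∀ x k → x ⊕ [ k ] ≡ [ toℕ x + k ]
  ⊕[] x k = trans (cong (_⊕ [ k ]) (sym ([toℕ] x))) ([]-⊕ (toℕ x) k)

  []⊗ : ∀ j x → [ j ] ⊗ x ≡ [ j * toℕ x ]
  []⊗ j x = trans (cong ([ j ] ⊗_) (sym ([toℕ] x))) ([]-⊗ j (toℕ x))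

  ⊗[] : ∀ x k → x ⊗ [ k ] ≡ [ toℕ x * k ]
  ⊗[] x k = trans (cong (_⊗ [ k ]) (sym ([toℕ] x))) ([]-⊗ (toℕ x) k)

  0%n≡0 : 0 % n ≡ 0
  0%n≡0 = m*n%n≡0 0 n

  [n]≡[0] : [ n ] ≡ [ 0 ]
  [n]≡[0] = []-cong (trans (n%n≡0 n) (sym 0%n≡0))

  ⊕-assoc : ∀ x y z → x ⊕ y ⊕ z ≡ x ⊕ (y ⊕ z)
  ⊕-assoc x y z = trans ([]⊕ _ z) (trans (cong [_] (ℕ.+-assoc (toℕ x) (toℕ y) (toℕ z))) (sym (⊕[] x _)))

  ⊕-comm : ∀ x y → x ⊕ y ≡ y ⊕ x
  ⊕-comm x y = cong [_] (ℕ.+-comm (toℕ x) (toℕ y))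

  ⊗-assoc : ∀ x y z → x ⊗ y ⊗ z ≡ x ⊗ (y ⊗ z)
  ⊗-assoc x y z = trans ([]⊗ _ z) (trans (cong [_] (ℕ.*-assoc (toℕ x) (toℕ y) (toℕ z))) (sym (⊗[] x _)))

  ⊗-comm : ∀ x y → x ⊗ y ≡ y ⊗ x
  ⊗-comm x y = cong [_] (ℕ.*-comm (toℕ x) (toℕ y))

  ⊕-identityˡ : ∀ x → [ 0 ] ⊕ x ≡ x
  ⊕-identityˡ x = trans ([]⊕ 0 x) ([toℕ] x)

  ⊗-identityˡ : ∀ x → [ 1 ] ⊗ x ≡ x
  ⊗-identityˡ x = trans ([]⊗ 1 x) (trans (cong [_] (ℕ.*-identityˡ (toℕ x))) ([toℕ] x))

  ⊖-inverseˡ : ∀ x → ⊖ x ⊕ x ≡ [ 0 ]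
  ⊖-inverseˡ x = trans ([]⊕ _ x) (trans (cong [_] (ℕ.m∸n+n≡m (ℕ.<⇒≤ (toℕ<n x)))) [n]≡[0])

  ⊗-distribˡ-⊕ : ∀ x y z → x ⊗ (y ⊕ z) ≡ x ⊗ y ⊕ x ⊗ z
  ⊗-distribˡ-⊕ x y z = trans (⊗[] x _) (trans (cong [_] (ℕ.*-distribˡ-+ (toℕ x) (toℕ y) (toℕ z))) (sym ([]-⊕ _ _)))

  isCommutativeRing : IsCommutativeRing _≡_ _⊕_ _⊗_ ⊖_ [ 0 ] [ 1 ]
  isCommutativeRing = record
    { isRing = record
      { +-isAbelianGroup = record
        { isGroup = record
          { isMonoid = record
            { isSemigroup = record
              { isMagma = record { isEquivalence = isEquivalence ; ∙-cong = cong₂ _⊕_ }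
              ; assoc = ⊕-assoc }
            ; identity = ⊕-identityˡ , λ x → trans (⊕-comm x _) (⊕-identityˡ x) }
          ; inverse = ⊖-inverseˡ , λ x → trans (⊕-comm x _) (⊖-inverseˡ x)
          ; ⁻¹-cong = cong ⊖_ }
        ; comm = ⊕-comm }
      ; *-cong = cong₂ _⊗_
      ; *-assoc = ⊗-assoc
      ; *-identity = ⊗-identityˡ , λ x → trans (⊗-comm x _) (⊗-identityˡ x)
      ; distrib = ⊗-distribˡ-⊕ , λ x y z → trans (⊗-comm (y ⊕ z) x) (trans (⊗-distribˡ-⊕ x y z) (cong₂ _⊕_ (⊗-comm x y) (⊗-comm x z)))
      }
    ; *-comm = ⊗-comm }

  divisible⇒0 : ∀ x → n ∣ toℕ x → x ≡ [ 0 ]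
  divisible⇒0 x n∣x with toℕ x in eq
  ... | zero  = trans (sym ([toℕ] x)) (cong [_] eq)
  ... | suc _ = ⊥-elim (ℕ.<⇒≱ (toℕ<n x) (subst (n ≤_) (sym eq) (∣⇒≤ n∣x)))

  integral : ∀ {x y} → x ⊗ y ≡ [ 0 ] → x ≡ [ 0 ] ⊎ y ≡ [ 0 ]
  integral {x} {y} eq with euclidsLemma (toℕ x) (toℕ y) n-prime (m%n≡0⇒n∣m _ n
      (trans (sym (toℕ-[] _)) (trans (cong toℕ eq) (trans (toℕ-[] 0) 0%n≡0))))
  ... | inj₁ n∣x = inj₁ (divisible⇒0 x n∣x)
  ... | inj₂ n∣y = inj₂ (divisible⇒0 y n∣y)

  2≢0 : [ 1 ] ⊕ ([ 1 ] ⊕ [ 0 ]) ≢ [ 0 ]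
  2≢0 eq with trans (sym (m<n⇒m%n≡m 2<n)) (trans (sym (toℕ-[] 2)) (trans (cong toℕ two) (trans (toℕ-[] 0) 0%n≡0)))
    where
    two : [ 2 ] ≡ [ 0 ]
    two = trans (sym (trans (cong ([ 1 ] ⊕_) ([]-⊕ 1 0)) ([]-⊕ 1 1))) eq
  ... | ()

  domain : FiniteDomain
  domain = record
    { F = Fin n ; _+_ = _⊕_ ; _*_ = _⊗_ ; -_ = ⊖_ ; 0# = [ 0 ] ; 1# = [ 1 ]
    ; isCommutativeRing = isCommutativeRing
    ; integral = integral
    ; _≟_ = Data.Fin._≟_
    ; elements = allFin n
    ; elements-! = Unique.allFin⁺ n
    ; ∈-elements = ∈-allFin
    ; 2#≢0# = 2≢0
    ; generated = generated
    }
    where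
    open import Algebra.Bundles using (CommutativeRing)
    ring : CommutativeRing _ _
    ring = record { isCommutativeRing = isCommutativeRing }
    open import Algebra.Properties.Semiring.Mult (CommutativeRing.semiring ring) using () renaming (_×_ to _×ₙ_)
    open import Algebra.Properties.Ring (CommutativeRing.ring ring) using (-‿involutive)
    multiples : ∀ k → k ×ₙ [ 1 ] ≡ [ k ]
    multiples zero    = refl
    multiples (suc k) = trans (cong ([ 1 ] ⊕_) (multiples k)) ([]-⊕ 1 k)
    generated : ∀ x → ∃ λ k → x ≡ ⊖ (k ×ₙ [ 1 ])
    generated x = toℕ (⊖ x) , sym (trans (cong ⊖_ (trans (multiples _) ([toℕ] (⊖ x)))) (-‿involutive x))

-- Subsets as lists without repetition.

members : ∀ {n} → Subset n → List (Fin n)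
members []          = []
members (true ∷ A)  = zero ∷ map suc (members A)
members (false ∷ A) = map suc (members A)

length-members : ∀ {n} (A : Subset n) → length (members A) ≡ ∣ A ∣
length-members []          = refl
length-members (true ∷ A)  = cong suc (trans (length-map suc (members A)) (length-members A))
length-members (false ∷ A) = trans (length-map suc (members A)) (length-members A)

∈-members⁺ : ∀ {n} {A : Subset n} {x} → x ∈ₛ A → x ∈ members A
∈-members⁺ {A = true ∷ A}  here       = Any.here refl
∈-members⁺ {A = true ∷ A}  (there x∈) = Any.there (∈-map⁺ suc (∈-members⁺ x∈))
∈-members⁺ {A = false ∷ A} (there x∈) = ∈-map⁺ suc (∈-members⁺ x∈)

∈-members⁻ : ∀ {n} {A : Subset n} {x} → x ∈ members A → x ∈ₛ A
∈-members⁻ {A = true ∷ A}  (Any.here refl) = here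
∈-members⁻ {A = true ∷ A}  (Any.there p) with ∈-map⁻ suc p
... | y , y∈ , refl = there (∈-members⁻ y∈)
∈-members⁻ {A = false ∷ A} p with ∈-map⁻ suc p
... | y , y∈ , refl = there (∈-members⁻ y∈)

members-! : ∀ {n} (A : Subset n) → Unique (members A)
members-! []          = []
members-! (true ∷ A)  = All.tabulate 0≢ ∷ Unique.map⁺ (λ where refl → refl) (members-! A)
  where
  0≢ : ∀ {x} → x ∈ map suc (members A) → zero ≢ x
  0≢ p refl with ∈-map⁻ suc p
  ... | _ , _ , ()
members-! (false ∷ A) = Unique.map⁺ (λ where refl → refl) (members-! A)

∈-tabulate⁺ : ∀ {n} {P : Fin n → Set} (P? : ∀ x → Dec (P x)) {x} → P x → x ∈ₛ tabulate (λ z → does (P? z))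
∈-tabulate⁺ P? {x} px = lookup⇒[]= x _ (trans (lookup∘tabulate _ x) (dec-true (P? x) px))

∈-tabulate⁻ : ∀ {n} {P : Fin n → Set} (P? : ∀ x → Dec (P x)) {x} → x ∈ₛ tabulate (λ z → does (P? z)) → P x
∈-tabulate⁻ P? {x} x∈ with P? x | trans (sym (lookup∘tabulate (λ z → does (P? z)) x)) ([]=⇒lookup x∈)
... | yes px | _ = px

-- For a ≤ 1 the power of a is too small to exceed that of D. From 2 ≤ a < D ≤ p it follows that p >
-- 2, so that 2 is non-zero in the field.
2≤base : ∀ {a D} i j → a < D → D ^ i < a ^ suc j → 2 ≤ a
2≤base {zero}        i j a<D ()
2≤base {suc zero} {D} i j a<D Dⁱ<1 = ⊥-elim (ℕ.<⇒≱ (subst (D ^ i <_) (ℕ.^-zeroˡ (suc j)) Dⁱ<1)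
  (ℕ.m^n>0 D {{ℕ.>-nonZero (ℕ.≤-trans (s≤s z≤n) a<D)}} i))
2≤base {suc (suc _)} i j a<D _  = s≤s (s≤s z≤n)

-- From lists in the abstract domain to subsets of `Fin p`.

module _ (p : ℕ) .{{_ : NonZero p}} (p-prime : Prime p) (A : Subset p)
  (aDS≤p² : ∣ A ∣ * ∣ diffSet p A A ∣ * ∣ diffSet p (sqSet p A) (sqSet p A) ∣ ≤ p ^ 2)
  (a<D : ∣ A ∣ < ∣ diffSet p A A ∣) (D⁵⁴<a⁵⁵ : ∣ diffSet p A A ∣ ^ 54 < ∣ A ∣ ^ 55) where

  private
    B = sqSet p A

    2≤a : 2 ≤ ∣ A ∣
    2≤a = 2≤base 54 54 a<D D⁵⁴<a⁵⁵

    2<p : 2 < p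
    2<p = ℕ.≤-trans (ℕ.≤-trans (s≤s 2≤a) a<D) (∣p∣≤n (diffSet p A A))

    open ResidueField p p-prime 2<p
    open Sumsets domain using (card; card-mono; card-unique; _⊟_; ⊟-mono; ∈-⊟⁺; ∈-⊟⁻)

    card-members : ∀ X → card (members X) ≡ ∣ X ∣
    card-members X = trans (card-unique (members-! X)) (length-members X)

    -- subF adds the representative p ∸ y, the ring subtraction its residue.
    subF≡ : ∀ x y → subF p x y ≡ x ⊕ ⊖ y
    subF≡ x y = sym (⊕[] x _)

    Difference : Subset p → Subset p → Fin p → Set
    Difference X Y z = ∃ λ x → ∃ λ y → x ∈ₛ X × y ∈ₛ Y × subF p x y ≡ z

    Square : Fin p → Set
    Square z = ∃ λ y → y ∈ₛ A × sqF p y ≡ z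

    -- Repeats the decision procedure inside `diffSet`, so that `∈-tabulate⁺` and `∈-tabulate⁻`
    -- apply to `diffSet` by computation.
    difference? : ∀ X Y z → Dec (Difference X Y z)
    difference? X Y z = any? λ x → any? λ y → (x ∈? X) ×-dec ((y ∈? Y) ×-dec (subF p x y Data.Fin.≟ z))

    square? : ∀ z → Dec (Square z)
    square? z = any? λ y → (y ∈? A) ×-dec (sqF p y Data.Fin.≟ z)

    card-diffSet : ∀ X Y → card (members X ⊟ members Y) ≡ ∣ diffSet p X Y ∣
    card-diffSet X Y = trans (ℕ.≤-antisym (card-mono into) (card-mono from)) (card-members (diffSet p X Y))
      where
      into : members X ⊟ members Y ⊆ members (diffSet p X Y)
      into z∈ with ∈-⊟⁻ z∈
      ... | x , y , x∈ , y∈ , refl = ∈-members⁺ (∈-tabulate⁺ (difference? X Y) (x , y , ∈-members⁻ x∈ , ∈-members⁻ y∈ , subF≡ x y))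
      from : members (diffSet p X Y) ⊆ members X ⊟ members Y
      from z∈ with ∈-tabulate⁻ (difference? X Y) (∈-members⁻ {A = diffSet p X Y} z∈)
      ... | x , y , x∈ , y∈ , refl = subst (_∈ members X ⊟ members Y) (sym (subF≡ x y)) (∈-⊟⁺ (∈-members⁺ x∈) (∈-members⁺ y∈))

    squares : map (λ y → y ⊗ y) (members A) ⊆ members B
    squares z∈ with ∈-map⁻ (λ y → y ⊗ y) z∈
    ... | y , y∈ , refl = ∈-members⁺ (∈-tabulate⁺ square? (y , ∈-members⁻ y∈ , refl))

    squares⁻ : members B ⊆ map (λ y → y ⊗ y) (members A)
    squares⁻ z∈ with ∈-tabulate⁻ square? (∈-members⁻ {A = B} z∈)
    ... | y , y∈ , refl = ∈-map⁺ (λ y → y ⊗ y) (∈-members⁺ y∈)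

    card-squares : card (map (λ y → y ⊗ y) (members A) ⊟ map (λ y → y ⊗ y) (members A)) ≡ ∣ diffSet p B B ∣
    card-squares = trans (ℕ.≤-antisym (card-mono (⊟-mono squares squares)) (card-mono (⊟-mono squares⁻ squares⁻))) (card-diffSet B B)

    first-member : ∃ (_∈ members A)
    first-member with members A in eq
    ... | []    = ⊥-elim (ℕ.<⇒≱ 2≤a (subst (_≤ 1) (trans (cong length (sym eq)) (length-members A)) z≤n))
    ... | x ∷ _ = x , Any.here refl

  subset-bound : ∣ A ∣ ^ 53 ≤ constant ^ 6 * (∣ diffSet p B B ∣ ^ 17 * ∣ diffSet p A A ∣ ^ 27)
  subset-bound = differences-of-squares domain (members-! A) (proj₂ first-member)
    (card-members A) (card-diffSet A A) card-squares (sym (length-tabulate {n = p} (λ x → x))) aDS≤p² (ℕ.<⇒≤ a<D) (ℕ.<⇒≤ D⁵⁴<a⁵⁵)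

-- `m` stands for 1/ε′, and `C` depends on it alone. Taking 17m-th roots and putting D = a^(1+ε)
-- turns the inequality into a^(1 + (9 - 27ε)/17) ≤ C^(1/(17m)) p^(1/m) S; the condition D⁵⁴ < a⁵⁵
-- is ε < 1/54.
theorem1p5 : (m : ℕ) → 1 ≤ m →
    ∃ λ (C : ℕ) →
    (p : ℕ) .{{_ : NonZero p}} → Prime p → (A : Subset p) →
    ∣ A ∣ * ∣ diffSet p A A ∣ * ∣ diffSet p (sqSet p A) (sqSet p A) ∣ ≤ p ^ 2 →
    ∣ A ∣ < ∣ diffSet p A A ∣ →
    ∣ diffSet p A A ∣ ^ 54 < ∣ A ∣ ^ 55 →
    ∣ A ∣ ^ (53 * m) ≤
    C * p ^ 17 * ∣ diffSet p (sqSet p A) (sqSet p A) ∣ ^ (17 * m) * ∣ diffSet p A A ∣ ^ (27 * m)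
theorem1p5 m _ = C , proof
  where
  open ℕ.≤-Reasoning
  C : ℕ
  C = (constant ^ 6) ^ m
  proof : (p : ℕ) .{{_ : NonZero p}} → Prime p → (A : Subset p) →
    ∣ A ∣ * ∣ diffSet p A A ∣ * ∣ diffSet p (sqSet p A) (sqSet p A) ∣ ≤ p ^ 2 →
    ∣ A ∣ < ∣ diffSet p A A ∣ →
    ∣ diffSet p A A ∣ ^ 54 < ∣ A ∣ ^ 55 →
    ∣ A ∣ ^ (53 * m) ≤
    C * p ^ 17 * ∣ diffSet p (sqSet p A) (sqSet p A) ∣ ^ (17 * m) * ∣ diffSet p A A ∣ ^ (27 * m)
  proof p p-prime A aDS≤p² a<D D⁵⁴<a⁵⁵ = begin
    a ^ (53 * m)                                 ≡⟨ ℕ.^-*-assoc a 53 m ⟨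
    (a ^ 53) ^ m                                 ≤⟨ ℕ.^-monoˡ-≤ m (subset-bound p p-prime A aDS≤p² a<D D⁵⁴<a⁵⁵) ⟩
    (constant ^ 6 * (S ^ 17 * D ^ 27)) ^ m       ≡⟨ ^-distribʳ-* (constant ^ 6) (S ^ 17 * D ^ 27) m ⟩
    C * (S ^ 17 * D ^ 27) ^ m                    ≡⟨ cong (C *_) (^-distribʳ-* (S ^ 17) (D ^ 27) m) ⟩
    C * ((S ^ 17) ^ m * (D ^ 27) ^ m)            ≡⟨ cong₂ (λ u v → C * (u * v)) (ℕ.^-*-assoc S 17 m) (ℕ.^-*-assoc D 27 m) ⟩
    C * (S ^ (17 * m) * D ^ (27 * m))            ≡⟨ ℕ.*-assoc C _ _ ⟨
    C * S ^ (17 * m) * D ^ (27 * m)              ≤⟨ ℕ.*-monoˡ-≤ (D ^ (27 * m)) (ℕ.*-monoˡ-≤ (S ^ (17 * m)) (ℕ.m≤m*n C (p ^ 17) {{ℕ.m^n≢0 p 17}})) ⟩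
    C * p ^ 17 * S ^ (17 * m) * D ^ (27 * m)     ∎
    where
    a = ∣ A ∣
    D = ∣ diffSet p A A ∣
    S = ∣ diffSet p (sqSet p A) (sqSet p A) ∣
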